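{- Let $(a,b,c)$ be any one of the seven triples $$(1,2,3),\ (1,2,4),\ (1,2,5),\ (2,2,4),\ (2,2,5),\ (2,3,3),\ (2,3,4).$$ Then $\{x(ax+1)+y(by+1)+z(cz+1):\ x,y,z\in\mathbb{Z}\}=\mathbb{N}$, where $\mathbb{N}=\{0,1,2,\ldots\}$. -}

module Defs where

open import Data.Nat using (ℕ)
open import Data.Integer using (ℤ; +_; _+_; _*_; 1ℤ)
open import Data.List using (List; _∷_; [])
open import Data.Product using (_×_; _,_)

f : ℤ → ℤ → ℤ → ℤ → ℤ → ℤ → ℤ
f a b c x y z = x * (a * x + 1ℤ) + y * (b * y + 1ℤ) + z * (c * z + 1ℤ)

triples : List (ℕ × ℕ × ℕ)
triples = (1 , 2 , 3) ∷ (1 , 2 , 4) ∷ (1 , 2 , 5) ∷ (2 , 2 , 4)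
        ∷ (2 , 2 , 5) ∷ (2 , 3 , 3) ∷ (2 , 3 , 4) ∷ []

module Submission where

-- Completing squares turns the claim for (a, b, c) into the representation of one number N in a fixed
-- arithmetic progression by a ternary form, subject to congruences: by x² + y² + z² for five of the triples,
-- by x² + y² + 3z² for (2,3,3) and by x² + 2y² + 2yz + 3z² for (1,2,5). The congruences are met by permuting
-- and changing signs, after a descent in Z[i] or Z[√-2] in the exceptional cases of (2,2,5) and (2,3,4).
--
-- A number N is represented by some positive ternary form of determinant 1, 3 or 5 as soon as there are m, s, t
-- with m ∣ t² + D N and N ∣ 1 + e m s², and the form is then identified by reduction and by the values that it
-- omits. To find m without Dirichlet's theorem, let χ be the Jacobi symbol (-M / ·), M = v² D N, and
-- r(m) = Σ_{d ∣ m} χ(d). If r(m) ≠ 0 then m = m′ s² with -M a square modulo m′, so it suffices that a class c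
-- modulo Q = 4M with χ(c) = 1 contains some m with r(m) ≠ 0. With the weight (Z ∸ m), Z = (BQ)², the sums of
-- r over the classes c and 1 differ by O(Z), since χ(a) ([ab ≡ c] - [ab ≡ 1]) has zero row and column sums; but
-- squares alone make the sum over the class 1 at least of order Z^{3/2}.

-- Without the weight `Z ∸ m` the comparison would be inconclusive: the unweighted sums over the two
-- classes differ by O(√Z), and this is also the order of the number of squares below Z. An affine
-- weight still cancels over whole periods, and it multiplies the contribution of the squares by Z
-- but the error only by √Z.
--
-- For N in a given progression the class c is fixed by e c + 1 = w N with w ∣ v² D. Then e c ≡ -1
-- modulo N, so m s² ≡ c gives N ∣ 1 + e m s². Moreover M = v² D N = v² D / w + (v² D e / w) c, so
-- modulo c the growing M reduces to v² D / w, which is 2, 4 or 6, and the symbol of c for such a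
-- fixed modulus is periodic with a small period. The square v² does not affect whether -M is a
-- residue modulo a number prime to v; it makes M even and leaves room for w.
--
-- For the determinants 3 and 5 two reduced forms survive. The wrong one is excluded because m is
-- known to be 1 modulo 3, or prime to 5, which makes the value 6, or 5, locally impossible.

module BigOp where

  open import Algebra.Structures using (IsCommutativeMonoid)
  import Data.Integer.Base as ℤ
  import Data.Integer.Properties as ℤ
  open import Data.Nat.Base using (ℕ; zero; suc; _+_; _*_; _<_; _≤_)
  open import Data.Nat.Properties using (n<1+n; m<n⇒m<1+n; m<1+n⇒m<n∨m≡n; <-irrefl; m≤n⇒∃[o]m+o≡n; m≤m+n; +-0-isCommutativeMonoid; +-suc; +-identityʳ; +-comm; _≟_)
  open import Data.Product using (_,_)
  open import Data.Sum using (inj₁; inj₂)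
  open import Function.Base using (_∘_)
  open import Relation.Binary.PropositionalEquality
  open import Relation.Nullary using (Dec; yes; no; contradiction)

  -- Folds over a commutative monoid.

  module Fold {A : Set} (_∙_ : A → A → A) (ε : A) (isCM : IsCommutativeMonoid _≡_ _∙_ ε) where

    open IsCommutativeMonoid isCM using (assoc; identityˡ; identityʳ; comm)
    open ≡-Reasoning

    fold : ℕ → (ℕ → A) → A
    fold zero    f = ε
    fold (suc n) f = fold n f ∙ f n

    fold-cong : ∀ n {f g} → (∀ i → i < n → f i ≡ g i) → fold n f ≡ fold n g
    fold-cong zero    f≡g = refl
    fold-cong (suc n) f≡g =
      cong₂ _∙_ (fold-cong n (λ i i<n → f≡g i (m<n⇒m<1+n i<n))) (f≡g n (n<1+n n))

    fold-ε : ∀ n {f} → (∀ i → i < n → f i ≡ ε) → fold n f ≡ ε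
    fold-ε zero    f≡ε = refl
    fold-ε (suc n) f≡ε = trans
      (cong₂ _∙_ (fold-ε n (λ i i<n → f≡ε i (m<n⇒m<1+n i<n))) (f≡ε n (n<1+n n)))
      (identityˡ ε)

    interchange : ∀ a b c d → (a ∙ b) ∙ (c ∙ d) ≡ (a ∙ c) ∙ (b ∙ d)
    interchange a b c d = begin
      (a ∙ b) ∙ (c ∙ d) ≡⟨ assoc a b (c ∙ d) ⟩
      a ∙ (b ∙ (c ∙ d)) ≡⟨ cong (a ∙_) (sym (assoc b c d)) ⟩
      a ∙ ((b ∙ c) ∙ d) ≡⟨ cong (λ x → a ∙ (x ∙ d)) (comm b c) ⟩
      a ∙ ((c ∙ b) ∙ d) ≡⟨ cong (a ∙_) (assoc c b d) ⟩
      a ∙ (c ∙ (b ∙ d)) ≡⟨ sym (assoc a c (b ∙ d)) ⟩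
      (a ∙ c) ∙ (b ∙ d) ∎

    fold-∙ : ∀ n f g → fold n (λ i → f i ∙ g i) ≡ fold n f ∙ fold n g
    fold-∙ zero    f g = sym (identityˡ ε)
    fold-∙ (suc n) f g =
      trans (cong (_∙ (f n ∙ g n)) (fold-∙ n f g)) (interchange _ _ _ _)

    fold-swap : ∀ m n (f : ℕ → ℕ → A) →
                fold m (λ i → fold n (f i)) ≡ fold n (λ j → fold m (λ i → f i j))
    fold-swap zero    n f = sym (fold-ε n (λ _ _ → refl))
    fold-swap (suc m) n f =
      trans (cong (_∙ fold n (f m)) (fold-swap m n f)) (sym (fold-∙ n _ _))

    fold-single : ∀ n {f} j → j < n → (∀ i → i < n → i ≢ j → f i ≡ ε) → fold n f ≡ f j
    fold-single (suc n) {f} j j<1+n f≡ε with m<1+n⇒m<n∨m≡n j<1+n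
    ... | inj₁ j<n  = trans
      (cong₂ _∙_ (fold-single n j j<n (λ i i<n → f≡ε i (m<n⇒m<1+n i<n)))
                 (f≡ε n (n<1+n n) (λ { refl → <-irrefl refl j<n })))
      (identityʳ _)
    ... | inj₂ refl = trans
      (cong (_∙ f n) (fold-ε n (λ i i<n → f≡ε i (m<n⇒m<1+n i<n) (λ { refl → <-irrefl refl i<n }))))
      (identityˡ _)

    fold-+ : ∀ m n f → fold (m + n) f ≡ fold m f ∙ fold n (λ i → f (m + i))
    fold-+ m zero    f = trans (cong (λ k → fold k f) (+-identityʳ m)) (sym (identityʳ _))
    fold-+ m (suc n) f = begin
      fold (m + suc n) f                                  ≡⟨ cong (λ k → fold k f) (+-suc m n) ⟩
      fold (m + n) f ∙ f (m + n)                          ≡⟨ cong (_∙ f (m + n)) (fold-+ m n f) ⟩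
      (fold m f ∙ fold n (λ i → f (m + i))) ∙ f (m + n)   ≡⟨ assoc _ _ _ ⟩
      fold m f ∙ (fold n (λ i → f (m + i)) ∙ f (m + n))   ∎

    fold-suc : ∀ n f → fold (suc n) f ≡ f 0 ∙ fold n (λ i → f (suc i))
    fold-suc n f = trans (fold-+ 1 n f) (cong₂ _∙_ (identityˡ (f 0)) refl)

    fold-extend : ∀ {m n} f → m ≤ n → (∀ i → m ≤ i → f i ≡ ε) → fold n f ≡ fold m f
    fold-extend {m} f m≤n f≡ε with m≤n⇒∃[o]m+o≡n m≤n
    ... | o , refl = trans (fold-+ m o f)
      (trans (cong (fold m f ∙_) (fold-ε o (λ i _ → f≡ε (m + i) (m≤m+n m i)))) (identityʳ _))

    fold-blocks : ∀ n k f → fold (n * k) f ≡ fold n (λ i → fold k (λ j → f (i * k + j)))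
    fold-blocks zero    k f = refl
    fold-blocks (suc n) k f = begin
      fold (k + n * k) f                            ≡⟨ cong (λ l → fold l f) (+-comm k (n * k)) ⟩
      fold (n * k + k) f                            ≡⟨ fold-+ (n * k) k f ⟩
      fold (n * k) f ∙ fold k (λ j → f (n * k + j)) ≡⟨ cong₂ _∙_ (fold-blocks n k f) refl ⟩
      fold (suc n) (λ i → fold k (λ j → f (i * k + j))) ∎

    when : {P : Set} → Dec P → A → A
    when (yes _) x = x
    when (no  _) x = ε

    when-true : {P : Set} (p? : Dec P) {x : A} → P → when p? x ≡ x
    when-true (yes _) p = refl
    when-true (no ¬p) p = contradiction p ¬p

    when-false : {P : Set} (p? : Dec P) {x : A} → (P → x ≡ ε) → when p? x ≡ ε
    when-false (yes p) ¬p = ¬p p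
    when-false (no _)  ¬p = refl

    -- Both sides are the double fold of the graph of π.
    fold-permute : ∀ n (π ρ : ℕ → ℕ) f →
                   (∀ i → i < n → π i < n) → (∀ i → i < n → ρ i < n) →
                   (∀ i → i < n → ρ (π i) ≡ i) → (∀ i → i < n → π (ρ i) ≡ i) →
                   fold n (f ∘ π) ≡ fold n f
    fold-permute n π ρ f π< ρ< ρπ πρ = begin
      fold n (f ∘ π)                                          ≡⟨ sym (fold-cong n rows) ⟩
      fold n (λ i → fold n (λ j → when (π i ≟ j) (f j)))      ≡⟨ fold-swap n n _ ⟩
      fold n (λ j → fold n (λ i → when (π i ≟ j) (f j)))      ≡⟨ fold-cong n columns ⟩
      fold n f                                                ∎
      where
      rows : ∀ i → i < n → fold n (λ j → when (π i ≟ j) (f j)) ≡ f (π i)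
      rows i i<n = trans
        (fold-single n (π i) (π< i i<n)
          (λ j _ j≢ → when-false (π i ≟ j) (λ eq → contradiction (sym eq) j≢)))
        (when-true (π i ≟ π i) refl)
      columns : ∀ j → j < n → fold n (λ i → when (π i ≟ j) (f j)) ≡ f j
      columns j j<n = trans
        (fold-single n (ρ j) (ρ< j j<n)
          (λ i i<n i≢ → when-false (π i ≟ j) (λ eq → contradiction (trans (sym (ρπ i i<n)) (cong ρ eq)) i≢)))
        (when-true (π (ρ j) ≟ j) (πρ j j<n))

  module ∑ℕ = Fold _+_ 0 +-0-isCommutativeMonoid
  module ∑ = Fold ℤ._+_ ℤ.0ℤ ℤ.+-0-isCommutativeMonoid
  module ∏ = Fold ℤ._*_ ℤ.1ℤ ℤ.*-1-isCommutativeMonoid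

open import Data.Nat.Base as ℕ using (ℕ; zero; suc; NonZero; z≤n; s≤s)
import Data.Nat.Divisibility as ℕ
import Data.Nat.Properties as ℕ
import Data.Nat.Tactic.RingSolver as ℕ
open import Data.Integer.Base as ℤ using (ℤ; +_; -_; _+_; _-_; _*_; 0ℤ; 1ℤ)
import Data.Integer.Properties as ℤ
open import Data.Integer.Tactic.RingSolver using (solve-∀)
open import Data.Product using (_×_; _,_; ∃-syntax; proj₁; proj₂)
open import Data.Sum using (_⊎_; inj₁; inj₂)
open import Relation.Binary.PropositionalEquality
open import Relation.Nullary using (¬_; Dec; yes; no; contradiction)

-- Residues modulo n up to sign.

module Folding where

  open import Data.Nat.DivMod using (_/_; _%_; m≡m%n+[m/n]*n; m%n<n)
  open import Data.Integer.Base using (∣_∣)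
  open import Data.Integer.Divisibility.Signed
  open import Relation.Binary.Definitions using (tri<; tri≈; tri>)

  ∣-resp : ∀ {k x y} → x ≡ y → k ∣ x → k ∣ y
  ∣-resp refl d = d

  pos-∣ : ∀ {m n} → m ℕ.∣ n → + m ∣ + n
  pos-∣ = ∣ᵤ⇒∣

  module Dist (n : ℕ) .{{_ : NonZero n}} where

    -- i is the distance from x to the nearest multiple of n.
    data Folded (x : ℕ) : ℕ → Set where
      below : ∀ i → i ℕ.+ i ℕ.≤ n → x ≡ i ℕ.+ x / n ℕ.* n → Folded x i
      above : ∀ i → 0 ℕ.< i → i ℕ.+ i ℕ.< n → x ℕ.+ i ≡ suc (x / n) ℕ.* n → Folded x i

    folded : ∀ x → ∃[ i ] Folded x i
    folded x with (x % n ℕ.+ x % n) ℕ.≤? n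
    ... | yes 2r≤n = x % n , below _ 2r≤n (m≡m%n+[m/n]*n x n)
    ... | no  2r≰n with ℕ.m≤n⇒∃[o]m+o≡n (m%n<n x n)
    ...   | o , r+o≡n = suc o , above _ (s≤s z≤n) 2i<n x+i≡
      where
      r = x % n
      r+i≡n : r ℕ.+ suc o ≡ n
      r+i≡n = trans (ℕ.+-suc r o) r+o≡n
      i<r : suc o ℕ.< r
      i<r = ℕ.+-cancelˡ-< r _ _ (subst (ℕ._< r ℕ.+ r) (sym r+i≡n) (ℕ.≰⇒> 2r≰n))
      2i<n : suc o ℕ.+ suc o ℕ.< n
      2i<n = subst (suc o ℕ.+ suc o ℕ.<_) r+i≡n (ℕ.+-monoˡ-< (suc o) i<r)
      x+i≡ : x ℕ.+ suc o ≡ suc (x / n) ℕ.* n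
      x+i≡ = trans (cong (ℕ._+ suc o) (m≡m%n+[m/n]*n x n))
        (trans (shuffle r (x / n ℕ.* n) (suc o)) (cong (ℕ._+ x / n ℕ.* n) r+i≡n))
        where
        shuffle : ∀ a b c → a ℕ.+ b ℕ.+ c ≡ a ℕ.+ c ℕ.+ b
        shuffle = ℕ.solve-∀

    dist : ℕ → ℕ
    dist x = proj₁ (folded x)

    dist-folded : ∀ x → Folded x (dist x)
    dist-folded x = proj₂ (folded x)

    Folded-≤ : ∀ {x i} → Folded x i → i ℕ.+ i ℕ.≤ n
    Folded-≤ (below _ le _)   = le
    Folded-≤ (above _ _ lt _) = ℕ.<⇒≤ lt

    dist-≤ : ∀ x → dist x ℕ.+ dist x ℕ.≤ n
    dist-≤ x = Folded-≤ (dist-folded x)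

    infix 4 _≈±_

    data _≈±_ (x y : ℤ) : Set where
      minus : + n ∣ x - y → x ≈± y
      plus  : + n ∣ x + y → x ≈± y

    Folded-≈± : ∀ {x i} → Folded x i → + x ≈± + i
    Folded-≈± {x} (below i _ eq) = minus (divides (+ (x / n)) (begin
        + x - + i                              ≡⟨ cong (λ y → + y - + i) eq ⟩
        + (i ℕ.+ x / n ℕ.* n) - + i            ≡⟨ cong (_- + i) (ℤ.pos-+ i _) ⟩
        + i + + (x / n ℕ.* n) - + i            ≡⟨ drop (+ i) _ ⟩
        + (x / n ℕ.* n)                        ≡⟨ ℤ.pos-* (x / n) n ⟩
        + (x / n) * + n                        ∎))
      where
      open ≡-Reasoning
      drop : ∀ a b → a + b - a ≡ b
      drop = solve-∀
    Folded-≈± {x} (above i _ _ eq) = plus (divides (+ suc (x / n))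
      (trans (cong +_ eq) (ℤ.pos-* (suc (x / n)) n)))

    ≈±-trans : ∀ {x y z} → x ≈± y → y ≈± z → x ≈± z
    ≈±-trans {x} {y} {z} (minus p) (minus q) = minus (∣-resp (lem x y z) (∣m∣n⇒∣m+n p q))
      where lem : ∀ x y z → (x - y) + (y - z) ≡ x - z
            lem = solve-∀
    ≈±-trans {x} {y} {z} (minus p) (plus q) = plus (∣-resp (lem x y z) (∣m∣n⇒∣m+n p q))
      where lem : ∀ x y z → (x - y) + (y + z) ≡ x + z
            lem = solve-∀
    ≈±-trans {x} {y} {z} (plus p) (minus q) = plus (∣-resp (lem x y z) (∣m∣n⇒∣m-n p q))
      where lem : ∀ x y z → (x + y) - (y - z) ≡ x + z
            lem = solve-∀
    ≈±-trans {x} {y} {z} (plus p) (plus q) = minus (∣-resp (lem x y z) (∣m∣n⇒∣m-n p q))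
      where lem : ∀ x y z → (x + y) - (y + z) ≡ x - z
            lem = solve-∀

    ≈±-* : ∀ {x y} a → x ≈± y → (a * x) ≈± (a * y)
    ≈±-* {x} {y} a (minus p) = minus (∣-resp (lem a x y) (∣n⇒∣m*n a p))
      where lem : ∀ a x y → a * (x - y) ≡ a * x - a * y
            lem = solve-∀
    ≈±-* {x} {y} a (plus p) = plus (∣-resp (lem a x y) (∣n⇒∣m*n a p))
      where lem : ∀ a x y → a * (x + y) ≡ a * x + a * y
            lem = solve-∀

    2i≤n⇒i<n : ∀ {i} → i ℕ.+ i ℕ.≤ n → i ℕ.< n
    2i≤n⇒i<n {zero}  _  = ℕ.>-nonZero⁻¹ n
    2i≤n⇒i<n {suc i} le = ℕ.<-≤-trans (ℕ.m<m+n (suc i) (s≤s z≤n)) le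

    small-multiple : ∀ {k} → k ℕ.< n → n ℕ.∣ k → k ≡ 0
    small-multiple {zero}  _   _ = refl
    small-multiple {suc k} k<n d = contradiction (ℕ.∣⇒≤ d) (ℕ.<⇒≱ k<n)

    ∣i-j∣-< : ∀ i j → i ℕ.< n → j ℕ.< n → ∣ + i - + j ∣ ℕ.< n
    ∣i-j∣-< i j i<n j<n = ℕ.≤-<-trans
      (subst (ℕ._≤ i ℕ.⊔ j) (cong ∣_∣ (sym (ℤ.m-n≡m⊖n i j))) (ℤ.∣m⊝n∣≤m⊔n i j))
      (ℕ.⊔-lub i<n j<n)

    -- Differences of elements of [0, n/2] stay below n, and so do sums, except for i = j = n/2,
    -- where there is nothing to prove. A multiple of n that small is 0.
    ≈±-unique : ∀ {i j} → i ℕ.+ i ℕ.≤ n → j ℕ.+ j ℕ.≤ n → + i ≈± + j → i ≡ j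
    ≈±-unique {i} {j} 2i 2j (minus p) =
      ℤ.+-injective (ℤ.i-j≡0⇒i≡j (+ i) (+ j)
        (ℤ.∣i∣≡0⇒i≡0 (small-multiple (∣i-j∣-< i j (2i≤n⇒i<n 2i) (2i≤n⇒i<n 2j)) (∣⇒∣ᵤ p))))
    ≈±-unique {i} {j} 2i 2j (plus p) with ℕ.<-cmp i j
    ... | tri≈ _ eq _ = eq
    ... | tri< i<j _ _ = contradiction (small-multiple i+j<n (∣⇒∣ᵤ p)) i+j≢0
      where
      i+j<n : i ℕ.+ j ℕ.< n
      i+j<n = ℕ.<-≤-trans (ℕ.+-monoˡ-< j i<j) 2j
      i+j≢0 : i ℕ.+ j ≢ 0
      i+j≢0 eq = contradiction (subst (i ℕ.<_) (ℕ.m+n≡0⇒n≡0 i eq) i<j) ℕ.n≮0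
    ... | tri> _ _ j<i = contradiction (small-multiple i+j<n (∣⇒∣ᵤ p)) i+j≢0
      where
      i+j<n : i ℕ.+ j ℕ.< n
      i+j<n = ℕ.<-≤-trans (ℕ.+-monoʳ-< i j<i) 2i
      i+j≢0 : i ℕ.+ j ≢ 0
      i+j≢0 eq = contradiction (subst (j ℕ.<_) (ℕ.m+n≡0⇒m≡0 i eq) j<i) ℕ.n≮0

    module Inverse (a b : ℕ) (ba≡1 : + n ∣ + b * + a - 1ℤ) where

      -- Multiplication by b undoes multiplication by a on classes up to sign, and `≈±-unique`
      -- recovers the representative.
      dist-inverse : ∀ i → i ℕ.+ i ℕ.≤ n → dist (b ℕ.* dist (a ℕ.* i)) ≡ i
      dist-inverse i 2i = sym (≈±-unique 2i (dist-≤ _) (≈±-trans i≈bai (≈±-trans step₁ step₂)))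
        where
        j = dist (a ℕ.* i)
        i≈bai : + i ≈± (+ b * + (a ℕ.* i))
        i≈bai = minus (∣-resp (trans (lem (+ a) (+ b) (+ i)) (cong (λ t → + i - + b * t) (sym (ℤ.pos-* a i))))
                       (∣m⇒∣-m (∣m⇒∣m*n (+ i) ba≡1)))
          where lem : ∀ a b i → - ((b * a - 1ℤ) * i) ≡ i - b * (a * i)
                lem = solve-∀
        step₁ : (+ b * + (a ℕ.* i)) ≈± (+ b * + j)
        step₁ = ≈±-* (+ b) (Folded-≈± (dist-folded (a ℕ.* i)))
        step₂ : (+ b * + j) ≈± + dist (b ℕ.* j)
        step₂ = subst (_≈± + dist (b ℕ.* j)) (ℤ.pos-* b j) (Folded-≈± (dist-folded (b ℕ.* j)))

      dist-≢0 : ∀ i → 0 ℕ.< i → i ℕ.+ i ℕ.≤ n → 0 ℕ.< dist (a ℕ.* i)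
      dist-≢0 i 0<i 2i = ℕ.n≢0⇒n>0 λ eq → contradiction
        (trans (sym (dist-inverse i 2i)) (trans (cong (λ t → dist (b ℕ.* t)) eq) (trans (cong dist (ℕ.*-zeroʳ b)) dist-0)))
        (ℕ.>⇒≢ 0<i)
        where
        dist-0 : dist 0 ≡ 0
        dist-0 = sym (≈±-unique z≤n (dist-≤ 0) (Folded-≈± (dist-folded 0)))

      -- The midpoint n/2 is its own negative and is not reached: 2j = n gives n ∣ 2bj, hence n ∣
      -- 2i, so that i = 0 and then j = 0.
      dist-< : ∀ i → i ℕ.+ i ℕ.< n → dist (a ℕ.* i) ℕ.+ dist (a ℕ.* i) ℕ.< n
      dist-< i 2i<n = ℕ.≤∧≢⇒< (dist-≤ _) λ 2j≡n →
        ℕ.<⇒≢ (subst (λ t → t ℕ.+ t ℕ.< n) (zero-dist (i≡0 2j≡n)) (ℕ.>-nonZero⁻¹ n)) 2j≡n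
        where
        j = dist (a ℕ.* i)
        zero-dist : i ≡ 0 → 0 ≡ j
        zero-dist refl = ≈±-unique z≤n (dist-≤ _)
          (subst (λ t → + t ≈± + j) (ℕ.*-zeroʳ a) (Folded-≈± (dist-folded (a ℕ.* 0))))
        bj≈i : + (b ℕ.* j) ≈± + i
        bj≈i = subst (λ t → + (b ℕ.* j) ≈± + t) (dist-inverse i (ℕ.<⇒≤ 2i<n)) (Folded-≈± (dist-folded (b ℕ.* j)))
        ∣2i : j ℕ.+ j ≡ n → + n ∣ + (i ℕ.+ i)
        ∣2i 2j≡n = from bj≈i
          where
          n∣2bj : + n ∣ + (b ℕ.* j) + + (b ℕ.* j)
          n∣2bj = divides (+ b) (trans (cong +_ (sym (ℕ.*-distribˡ-+ b j j))) (trans (cong (λ t → + (b ℕ.* t)) 2j≡n) (ℤ.pos-* b n)))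
          from : + (b ℕ.* j) ≈± + i → + n ∣ + (i ℕ.+ i)
          from (minus p) = ∣-resp (lem (+ (b ℕ.* j)) (+ i)) (∣m∣n⇒∣m-n n∣2bj (∣m∣n⇒∣m+n p p))
            where lem : ∀ x i → (x + x) - ((x - i) + (x - i)) ≡ i + i
                  lem = solve-∀
          from (plus p) = ∣-resp (lem (+ (b ℕ.* j)) (+ i)) (∣m∣n⇒∣m-n (∣m∣n⇒∣m+n p p) n∣2bj)
            where lem : ∀ x i → ((x + i) + (x + i)) - (x + x) ≡ i + i
                  lem = solve-∀
        i≡0 : j ℕ.+ j ≡ n → i ≡ 0
        i≡0 2j≡n = ℕ.m+n≡0⇒m≡0 i (small-multiple 2i<n (∣⇒∣ᵤ (∣2i 2j≡n)))

-- Signs, parity, inverses and quotients.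

module Arith where

  open BigOp
  open import Data.Nat.Coprimality using (Coprime; coprime-Bézout)
  open import Data.Nat.DivMod using (_/_; _%_; m≡m%n+[m/n]*n; m%n<n; m*n/n≡m; +-distrib-/-∣ʳ)
  open import Data.Nat.GCD using (module Bézout)
  open import Data.Integer.Divisibility.Signed
  open ≡-Reasoning

  sgn : ℕ → ℤ
  sgn zero    = 1ℤ
  sgn (suc n) = - sgn n

  sgn-+ : ∀ m n → sgn (m ℕ.+ n) ≡ sgn m * sgn n
  sgn-+ zero    n = sym (ℤ.*-identityˡ (sgn n))
  sgn-+ (suc m) n = trans (cong -_ (sgn-+ m n)) (ℤ.neg-distribˡ-* (sgn m) (sgn n))

  sgn-²≡1 : ∀ n → sgn n * sgn n ≡ 1ℤ
  sgn-²≡1 zero    = refl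
  sgn-²≡1 (suc n) = trans (lem (sgn n)) (sgn-²≡1 n)
    where lem : ∀ s → - s * - s ≡ s * s
          lem = solve-∀

  sgn-±1 : ∀ n → sgn n ≡ 1ℤ ⊎ sgn n ≡ - 1ℤ
  sgn-±1 zero = inj₁ refl
  sgn-±1 (suc n) with sgn-±1 n
  ... | inj₁ eq = inj₂ (cong -_ eq)
  ... | inj₂ eq = inj₁ (cong -_ eq)

  sgn-nonZero : ∀ n → ℤ.NonZero (sgn n)
  sgn-nonZero n with sgn n | sgn-±1 n
  ... | _ | inj₁ refl = _
  ... | _ | inj₂ refl = _

  sgn-even : ∀ n → sgn (n ℕ.+ n) ≡ 1ℤ
  sgn-even n = trans (sgn-+ n n) (sgn-²≡1 n)

  sgn-*-odd : ∀ q k → sgn (q ℕ.* suc (k ℕ.+ k)) ≡ sgn q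
  sgn-*-odd q k = begin
    sgn (q ℕ.* suc (k ℕ.+ k))               ≡⟨ cong sgn (lem q k) ⟩
    sgn ((q ℕ.* k ℕ.+ q ℕ.* k) ℕ.+ q)       ≡⟨ sgn-+ (q ℕ.* k ℕ.+ q ℕ.* k) q ⟩
    sgn (q ℕ.* k ℕ.+ q ℕ.* k) * sgn q       ≡⟨ cong (_* sgn q) (sgn-even (q ℕ.* k)) ⟩
    1ℤ * sgn q                              ≡⟨ ℤ.*-identityˡ _ ⟩
    sgn q                                   ∎
    where lem : ∀ q k → q ℕ.* suc (k ℕ.+ k) ≡ (q ℕ.* k ℕ.+ q ℕ.* k) ℕ.+ q
          lem = ℕ.solve-∀

  ∏-sgn : ∀ n f → ∏.fold n (λ i → sgn (f i)) ≡ sgn (∑ℕ.fold n f)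
  ∏-sgn zero    f = refl
  ∏-sgn (suc n) f = trans (cong (_* sgn (f n)) (∏-sgn n f)) (sym (sgn-+ (∑ℕ.fold n f) (f n)))

  parity : ∀ v → (∃[ w ] v ≡ w ℕ.+ w) ⊎ (∃[ w ] v ≡ suc (w ℕ.+ w))
  parity zero = inj₁ (0 , refl)
  parity (suc v) with parity v
  ... | inj₁ (w , eq) = inj₂ (w , cong suc eq)
  ... | inj₂ (w , eq) = inj₁ (suc w , cong suc (trans eq (sym (ℕ.+-suc w w))))

  coprime-inverse : ∀ {a n} → Coprime a n → ∃[ b ] + n ∣ + b * + a - 1ℤ
  coprime-inverse {a} {n} c with coprime-Bézout c
  ... | Bézout.+- x y eq = x , divides (+ y) (begin
        + x * + a - 1ℤ             ≡⟨ cong (_- 1ℤ) (sym (ℤ.pos-* x a)) ⟩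
        + (x ℕ.* a) - 1ℤ           ≡⟨ cong (λ t → + t - 1ℤ) (sym eq) ⟩
        + (1 ℕ.+ y ℕ.* n) - 1ℤ     ≡⟨ cong (_- 1ℤ) (ℤ.pos-+ 1 (y ℕ.* n)) ⟩
        1ℤ + + (y ℕ.* n) - 1ℤ      ≡⟨ lem (+ (y ℕ.* n)) ⟩
        + (y ℕ.* n)                ≡⟨ ℤ.pos-* y n ⟩
        + y * + n                  ∎)
    where lem : ∀ t → 1ℤ + t - 1ℤ ≡ t
          lem = solve-∀
  ... | Bézout.-+ x y eq = negated n eq
    where
    negated : ∀ n → 1 ℕ.+ x ℕ.* a ≡ y ℕ.* n → ∃[ b ] + n ∣ + b * + a - 1ℤ
    negated zero    eq = contradiction (trans eq (ℕ.*-zeroʳ y)) ℕ.1+n≢0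
    -- The inverse is -x; the natural number x (n - 1) is congruent to it.
    negated (suc k) eq = x ℕ.* k , divides (+ x * + a - + y) (begin
        + (x ℕ.* k) * + a - 1ℤ                                ≡⟨ cong (λ t → t * + a - 1ℤ) (ℤ.pos-* x k) ⟩
        + x * + k * + a - 1ℤ                                  ≡⟨ lem (+ x) (+ k) (+ a) ⟩
        + x * + a * (1ℤ + + k) - (1ℤ + + x * + a)             ≡⟨ cong (λ t → + x * + a * (1ℤ + + k) - t) eq′ ⟩
        + x * + a * (1ℤ + + k) - + y * (1ℤ + + k)             ≡⟨ lem₂ (+ x * + a) (+ y) (1ℤ + + k) ⟩
        (+ x * + a - + y) * + suc k                           ∎)
      where
      lem : ∀ x k a → x * k * a - 1ℤ ≡ x * a * (1ℤ + k) - (1ℤ + x * a)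
      lem = solve-∀
      lem₂ : ∀ s t u → s * u - t * u ≡ (s - t) * u
      lem₂ = solve-∀
      eq′ : 1ℤ + + x * + a ≡ + y * (1ℤ + + k)
      eq′ = trans (cong (λ t → 1ℤ + t) (sym (ℤ.pos-* x a))) (trans (cong +_ eq) (ℤ.pos-* y (suc k)))

  module _ (n : ℕ) .{{_ : NonZero n}} where

    [m+kn]/n : ∀ m k → (m ℕ.+ k ℕ.* n) / n ≡ m / n ℕ.+ k
    [m+kn]/n m k = trans (+-distrib-/-∣ʳ m (ℕ.divides k refl)) (cong (m / n ℕ.+_) (m*n/n≡m k n))

    -- The two remainders add up to a multiple of n below 2n, and not to 0 since n does not divide
    -- z. So they add up to n, which accounts for the missing unit.
    complementary-quotients : ∀ y z Q → y ℕ.+ z ≡ Q ℕ.* n → ¬ n ℕ.∣ z → suc (y / n ℕ.+ z / n) ≡ Q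
    complementary-quotients y z Q eq n∤z = ℕ.*-cancelʳ-≡ _ _ n (begin
      n ℕ.+ t ℕ.* n                                                     ≡⟨ cong (ℕ._+ t ℕ.* n) (sym s≡n) ⟩
      s ℕ.+ t ℕ.* n                                                     ≡⟨ sum ⟩
      Q ℕ.* n                                                           ∎)
      where
      s = y % n ℕ.+ z % n
      t = y / n ℕ.+ z / n
      sum : s ℕ.+ t ℕ.* n ≡ Q ℕ.* n
      sum = begin
        s ℕ.+ t ℕ.* n                                                   ≡⟨ lem (y % n) (z % n) (y / n) (z / n) n ⟩
        (y % n ℕ.+ y / n ℕ.* n) ℕ.+ (z % n ℕ.+ z / n ℕ.* n)             ≡⟨ cong₂ ℕ._+_ (sym (m≡m%n+[m/n]*n y n)) (sym (m≡m%n+[m/n]*n z n)) ⟩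
        y ℕ.+ z                                                         ≡⟨ eq ⟩
        Q ℕ.* n                                                         ∎
        where lem : ∀ a b c d n → a ℕ.+ b ℕ.+ (c ℕ.+ d) ℕ.* n ≡ (a ℕ.+ c ℕ.* n) ℕ.+ (b ℕ.+ d ℕ.* n)
              lem = ℕ.solve-∀
      n∣s : n ℕ.∣ s
      n∣s = ℕ.∣m+n∣m⇒∣n (subst (n ℕ.∣_) (trans (sym sum) (ℕ.+-comm s _)) (ℕ.n∣m*n Q)) (ℕ.n∣m*n t)
      s<2n : s ℕ.< 2 ℕ.* n
      s<2n = subst (s ℕ.<_) (cong (n ℕ.+_) (sym (ℕ.+-identityʳ n))) (ℕ.+-mono-< (m%n<n y n) (m%n<n z n))
      s≡n : s ≡ n
      s≡n with n∣s
      ... | ℕ.divides 0 s≡0 = contradiction (ℕ.m%n≡0⇒n∣m z n (ℕ.m+n≡0⇒n≡0 (y % n) s≡0)) n∤z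
      ... | ℕ.divides 1 s≡n = trans s≡n (ℕ.*-identityˡ n)
      ... | ℕ.divides (suc (suc k)) s≡ = contradiction s<2n
              (ℕ.≤⇒≯ (subst (2 ℕ.* n ℕ.≤_) (sym s≡) (ℕ.*-monoˡ-≤ n (s≤s (s≤s (z≤n {k}))))))

  small-nonmultiple : ∀ {m n} → 0 ℕ.< m → m ℕ.< n → ¬ n ℕ.∣ m
  small-nonmultiple {suc m} 0<m m<n d = ℕ.<⇒≱ m<n (ℕ.∣⇒≤ d)

-- The symbol (-M / d): periodicity, multiplicativity, reciprocity.

module Character where

  open BigOp
  open Folding
  open Arith
  open import Data.Nat.Coprimality using (Coprime; coprime-divisor) renaming (sym to coprime-sym)
  open import Data.Nat.DivMod using (_/_; m<n*o⇒m/o<n; m/n*n≤m; m≡m%n+[m/n]*n; m%n<n)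
  open import Data.Integer.Divisibility.Signed
  open ≡-Reasoning

  module _ (n : ℕ) .{{_ : NonZero n}} where

    open Dist n

    -- If x = q n + i, multiplying by the odd e shifts the quotient of i e by q e, which has the
    -- parity of q. If x = (q + 1) n - i, the quotients of x e and i e add up to (q + 1) e - 1,
    -- again of the parity of q; coprimality keeps i e off the multiples of n, where that count
    -- would be off by one.
    sgn-quotient-* : ∀ {x i} k → Folded x i → Coprime n (suc (k ℕ.+ k)) →
                     sgn (x ℕ.* suc (k ℕ.+ k) / n) ≡ sgn (x / n) * sgn (i ℕ.* suc (k ℕ.+ k) / n)
    sgn-quotient-* {x} k (below i _ eq) cop = begin
      sgn (x ℕ.* e / n)                              ≡⟨ cong (λ t → sgn (t / n)) expand ⟩
      sgn ((i ℕ.* e ℕ.+ (q ℕ.* e) ℕ.* n) / n)        ≡⟨ cong sgn ([m+kn]/n n (i ℕ.* e) (q ℕ.* e)) ⟩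
      sgn (i ℕ.* e / n ℕ.+ q ℕ.* e)                  ≡⟨ sgn-+ (i ℕ.* e / n) (q ℕ.* e) ⟩
      sgn (i ℕ.* e / n) * sgn (q ℕ.* e)              ≡⟨ cong (sgn (i ℕ.* e / n) *_) (sgn-*-odd q k) ⟩
      sgn (i ℕ.* e / n) * sgn q                      ≡⟨ ℤ.*-comm (sgn (i ℕ.* e / n)) (sgn q) ⟩
      sgn q * sgn (i ℕ.* e / n)                      ∎
      where
      e = suc (k ℕ.+ k)
      q = x / n
      expand : x ℕ.* e ≡ i ℕ.* e ℕ.+ (q ℕ.* e) ℕ.* n
      expand = trans (cong (ℕ._* e) eq) (lem i q n e)
        where lem : ∀ i q n e → (i ℕ.+ q ℕ.* n) ℕ.* e ≡ i ℕ.* e ℕ.+ (q ℕ.* e) ℕ.* n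
              lem = ℕ.solve-∀
    sgn-quotient-* {x} k (above i 0<i 2i<n eq) cop = ℤ.*-cancelʳ-≡ _ _ s {{sgn-nonZero (i ℕ.* e / n)}} (begin
      sgn (x ℕ.* e / n) * s            ≡⟨ sym (sgn-+ (x ℕ.* e / n) (i ℕ.* e / n)) ⟩
      sgn (x ℕ.* e / n ℕ.+ i ℕ.* e / n) ≡⟨ sym (ℤ.neg-involutive _) ⟩
      - sgn (suc (x ℕ.* e / n ℕ.+ i ℕ.* e / n)) ≡⟨ cong (λ t → - sgn t) total ⟩
      - sgn (suc q ℕ.* e)              ≡⟨ cong -_ (sgn-*-odd (suc q) k) ⟩
      - - sgn q                        ≡⟨ ℤ.neg-involutive (sgn q) ⟩
      sgn q                            ≡⟨ sym (ℤ.*-identityʳ (sgn q)) ⟩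
      sgn q * 1ℤ                       ≡⟨ cong (sgn q *_) (sym (sgn-²≡1 (i ℕ.* e / n))) ⟩
      sgn q * (s * s)                  ≡⟨ sym (ℤ.*-assoc (sgn q) s s) ⟩
      sgn q * s * s                    ∎)
      where
      e = suc (k ℕ.+ k)
      q = x / n
      s = sgn (i ℕ.* e / n)
      n∤ie : ¬ n ℕ.∣ i ℕ.* e
      n∤ie d = small-nonmultiple 0<i (2i≤n⇒i<n (ℕ.<⇒≤ 2i<n)) (coprime-divisor cop (subst (n ℕ.∣_) (ℕ.*-comm i e) d))
      total : suc (x ℕ.* e / n ℕ.+ i ℕ.* e / n) ≡ suc q ℕ.* e
      total = complementary-quotients n (x ℕ.* e) (i ℕ.* e) (suc q ℕ.* e)
        (trans (sym (ℕ.*-distribʳ-+ e x i)) (trans (cong (ℕ._* e) eq) (lem (suc q) n e))) n∤ie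
        where lem : ∀ q n e → q ℕ.* n ℕ.* e ≡ q ℕ.* e ℕ.* n
              lem = ℕ.solve-∀

    dist-permutes : ∀ {a} H → Coprime a n → (∀ {i} → i ℕ.< H → i ℕ.+ i ℕ.< n) → (∀ {i} → i ℕ.+ i ℕ.< n → i ℕ.< H) →
                    (f : ℕ → ℤ) → ∏.fold H (λ i → f (dist (a ℕ.* i))) ≡ ∏.fold H f
    dist-permutes {a} H cop to from f with coprime-inverse cop
    ... | b , ba≡1 = ∏.fold-permute H (λ i → dist (a ℕ.* i)) (λ i → dist (b ℕ.* i)) f
        (λ i i<H → from (A.dist-< i (to i<H))) (λ i i<H → from (B.dist-< i (to i<H)))
        (λ i i<H → A.dist-inverse i (ℕ.<⇒≤ (to i<H))) (λ i i<H → B.dist-inverse i (ℕ.<⇒≤ (to i<H)))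
      where
      module A = Inverse a b ba≡1
      module B = Inverse b a (subst (λ t → + n ∣ t - 1ℤ) (ℤ.*-comm (+ b) (+ a)) ba≡1)

  nonZero-double : ∀ M .{{_ : NonZero M}} → NonZero (M ℕ.+ M)
  nonZero-double (suc M) = _

  -- For M even and d odd and prime to M, this is the Jacobi symbol (-M / d).
  module Symbol (M : ℕ) .{{_ : NonZero M}} where

    period : ℕ
    period = M ℕ.+ M

    instance
      period-nonZero : NonZero period
      period-nonZero = nonZero-double M

    -- Gauss's lemma with the roles exchanged: the product runs over residues of the fixed modulus
    -- 2M and not over residues of d, so that the behaviour in d can be read off without factoring
    -- d.
    symbol : ℕ → ℤ
    symbol d = ∏.fold M (λ i → sgn (i ℕ.* d / period))

    symbol-periodic : ∀ d → symbol (d ℕ.+ (period ℕ.+ period)) ≡ symbol d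
    symbol-periodic d = ∏.fold-cong M λ i _ → begin
      sgn (i ℕ.* (d ℕ.+ (n ℕ.+ n)) / n)       ≡⟨ cong (λ t → sgn (t / n)) (lem i d n) ⟩
      sgn ((i ℕ.* d ℕ.+ (i ℕ.+ i) ℕ.* n) / n) ≡⟨ cong sgn ([m+kn]/n n (i ℕ.* d) (i ℕ.+ i)) ⟩
      sgn (i ℕ.* d / n ℕ.+ (i ℕ.+ i))         ≡⟨ sgn-+ (i ℕ.* d / n) (i ℕ.+ i) ⟩
      sgn (i ℕ.* d / n) * sgn (i ℕ.+ i)       ≡⟨ cong (sgn (i ℕ.* d / n) *_) (sgn-even i) ⟩
      sgn (i ℕ.* d / n) * 1ℤ                  ≡⟨ ℤ.*-identityʳ _ ⟩
      sgn (i ℕ.* d / n)                       ∎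
      where
      n = period
      lem : ∀ i d n → i ℕ.* (d ℕ.+ (n ℕ.+ n)) ≡ i ℕ.* d ℕ.+ (i ℕ.+ i) ℕ.* n
      lem = ℕ.solve-∀

    i<M⇒2i<period : ∀ {i} → i ℕ.< M → i ℕ.+ i ℕ.< period
    i<M⇒2i<period i<M = ℕ.+-mono-< i<M i<M

    2i<period⇒i<M : ∀ {i} → i ℕ.+ i ℕ.< period → i ℕ.< M
    2i<period⇒i<M {i} lt = ℕ.≰⇒> λ M≤i → ℕ.<⇒≱ lt (ℕ.+-mono-≤ M≤i M≤i)

    -- The sign attached to i d e is the sign of i d times the sign of dist (d i) e, and
    -- multiplication by d permutes the i < M up to sign.
    symbol-* : ∀ {d} k → Coprime d period → Coprime (suc (k ℕ.+ k)) period →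
               symbol (d ℕ.* suc (k ℕ.+ k)) ≡ symbol d * symbol (suc (k ℕ.+ k))
    symbol-* {d} k d⊥n e⊥n = begin
      symbol (d ℕ.* e)                                              ≡⟨ ∏.fold-cong M pointwise ⟩
      ∏.fold M (λ i → sgn (i ℕ.* d / n) * g (dist (d ℕ.* i)))       ≡⟨ ∏.fold-∙ M _ _ ⟩
      symbol d * ∏.fold M (λ i → g (dist (d ℕ.* i)))                ≡⟨ cong (symbol d *_) (dist-permutes n M d⊥n i<M⇒2i<period 2i<period⇒i<M g) ⟩
      symbol d * symbol e                                           ∎
      where
      n = period
      open Dist n
      e = suc (k ℕ.+ k)
      g : ℕ → ℤ
      g j = sgn (j ℕ.* e / n)
      pointwise : ∀ i → i ℕ.< M → sgn (i ℕ.* (d ℕ.* e) / n) ≡ sgn (i ℕ.* d / n) * g (dist (d ℕ.* i))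
      pointwise i _ = begin
        sgn (i ℕ.* (d ℕ.* e) / n)                       ≡⟨ cong (λ t → sgn (t / n)) (lem i d e) ⟩
        sgn (d ℕ.* i ℕ.* e / n)                         ≡⟨ sgn-quotient-* n k (dist-folded (d ℕ.* i)) (coprime-sym e⊥n) ⟩
        sgn (d ℕ.* i / n) * g (dist (d ℕ.* i))          ≡⟨ cong (λ t → sgn (t / n) * g (dist (d ℕ.* i))) (ℕ.*-comm d i) ⟩
        sgn (i ℕ.* d / n) * g (dist (d ℕ.* i))          ∎
        where lem : ∀ i d e → i ℕ.* (d ℕ.* e) ≡ d ℕ.* i ℕ.* e
              lem = ℕ.solve-∀

    symbol-²≡1 : ∀ d → symbol d * symbol d ≡ 1ℤ
    symbol-²≡1 d = trans (sym (∏.fold-∙ M _ _)) (∏.fold-ε M (λ i _ → sgn-²≡1 (i ℕ.* d / period)))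

    symbol-±1 : ∀ d → symbol d ≡ 1ℤ ⊎ symbol d ≡ - 1ℤ
    symbol-±1 d = subst (λ t → t ≡ 1ℤ ⊎ t ≡ - 1ℤ) (sym (∏-sgn M q)) (sgn-±1 (∑ℕ.fold M q))
      where
      q : ℕ → ℕ
      q i = i ℕ.* d / period

  ∑ℕ-const : ∀ n c → ∑ℕ.fold n (λ _ → c) ≡ n ℕ.* c
  ∑ℕ-const zero    c = refl
  ∑ℕ-const (suc n) c = trans (cong (ℕ._+ c) (∑ℕ-const n c)) (ℕ.+-comm (n ℕ.* c) c)

  quotient-count : ∀ x n B .{{_ : NonZero n}} → x / n ℕ.≤ B →
                   x / n ≡ ∑ℕ.fold B (λ j → ∑ℕ.when (suc j ℕ.* n ℕ.≤? x) 1)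
  quotient-count x n B q≤B = sym (begin
    ∑ℕ.fold B ind       ≡⟨ cong (λ b → ∑ℕ.fold b ind) (sym (ℕ.m+[n∸m]≡n q≤B)) ⟩
    ∑ℕ.fold (q ℕ.+ r) ind ≡⟨ ∑ℕ.fold-+ q r ind ⟩
    ∑ℕ.fold q ind ℕ.+ ∑ℕ.fold r (λ j → ind (q ℕ.+ j)) ≡⟨ cong₂ ℕ._+_ (∑ℕ.fold-cong q ones) (∑ℕ.fold-ε r zeros) ⟩
    ∑ℕ.fold q (λ _ → 1) ℕ.+ 0 ≡⟨ ℕ.+-identityʳ _ ⟩
    ∑ℕ.fold q (λ _ → 1) ≡⟨ ∑ℕ-const q 1 ⟩
    q ℕ.* 1 ≡⟨ ℕ.*-identityʳ q ⟩
    q ∎)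
    where
    q = x / n
    r = B ℕ.∸ q
    ind : ℕ → ℕ
    ind j = ∑ℕ.when (suc j ℕ.* n ℕ.≤? x) 1
    ones : ∀ j → j ℕ.< q → ind j ≡ 1
    ones j j<q = ∑ℕ.when-true (suc j ℕ.* n ℕ.≤? x) (ℕ.≤-trans (ℕ.*-monoˡ-≤ n j<q) (m/n*n≤m x n))
    x< : x ℕ.< suc q ℕ.* n
    x< = subst (ℕ._< suc q ℕ.* n) (sym (m≡m%n+[m/n]*n x n)) (ℕ.+-monoˡ-< (q ℕ.* n) (m%n<n x n))
    zeros : ∀ j → j ℕ.< r → ind (q ℕ.+ j) ≡ 0
    zeros j _ = ∑ℕ.when-false (suc (q ℕ.+ j) ℕ.* n ℕ.≤? x)
      (λ le → contradiction (ℕ.≤-trans (ℕ.*-monoˡ-≤ n (s≤s (ℕ.m≤m+n q j))) le) (ℕ.<⇒≱ x<))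

  -- Counting lattice points on either side of the diagonal of a rectangle.
  lattice-count : ∀ m h → let M = suc m ; d = suc (h ℕ.+ h) in Coprime d (M ℕ.+ M) →
    ∑ℕ.fold (suc h) (λ k → k ℕ.* (M ℕ.+ M) / d) ℕ.+ ∑ℕ.fold M (λ i → i ℕ.* d / (M ℕ.+ M)) ≡ h ℕ.* m
  lattice-count m h cop = begin
    ∑ℕ.fold (suc h) (λ k → k ℕ.* n / d) ℕ.+ ∑ℕ.fold (suc m) (λ i → i ℕ.* d / n)
      ≡⟨ cong₂ ℕ._+_ (∑ℕ.fold-suc h _) (∑ℕ.fold-suc m _) ⟩
    ∑ℕ.fold h (λ k → suc k ℕ.* n / d) ℕ.+ ∑ℕ.fold m (λ i → suc i ℕ.* d / n)
      ≡⟨ cong₂ ℕ._+_ (∑ℕ.fold-cong h (λ k k<h → quotient-count (suc k ℕ.* n) d m (bound₁ k k<h)))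
                     (∑ℕ.fold-cong m (λ i i<m → quotient-count (suc i ℕ.* d) n h (bound₂ i i<m))) ⟩
    ∑ℕ.fold h (λ k → ∑ℕ.fold m (λ i → low k i)) ℕ.+ ∑ℕ.fold m (λ i → ∑ℕ.fold h (λ k → high k i))
      ≡⟨ cong (∑ℕ.fold h (λ k → ∑ℕ.fold m (λ i → low k i)) ℕ.+_) (∑ℕ.fold-swap m h _) ⟩
    ∑ℕ.fold h (λ k → ∑ℕ.fold m (λ i → low k i)) ℕ.+ ∑ℕ.fold h (λ k → ∑ℕ.fold m (λ i → high k i))
      ≡⟨ sym (∑ℕ.fold-∙ h _ _) ⟩
    ∑ℕ.fold h (λ k → ∑ℕ.fold m (λ i → low k i) ℕ.+ ∑ℕ.fold m (λ i → high k i))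
      ≡⟨ ∑ℕ.fold-cong h (λ k k<h → trans (sym (∑ℕ.fold-∙ m _ _)) (∑ℕ.fold-cong m (λ i i<m → exactly-one k i k<h))) ⟩
    ∑ℕ.fold h (λ k → ∑ℕ.fold m (λ i → 1))
      ≡⟨ ∑ℕ.fold-cong h (λ k _ → trans (∑ℕ-const m 1) (ℕ.*-identityʳ m)) ⟩
    ∑ℕ.fold h (λ k → m)
      ≡⟨ ∑ℕ-const h m ⟩
    h ℕ.* m ∎
    where
    M = suc m
    d = suc (h ℕ.+ h)
    n = M ℕ.+ M
    low high : ℕ → ℕ → ℕ
    low  k i = ∑ℕ.when (suc i ℕ.* d ℕ.≤? suc k ℕ.* n) 1
    high k i = ∑ℕ.when (suc k ℕ.* n ℕ.≤? suc i ℕ.* d) 1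
    bound₁ : ∀ k → k ℕ.< h → suc k ℕ.* n / d ℕ.≤ m
    bound₁ k k<h = ℕ.≤-pred (m<n*o⇒m/o<n (ℕ.≤-<-trans (ℕ.*-monoˡ-≤ n k<h)
      (subst₂ ℕ._<_ (lem₁ h M) (ℕ.*-comm d M) (ℕ.*-monoˡ-< M (ℕ.n<1+n (h ℕ.+ h))))))
      where lem₁ : ∀ h M → (h ℕ.+ h) ℕ.* M ≡ h ℕ.* (M ℕ.+ M)
            lem₁ = ℕ.solve-∀
    bound₂ : ∀ i → i ℕ.< m → suc i ℕ.* d / n ℕ.≤ h
    bound₂ i i<m = ℕ.≤-pred (m<n*o⇒m/o<n (ℕ.<-≤-trans (ℕ.*-monoˡ-< d (s≤s i<m))
      (subst (M ℕ.* d ℕ.≤_) (lem₂ M h) (ℕ.*-monoʳ-≤ M (ℕ.n≤1+n d)))))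
      where lem₂ : ∀ M h → M ℕ.* suc (suc (h ℕ.+ h)) ≡ suc h ℕ.* (M ℕ.+ M)
            lem₂ = ℕ.solve-∀
    exactly-one : ∀ k i → k ℕ.< h → low k i ℕ.+ high k i ≡ 1
    exactly-one k i k<h with suc i ℕ.* d ℕ.≤? suc k ℕ.* n | suc k ℕ.* n ℕ.≤? suc i ℕ.* d
    -- A lattice point on the diagonal would make d divide k + 1 ≤ h.
    ... | yes p | yes q = contradiction
            (coprime-divisor cop (ℕ.divides (suc i) (trans (ℕ.*-comm n (suc k)) (ℕ.≤-antisym q p))))
            (small-nonmultiple (s≤s z≤n) (s≤s (ℕ.≤-trans k<h (ℕ.m≤m+n h h))))
    ... | yes _ | no _  = refl
    ... | no _  | yes _ = refl
    ... | no p  | no q  = contradiction (ℕ.<⇒≤ (ℕ.≰⇒> q)) p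

  -- The even modulus M is written suc (suc (l + l)).
  symbol-reciprocity : ∀ l h → let M = suc (suc (l ℕ.+ l)) ; d = suc (h ℕ.+ h) in Coprime d (M ℕ.+ M) →
    Symbol.symbol M d ≡ sgn h * ∏.fold (suc h) (λ k → sgn (k ℕ.* (M ℕ.+ M) / d))
  symbol-reciprocity l h cop = begin
    Symbol.symbol M d                    ≡⟨ ∏-sgn M _ ⟩
    sgn b                                ≡⟨ sym (ℤ.*-identityˡ (sgn b)) ⟩
    1ℤ * sgn b                           ≡⟨ cong (_* sgn b) (sym (sgn-²≡1 a)) ⟩
    sgn a * sgn a * sgn b                ≡⟨ lem (sgn a) (sgn b) ⟩
    (sgn a * sgn b) * sgn a              ≡⟨ cong (_* sgn a) (trans (sym (sgn-+ a b)) (cong sgn (lattice-count (suc (l ℕ.+ l)) h cop))) ⟩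
    -- As M is even, M - 1 is odd and h (M - 1) has the parity of h.
    sgn (h ℕ.* suc (l ℕ.+ l)) * sgn a    ≡⟨ cong₂ _*_ (sgn-*-odd h l) (sym (∏-sgn (suc h) _)) ⟩
    sgn h * ∏.fold (suc h) (λ k → sgn (k ℕ.* (M ℕ.+ M) / d)) ∎
    where
    M = suc (suc (l ℕ.+ l))
    d = suc (h ℕ.+ h)
    a = ∑ℕ.fold (suc h) (λ k → k ℕ.* (M ℕ.+ M) / d)
    b = ∑ℕ.fold M (λ i → i ℕ.* d / (M ℕ.+ M))
    lem : ∀ x y → x * x * y ≡ (x * y) * x
    lem = solve-∀

  -- By reciprocity M enters only through the quotients of 2kM by d, and adding a multiple of d to M
  -- changes them by even numbers. This trades a modulus that grows with N for a fixed one.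
  symbol-congruent : ∀ l l′ h q → let M = suc (suc (l ℕ.+ l)) ; M′ = suc (suc (l′ ℕ.+ l′)) ; d = suc (h ℕ.+ h) in
    Coprime d (M ℕ.+ M) → Coprime d (M′ ℕ.+ M′) → M ≡ M′ ℕ.+ q ℕ.* d → Symbol.symbol M d ≡ Symbol.symbol M′ d
  symbol-congruent l l′ h q cop cop′ M≡ = begin
    Symbol.symbol M d                                                 ≡⟨ symbol-reciprocity l h cop ⟩
    sgn h * ∏.fold (suc h) (λ k → sgn (k ℕ.* (M ℕ.+ M) / d))          ≡⟨ cong (sgn h *_) (∏.fold-cong (suc h) (λ k _ → pointwise k)) ⟩
    sgn h * ∏.fold (suc h) (λ k → sgn (k ℕ.* (M′ ℕ.+ M′) / d))        ≡⟨ sym (symbol-reciprocity l′ h cop′) ⟩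
    Symbol.symbol M′ d                                                ∎
    where
    M = suc (suc (l ℕ.+ l))
    M′ = suc (suc (l′ ℕ.+ l′))
    d = suc (h ℕ.+ h)
    pointwise : ∀ k → sgn (k ℕ.* (M ℕ.+ M) / d) ≡ sgn (k ℕ.* (M′ ℕ.+ M′) / d)
    pointwise k = begin
      sgn (k ℕ.* (M ℕ.+ M) / d)                                    ≡⟨ cong (λ t → sgn (k ℕ.* (t ℕ.+ t) / d)) M≡ ⟩
      sgn (k ℕ.* ((M′ ℕ.+ q ℕ.* d) ℕ.+ (M′ ℕ.+ q ℕ.* d)) / d)      ≡⟨ cong (λ t → sgn (t / d)) (lem k M′ q d) ⟩
      sgn ((k ℕ.* (M′ ℕ.+ M′) ℕ.+ (k ℕ.* q ℕ.+ k ℕ.* q) ℕ.* d) / d) ≡⟨ cong sgn ([m+kn]/n d (k ℕ.* (M′ ℕ.+ M′)) (k ℕ.* q ℕ.+ k ℕ.* q)) ⟩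
      sgn (k ℕ.* (M′ ℕ.+ M′) / d ℕ.+ (k ℕ.* q ℕ.+ k ℕ.* q))        ≡⟨ sgn-+ (k ℕ.* (M′ ℕ.+ M′) / d) (k ℕ.* q ℕ.+ k ℕ.* q) ⟩
      sgn (k ℕ.* (M′ ℕ.+ M′) / d) * sgn (k ℕ.* q ℕ.+ k ℕ.* q)      ≡⟨ cong (sgn (k ℕ.* (M′ ℕ.+ M′) / d) *_) (sgn-even (k ℕ.* q)) ⟩
      sgn (k ℕ.* (M′ ℕ.+ M′) / d) * 1ℤ                             ≡⟨ ℤ.*-identityʳ _ ⟩
      sgn (k ℕ.* (M′ ℕ.+ M′) / d)                                  ∎
      where lem : ∀ k M q d → k ℕ.* ((M ℕ.+ q ℕ.* d) ℕ.+ (M ℕ.+ q ℕ.* d)) ≡ k ℕ.* (M ℕ.+ M) ℕ.+ (k ℕ.* q ℕ.+ k ℕ.* q) ℕ.* d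
            lem = ℕ.solve-∀

-- Gauss's lemma and Euler's criterion.

module Residue where

  open BigOp
  open Folding
  open Arith
  open Character
  open import Data.Nat.Coprimality using (Coprime; prime⇒coprime) renaming (sym to coprime-sym)
  open import Data.Nat.DivMod using (_/_; m<n⇒m/n≡0)
  open import Data.Nat.Primality using (Prime; euclidsLemma; prime⇒nonTrivial)
  open import Data.Integer.Base using (_^_; ∣_∣)
  open import Data.Integer.Divisibility.Signed
  open import Data.Product using (Σ-syntax)
  open import Data.Sum using ([_,_]′) renaming (map to map-⊎)
  open import Data.Vec.Base using (Vec; []; _∷_; replicate)
  open import Function.Base using (id)

  module Mod (n : ℤ) where

    infix 4 _≈_

    record _≈_ (x y : ℤ) : Set where
      constructor mod
      field divides-difference : n ∣ x - y

    open _≈_ public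

    ≈-refl : ∀ {x} → x ≈ x
    ≈-refl {x} = mod (∣-resp (sym (ℤ.+-inverseʳ x)) (divides 0ℤ refl))

    ≈-reflexive : ∀ {x y} → x ≡ y → x ≈ y
    ≈-reflexive refl = ≈-refl

    ≈-trans : ∀ {x y z} → x ≈ y → y ≈ z → x ≈ z
    ≈-trans {x} {y} {z} (mod p) (mod q) = mod (∣-resp (lem x y z) (∣m∣n⇒∣m+n p q))
      where lem : ∀ x y z → (x - y) + (y - z) ≡ x - z
            lem = solve-∀

    *-cong-≈ : ∀ {x y u v} → x ≈ y → u ≈ v → x * u ≈ y * v
    *-cong-≈ {x} {y} {u} {v} (mod p) (mod q) = mod (∣-resp (lem x y u v) (∣m∣n⇒∣m+n (∣m⇒∣m*n u p) (∣n⇒∣m*n y q)))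
      where lem : ∀ x y u v → (x - y) * u + y * (u - v) ≡ x * u - y * v
            lem = solve-∀

    ∏-cong-≈ : ∀ m {f g} → (∀ i → i ℕ.< m → f i ≈ g i) → ∏.fold m f ≈ ∏.fold m g
    ∏-cong-≈ zero    f≈g = ≈-refl
    ∏-cong-≈ (suc m) f≈g = *-cong-≈ (∏-cong-≈ m (λ i i<m → f≈g i (ℕ.m<n⇒m<1+n i<m))) (f≈g m (ℕ.n<1+n m))

  square-^ : ∀ x n → (x * x) ^ n ≡ x ^ n * x ^ n
  square-^ x zero    = refl
  square-^ x (suc n) = trans (cong (x * x *_) (square-^ x n)) (lem x (x ^ n))
    where lem : ∀ x y → x * x * (y * y) ≡ x * y * (x * y)
          lem = solve-∀

  neg-^ : ∀ x n → (- x) ^ n ≡ sgn n * x ^ n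
  neg-^ x zero    = refl
  neg-^ x (suc n) = trans (cong (- x *_) (neg-^ x n)) (lem x (sgn n) (x ^ n))
    where lem : ∀ x s y → - x * (s * y) ≡ - s * (x * y)
          lem = solve-∀

  euclid-ℤ : ∀ {p} → Prime p → ∀ x y → + p ∣ x * y → (+ p ∣ x) ⊎ (+ p ∣ y)
  euclid-ℤ {p} pr x y d = map-⊎ ∣ᵤ⇒∣ ∣ᵤ⇒∣ (euclidsLemma ∣ x ∣ ∣ y ∣ pr (subst (p ℕ.∣_) (ℤ.abs-* x y) (∣⇒∣ᵤ d)))

  -- The vector lists the coefficients from the constant one upwards, below an implicit leading 1;
  -- its length is the degree.
  eval : ∀ {n} → Vec ℤ n → ℤ → ℤ
  eval []       x = 1ℤ
  eval (c ∷ cs) x = c + x * eval cs x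

  -- eval is monic, so division by x - r leaves a monic quotient.
  factor : ∀ {n} (cs : Vec ℤ (suc n)) r →
           Σ[ qs ∈ Vec ℤ n ] (∀ x → eval cs x ≡ eval cs r + (x - r) * eval qs x)
  factor {zero} (c ∷ []) r = [] , λ x → lem c x r
    where lem : ∀ c x r → c + x * 1ℤ ≡ c + r * 1ℤ + (x - r) * 1ℤ
          lem = solve-∀
  factor {suc n} (c ∷ cs) r with factor cs r
  ... | qs , eq = eval cs r ∷ qs , λ x → trans (cong (λ t → c + x * t) (eq x)) (lem c x r (eval cs r) (eval qs x))
    where lem : ∀ c x r u v → c + x * (u + (x - r) * v) ≡ c + r * u + (x - r) * (u + x * v)
          lem = solve-∀

  x^n-1 : ∀ n → Vec ℤ (suc n)
  x^n-1 n = - 1ℤ ∷ replicate n 0ℤ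

  eval-x^n : ∀ n x → eval (replicate n 0ℤ) x ≡ x ^ n
  eval-x^n zero    x = refl
  eval-x^n (suc n) x = trans (ℤ.+-identityˡ _) (cong (x *_) (eval-x^n n x))

  module _ {p : ℕ} (pr : Prime p) where

    open Mod (+ p)

    factor-root : ∀ {n} (cs : Vec ℤ (suc n)) r → + p ∣ eval cs r →
                  Σ[ qs ∈ Vec ℤ n ] (∀ x → + p ∣ eval cs x → ¬ + p ∣ x - r → + p ∣ eval qs x)
    factor-root cs r root with factor cs r
    ... | qs , eq = qs , λ x root′ p∤ → [ (λ d → contradiction d p∤) , id ]′
      (euclid-ℤ pr (x - r) (eval qs x) (∣m+n∣m⇒∣n (∣-resp (eq x) root′) root))

    p∤1 : ¬ + p ∣ 1ℤ
    p∤1 d = contradiction (ℕ.∣1⇒≡1 (∣⇒∣ᵤ d)) (ℕ.nonTrivial⇒≢1 {{prime⇒nonTrivial pr}})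

    -- Dividing out the last root leaves a monic quotient of smaller degree that vanishes at the
    -- other roots; in degree 0 a root would mean p ∣ 1.
    lagrange : ∀ {n} (cs : Vec ℤ n) (ρ : ℕ → ℤ) → (∀ i → i ℕ.< suc n → + p ∣ eval cs (ρ i)) →
               ¬ (∀ i j → i ℕ.< j → j ℕ.< suc n → ¬ + p ∣ ρ i - ρ j)
    lagrange []       ρ root distinct = p∤1 (root 0 (s≤s z≤n))
    lagrange {suc n} cs@(_ ∷ _) ρ root distinct with factor-root cs (ρ (suc n)) (root (suc n) (ℕ.n<1+n _))
    ... | qs , q-root = lagrange qs ρ
      (λ i i≤n → q-root (ρ i) (root i (ℕ.m<n⇒m<1+n i≤n)) (distinct i (suc n) i≤n (ℕ.n<1+n _)))
      (λ i j i<j j≤n → distinct i j i<j (ℕ.m<n⇒m<1+n j≤n))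

    cancel-∏ : ∀ n (u : ℕ → ℤ) x → (∀ i → i ℕ.< n → ¬ + p ∣ u i) → + p ∣ x * ∏.fold n u → + p ∣ x
    cancel-∏ zero    u x p∤ d = ∣-resp (ℤ.*-identityʳ x) d
    cancel-∏ (suc n) u x p∤ d = [ cancel-∏ n u x (λ i i<n → p∤ i (ℕ.m<n⇒m<1+n i<n)) , (λ d → contradiction d (p∤ n (ℕ.n<1+n n))) ]′
      (euclid-ℤ pr (x * ∏.fold n u) (u n) (∣-resp (sym (ℤ.*-assoc x (∏.fold n u) (u n))) d))

  module OddPrime (h : ℕ) (pr : Prime (suc (h ℕ.+ h))) where

    p : ℕ
    p = suc (h ℕ.+ h)

    open Mod (+ p)
    open Dist p

    small-not-∣ : ∀ {k} → 0 ℕ.< k → k ℕ.< p → ¬ + p ∣ + k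
    small-not-∣ 0<k k<p d = small-nonmultiple 0<k k<p (∣⇒∣ᵤ d)

    gaussSign : ℕ → ℤ
    gaussSign a = ∏.fold (suc h) (λ k → sgn (k ℕ.* (a ℕ.+ a) / p))

    -- The value at 0 is replaced by 1, here and in `scaled`: folds start at 0, and the product of
    -- `unit` up to h becomes h!.
    unit : ℕ → ℤ
    unit zero    = 1ℤ
    unit (suc k) = + suc k

    scaled : ℤ → ℕ → ℤ
    scaled a zero    = 1ℤ
    scaled a (suc k) = a

    ∏-scaled : ∀ a n → ∏.fold (suc n) (scaled a) ≡ a ^ n
    ∏-scaled a zero    = refl
    ∏-scaled a (suc n) = trans (cong (_* a) (∏-scaled a n)) (ℤ.*-comm (a ^ n) a)

    odd≢double : ∀ j → j ℕ.+ j ≢ p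
    odd≢double j eq = go j h eq
      where
      go : ∀ j h → j ℕ.+ j ≢ suc (h ℕ.+ h)
      go (suc j) zero    eq = contradiction (trans (sym (ℕ.+-suc j j)) (ℕ.suc-injective eq)) (λ ())
      go (suc j) (suc h) eq = go j h (ℕ.suc-injective (trans (sym (ℕ.+-suc j j)) (trans (ℕ.suc-injective eq) (cong suc (ℕ.+-suc h h)))))

    -- The parity of the quotient of 2x by p tells in which half of its period x lies, hence whether
    -- the nearest multiple of p is below or above x.
    Folded-sgn : ∀ {x j} → Folded x j → + x ≈ sgn ((x ℕ.+ x) / p) * + j
    Folded-sgn {x} (below j 2j≤p eq) = subst (λ s → + x ≈ s * + j) (sym s≡1)
        (mod (∣-resp (cong (λ t → + x - t) (sym (ℤ.*-identityˡ (+ j)))) x≈j))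
      where
      q = x / p
      lem : ∀ j q p → (j ℕ.+ q ℕ.* p) ℕ.+ (j ℕ.+ q ℕ.* p) ≡ (j ℕ.+ j) ℕ.+ (q ℕ.+ q) ℕ.* p
      lem = ℕ.solve-∀
      s≡1 : sgn ((x ℕ.+ x) / p) ≡ 1ℤ
      s≡1 = trans (cong (λ t → sgn (t / p)) (trans (cong (λ t → t ℕ.+ t) eq) (lem j q p)))
        (trans (cong sgn ([m+kn]/n p (j ℕ.+ j) (q ℕ.+ q)))
        (trans (cong (λ t → sgn (t ℕ.+ (q ℕ.+ q))) (m<n⇒m/n≡0 (ℕ.≤∧≢⇒< 2j≤p (odd≢double j)))) (sgn-even q)))
      x≈j : + p ∣ + x - + j
      x≈j = divides (+ q) (trans (cong (λ t → + t - + j) eq)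
        (trans (cong (_- + j) (ℤ.pos-+ j (q ℕ.* p))) (trans (lem₂ (+ j) _) (ℤ.pos-* q p))))
        where lem₂ : ∀ a b → a + b - a ≡ b
              lem₂ = solve-∀
    Folded-sgn {x} (above j 0<j 2j<p eq) = subst (λ s → + x ≈ s * + j) (sym s≡-1)
        (mod (divides (+ suc q) (trans (lem₃ (+ x) (+ j)) (trans (cong +_ eq) (ℤ.pos-* (suc q) p)))))
      where
      q = x / p
      lem₃ : ∀ x j → x - - 1ℤ * j ≡ x + j
      lem₃ = solve-∀
      lem : ∀ x j → (x ℕ.+ x) ℕ.+ (j ℕ.+ j) ≡ (x ℕ.+ j) ℕ.+ (x ℕ.+ j)
      lem = ℕ.solve-∀
      s≡-1 : sgn ((x ℕ.+ x) / p) ≡ - 1ℤ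
      s≡-1 = trans (sym (ℤ.neg-involutive _)) (cong -_ (begin
        sgn (suc ((x ℕ.+ x) / p))                      ≡⟨ cong (λ t → sgn (suc t)) (sym (ℕ.+-identityʳ ((x ℕ.+ x) / p))) ⟩
        sgn (suc ((x ℕ.+ x) / p ℕ.+ 0))                ≡⟨ cong (λ t → sgn (suc ((x ℕ.+ x) / p ℕ.+ t))) (sym (m<n⇒m/n≡0 2j<p)) ⟩
        sgn (suc ((x ℕ.+ x) / p ℕ.+ (j ℕ.+ j) / p))    ≡⟨ cong sgn (complementary-quotients p (x ℕ.+ x) (j ℕ.+ j) (suc q ℕ.+ suc q)
                                                           (trans (lem x j) (trans (cong₂ ℕ._+_ eq eq) (sym (ℕ.*-distribʳ-+ p (suc q) (suc q)))))
                                                           (small-nonmultiple (ℕ.+-mono-<-≤ 0<j z≤n) 2j<p)) ⟩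
        sgn (suc q ℕ.+ suc q)                          ≡⟨ sgn-even (suc q) ⟩
        1ℤ                                             ∎))
        where open ≡-Reasoning

    k<1+h⇒2k<p : ∀ {k} → k ℕ.< suc h → k ℕ.+ k ℕ.< p
    k<1+h⇒2k<p (s≤s k≤h) = s≤s (ℕ.+-mono-≤ k≤h k≤h)

    2k<p⇒k<1+h : ∀ {k} → k ℕ.+ k ℕ.< p → k ℕ.< suc h
    2k<p⇒k<1+h {k} (s≤s lt) = ℕ.≰⇒> λ h<k → ℕ.<⇒≱ (ℕ.+-mono-≤-< (ℕ.<⇒≤ h<k) h<k) lt

    -- The product of a k for 1 ≤ k ≤ h is a^h h!. The distances of the a k to the multiples of p
    -- are a permutation of 1, ..., h, so it is also h! times the product of the signs; h! is prime
    -- to p and cancels.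
    gauss-lemma : ∀ {a} → Coprime a p → (+ a) ^ h ≈ gaussSign a
    gauss-lemma {a} cop = mod (cancel-∏ pr (suc h) unit _ unit-coprime (∣-resp difference (divides-difference products)))
      where
      P = ∏.fold (suc h) unit
      unit-coprime : ∀ k → k ℕ.< suc h → ¬ + p ∣ unit k
      unit-coprime zero    _   = p∤1 pr
      unit-coprime (suc k) k<  = small-not-∣ (s≤s z≤n) (ℕ.≤-<-trans (ℕ.m≤m+n (suc k) (suc k)) (k<1+h⇒2k<p k<))
      pointwise : ∀ k → k ℕ.< suc h → scaled (+ a) k * unit k ≈ sgn (k ℕ.* (a ℕ.+ a) / p) * unit (dist (a ℕ.* k))
      pointwise zero    _  = ≈-reflexive (sym (cong (λ t → 1ℤ * unit t) dist-0))
        where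
        dist-0 : dist (a ℕ.* 0) ≡ 0
        dist-0 = trans (cong dist (ℕ.*-zeroʳ a)) (sym (≈±-unique z≤n (dist-≤ 0) (Folded-≈± (dist-folded 0))))
      pointwise (suc k) k< = subst₂ _≈_ (ℤ.pos-* a (suc k))
          (cong₂ (λ s t → sgn (s / p) * t) (lem a (suc k)) (sym unit-dist)) (Folded-sgn (dist-folded (a ℕ.* suc k)))
        where
        lem : ∀ a k → a ℕ.* k ℕ.+ a ℕ.* k ≡ k ℕ.* (a ℕ.+ a)
        lem = ℕ.solve-∀
        unit-positive : ∀ {j} → 0 ℕ.< j → unit j ≡ + j
        unit-positive {suc j} _ = refl
        unit-dist : unit (dist (a ℕ.* suc k)) ≡ + dist (a ℕ.* suc k)
        unit-dist with coprime-inverse cop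
        ... | b , ba≡1 = unit-positive (Inverse.dist-≢0 a b ba≡1 (suc k) (s≤s z≤n) (ℕ.<⇒≤ (k<1+h⇒2k<p k<)))
      products : (+ a) ^ h * P ≈ gaussSign a * P
      products = ≈-trans
        (≈-reflexive (trans (cong (_* P) (sym (∏-scaled (+ a) h))) (sym (∏.fold-∙ (suc h) (scaled (+ a)) unit))))
        (≈-trans (∏-cong-≈ (suc h) pointwise)
        (≈-reflexive (trans (∏.fold-∙ (suc h) _ _)
          (cong (gaussSign a *_) (dist-permutes p (suc h) cop k<1+h⇒2k<p 2k<p⇒k<1+h unit)))))
      difference : (+ a) ^ h * P - gaussSign a * P ≡ ((+ a) ^ h - gaussSign a) * P
      difference = lem ((+ a) ^ h) (gaussSign a) P
        where lem : ∀ x y z → x * z - y * z ≡ (x - y) * z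
              lem = solve-∀

    gaussSign-²≡1 : ∀ a → gaussSign a * gaussSign a ≡ 1ℤ
    gaussSign-²≡1 a = trans (sym (∏.fold-∙ (suc h) _ _)) (∏.fold-ε (suc h) (λ k _ → sgn-²≡1 (k ℕ.* (a ℕ.+ a) / p)))

    prime-coprime : ∀ {k} → 0 ℕ.< k → k ℕ.< p → Coprime k p
    prime-coprime 0<k k<p = coprime-sym (prime⇒coprime pr {{ℕ.>-nonZero 0<k}} k<p)

    squareOf : ℕ → ℤ
    squareOf i = + suc i * + suc i

    squareOf-distinct : ∀ i j → i ℕ.< j → j ℕ.< h → ¬ + p ∣ squareOf i - squareOf j
    squareOf-distinct i j i<j j<h d with ℕ.m≤n⇒∃[o]m+o≡n i<j
    ... | o , refl = [ small-not-∣ (s≤s z≤n) o<p , small-not-∣ (s≤s z≤n) sum<p ]′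
        (euclid-ℤ pr (+ suc o) (+ (suc i ℕ.+ suc (suc i ℕ.+ o)))
          (∣-resp (lem (+ i) (+ o)) (∣m⇒∣-m d)))
      where
      lem : ∀ i o → - ((1ℤ + i) * (1ℤ + i) - (1ℤ + (1ℤ + i + o)) * (1ℤ + (1ℤ + i + o))) ≡
                    (1ℤ + o) * ((1ℤ + i) + (1ℤ + (1ℤ + i + o)))
      lem = solve-∀
      o<p : suc o ℕ.< p
      o<p = s≤s (ℕ.≤-trans (ℕ.≤-trans (s≤s (ℕ.m≤n+m o i)) (ℕ.<⇒≤ j<h)) (ℕ.m≤m+n h h))
      sum<p : suc i ℕ.+ suc (suc i ℕ.+ o) ℕ.< p
      sum<p = s≤s (ℕ.+-mono-≤ (ℕ.≤-trans i<j (ℕ.<⇒≤ j<h)) j<h)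

    -- The squares of 1, ..., h are h distinct roots of X^h - 1. If a were a root different from all
    -- of them, dividing by X - a would leave a monic polynomial of degree h - 1 with h roots.
    euler-criterion : ∀ a → a ^ h ≈ 1ℤ → ∃[ i ] + p ∣ squareOf i - a
    euler-criterion a a^h≈1 with ℕ.anyUpTo? (λ i → + p ∣? (squareOf i - a)) h
    ... | yes (i , _ , d) = i , d
    ... | no none = contradiction refl (nonzero h)
      where
      eval-root : ∀ h′ → h ≡ suc h′ → ∀ x → x ^ h ≈ 1ℤ → + p ∣ eval (x^n-1 h′) x
      eval-root h′ eq x (mod d) = ∣-resp
        (trans (cong (λ t → x ^ t - 1ℤ) eq) (trans (ℤ.+-comm (x ^ suc h′) (- 1ℤ)) (cong (λ t → - 1ℤ + x * t) (sym (eval-x^n h′ x))))) d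
      squares-^ : ∀ i → i ℕ.< h → squareOf i ^ h ≈ 1ℤ
      squares-^ i i<h = ≈-trans (≈-reflexive (square-^ (+ suc i) h))
        (≈-trans (*-cong-≈ gl gl) (≈-reflexive (gaussSign-²≡1 (suc i))))
        where gl = gauss-lemma {suc i} (prime-coprime (s≤s z≤n) (s≤s (ℕ.≤-trans i<h (ℕ.m≤m+n h h))))
      impossible : ∀ h′ → ¬ h ≡ suc h′
      impossible h′ eq with factor-root pr (x^n-1 h′) a (eval-root h′ eq a a^h≈1)
      ... | qs , q-root = lagrange pr qs squareOf
        (λ i i< → let i<h = subst (i ℕ.<_) (sym eq) i< in
          q-root (squareOf i) (eval-root h′ eq (squareOf i) (squares-^ i i<h)) (λ d → none (i , i<h , d)))
        (λ i j i<j j< → squareOf-distinct i j i<j (subst (j ℕ.<_) (sym eq) j<))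
      nonzero : ∀ k → ¬ h ≡ k
      nonzero zero    h≡0 = ℕ.nonTrivial⇒≢1 {{prime⇒nonTrivial pr}} (cong (λ t → suc (t ℕ.+ t)) h≡0)
      nonzero (suc k) eq  = impossible k eq

    -- By reciprocity the symbol is the Gauss sign of -M.
    symbol≡1⇒residue : ∀ l → let M = suc (suc (l ℕ.+ l)) in Coprime p (M ℕ.+ M) →
                       Symbol.symbol M p ≡ 1ℤ → ∃[ t ] p ℕ.∣ t ℕ.* t ℕ.+ M
    symbol≡1⇒residue l cop eq = suc (proj₁ root) , ∣⇒∣ᵤ (∣-resp (lem (+ suc (proj₁ root)) (+ M)) (proj₂ root))
      where
      M = suc (suc (l ℕ.+ l))
      M⊥p : Coprime M p
      M⊥p (d∣M , d∣p) = cop (d∣p , ℕ.∣m∣n⇒∣m+n d∣M d∣M)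
      M^h≈1 : (- + M) ^ h ≈ 1ℤ
      M^h≈1 = ≈-trans (≈-reflexive (neg-^ (+ M) h))
        (≈-trans (*-cong-≈ (≈-refl {sgn h}) (gauss-lemma M⊥p))
        (≈-reflexive (trans (sym (symbol-reciprocity l h cop)) eq)))
      root : ∃[ i ] + p ∣ squareOf i - (- + M)
      root = euler-criterion (- + M) M^h≈1
      lem : ∀ s m → s * s - - m ≡ s * s + m
      lem = solve-∀

-- Divisor sums of a real character.

module DivisorSum where

  open BigOp
  open Folding using (∣-resp)
  open Arith using (coprime-inverse; parity)
  open import Data.Nat.Coprimality using (Coprime; coprime-divisor) renaming (sym to coprime-sym)
  open import Data.Nat.Induction using (<-rec)
  open import Data.Nat.Primality using (Prime; euclidsLemma; prime⇒nonTrivial; prime⇒nonZero; prime⇒irreducible)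
  open import Data.Nat.Primality.Factorisation using (factorise)
  open import Data.Integer.Base using (+≤+; +<+)
  open import Data.Integer.Divisibility.Signed
  open import Data.List.Base using ([]; _∷_)
  open import Data.Nat.ListAction using (product)
  open import Data.List.Relation.Unary.All using (_∷_)
  open import Data.Sum using ([_,_]′)
  open import Function.Base using (_∘_)
  open import Relation.Nullary using (¬?)

  ∑-*ˡ : ∀ n c f → ∑.fold n (λ i → c * f i) ≡ c * ∑.fold n f
  ∑-*ˡ zero    c f = sym (ℤ.*-zeroʳ c)
  ∑-*ˡ (suc n) c f = trans (cong (_+ c * f n) (∑-*ˡ n c f)) (sym (ℤ.*-distribˡ-+ c _ _))

  prime-divisor : ∀ m → 1 ℕ.< m → ∃[ p ] Prime p × p ℕ.∣ m
  prime-divisor m 1<m with factorise m {{ℕ.>-nonZero (ℕ.<-trans (s≤s z≤n) 1<m)}}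
  ... | record { factors = [] ; isFactorisation = eq } = contradiction (sym eq) (ℕ.<⇒≢ 1<m)
  ... | record { factors = p ∷ ps ; isFactorisation = eq ; factorsPrime = pr ∷ _ } =
    p , pr , subst (p ℕ.∣_) (sym eq) (ℕ.m∣m*n (product ps))

  prime-coprime : ∀ {p n} → Prime p → ¬ p ℕ.∣ n → Coprime p n
  prime-coprime pr p∤n (d∣p , d∣n) with prime⇒irreducible pr d∣p
  ... | inj₁ d≡1  = d≡1
  ... | inj₂ refl = contradiction d∣n p∤n

  1<prime : ∀ {p} → Prime p → 1 ℕ.< p
  1<prime pr = ℕ.nonTrivial⇒n>1 _ {{prime⇒nonTrivial pr}}

  module _ {p : ℕ} (pr : Prime p) where

    private instance
      p-nonZero : NonZero p
      p-nonZero = prime⇒nonZero pr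

    prime-power-part : ∀ m → 0 ℕ.< m → ∃[ v ] ∃[ n ] 0 ℕ.< n × (m ≡ n ℕ.* p ℕ.^ v) × ¬ p ℕ.∣ n
    prime-power-part = <-rec _ step
      where
      step : ∀ m → (∀ {k} → k ℕ.< m → 0 ℕ.< k → ∃[ v ] ∃[ n ] 0 ℕ.< n × (k ≡ n ℕ.* p ℕ.^ v) × ¬ p ℕ.∣ n) →
             0 ℕ.< m → ∃[ v ] ∃[ n ] 0 ℕ.< n × (m ≡ n ℕ.* p ℕ.^ v) × ¬ p ℕ.∣ n
      step m rec 0<m with p ℕ.∣? m
      ... | no p∤m = 0 , m , 0<m , sym (ℕ.*-identityʳ m) , p∤m
      ... | yes (ℕ.divides zero    refl) = contradiction 0<m ℕ.n≮0
      ... | yes (ℕ.divides (suc k) refl) with rec (ℕ.m<m*n (suc k) p (1<prime pr)) (s≤s z≤n)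
      ...   | v , n , 0<n , eq , p∤n = suc v , n , 0<n ,
              trans (cong (ℕ._* p) eq) (lem n (p ℕ.^ v) p) , p∤n
        where lem : ∀ a b c → a ℕ.* b ℕ.* c ≡ a ℕ.* (c ℕ.* b)
              lem = ℕ.solve-∀

  prime-power-induction : (P : ℕ → Set) → P 1 →
    (∀ {p} n v → Prime p → 0 ℕ.< n → ¬ p ℕ.∣ n → P n → P (n ℕ.* p ℕ.^ suc v)) →
    ∀ m → 0 ℕ.< m → P m
  prime-power-induction P P1 Pstep = <-rec _ step
    where
    extend : ∀ {p} m → (∀ {k} → k ℕ.< m → 0 ℕ.< k → P k) → Prime p → p ℕ.∣ m →
             ∃[ v ] ∃[ n ] 0 ℕ.< n × (m ≡ n ℕ.* p ℕ.^ v) × ¬ p ℕ.∣ n → P m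
    extend m rec pr p∣m (zero , n , 0<n , eq , p∤n) =
      contradiction (subst (_ ℕ.∣_) (trans eq (ℕ.*-identityʳ n)) p∣m) p∤n
    extend {p} m rec pr p∣m (suc v , n , 0<n , refl , p∤n) =
      Pstep n v pr 0<n p∤n (rec (ℕ.m<m*n n (p ℕ.^ suc v) {{ℕ.>-nonZero 0<n}} 1<p^) 0<n)
      where
      1<p^ : 1 ℕ.< p ℕ.^ suc v
      1<p^ = ℕ.<-≤-trans (1<prime pr) (ℕ.m≤m*n p (p ℕ.^ v) {{ℕ.m^n≢0 p v {{prime⇒nonZero pr}}}})
    step : ∀ m → (∀ {k} → k ℕ.< m → 0 ℕ.< k → P k) → 0 ℕ.< m → P m
    step (suc zero)    rec 0<m = P1
    step m@(suc (suc _)) rec 0<m with prime-divisor m (s≤s (s≤s z≤n))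
    ... | p , pr , p∣m = extend m rec pr p∣m (prime-power-part pr m 0<m)

  module Sum (χ : ℕ → ℤ) (χ-* : ∀ a b → χ (a ℕ.* b) ≡ χ a * χ b) where

    divisorTerm : ℕ → ℕ → ℤ
    divisorTerm m d = ∑.when (d ℕ.∣? m) (χ d)

    r : ℕ → ℤ
    r m = ∑.fold (suc m) (divisorTerm m)

    -- The part of `r` over divisors prime to p. It does not change when m is multiplied by p, which
    -- turns the splitting of `r` into a recursion in the exponent of p.
    s : ℕ → ℕ → ℤ
    s p m = ∑.fold (suc m) (λ d → ∑.when (¬? (p ℕ.∣? d)) (divisorTerm m d))

    divisorTerm-large : ∀ {m d} → 0 ℕ.< m → m ℕ.< d → divisorTerm m d ≡ 0ℤ
    divisorTerm-large {m} {d} 0<m m<d = ∑.when-false (d ℕ.∣? m)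
      (λ d∣m → contradiction (ℕ.∣⇒≤ {{ℕ.>-nonZero 0<m}} d∣m) (ℕ.<⇒≱ m<d))

    r-extend : ∀ {m X} → 0 ℕ.< m → m ℕ.< X → ∑.fold X (divisorTerm m) ≡ r m
    r-extend {m} 0<m m<X = ∑.fold-extend (divisorTerm m) m<X (λ d → divisorTerm-large 0<m)

    s-extend : ∀ p {m X} → 0 ℕ.< m → m ℕ.< X → ∑.fold X (λ d → ∑.when (¬? (p ℕ.∣? d)) (divisorTerm m d)) ≡ s p m
    s-extend p {m} 0<m m<X = ∑.fold-extend _ m<X
      (λ d m<d → ∑.when-false (¬? (p ℕ.∣? d)) (λ _ → divisorTerm-large 0<m m<d))

    ∑-multiples : ∀ p Y (f : ℕ → ℤ) .{{_ : NonZero p}} →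
                  ∑.fold (Y ℕ.* p) (λ d → ∑.when (p ℕ.∣? d) (f d)) ≡ ∑.fold Y (λ i → f (i ℕ.* p))
    ∑-multiples p Y f = trans (∑.fold-blocks Y p _) (∑.fold-cong Y (λ i _ → block i))
      where
      block : ∀ i → ∑.fold p (λ j → ∑.when (p ℕ.∣? (i ℕ.* p ℕ.+ j)) (f (i ℕ.* p ℕ.+ j))) ≡ f (i ℕ.* p)
      block i = trans
        (∑.fold-single p 0 (ℕ.>-nonZero⁻¹ p) λ j j<p j≢0 → ∑.when-false (p ℕ.∣? (i ℕ.* p ℕ.+ j)) λ d →
          contradiction (ℕ.∣⇒≤ {{ℕ.≢-nonZero j≢0}} (ℕ.∣m+n∣m⇒∣n d (ℕ.n∣m*n i))) (ℕ.<⇒≱ j<p))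
        (trans (∑.when-true (p ℕ.∣? (i ℕ.* p ℕ.+ 0)) (subst (p ℕ.∣_) (sym (ℕ.+-identityʳ (i ℕ.* p))) (ℕ.n∣m*n i)))
          (cong f (ℕ.+-identityʳ (i ℕ.* p))))

    when-split : {P : Set} (p? : Dec P) (x : ℤ) → x ≡ ∑.when p? x + ∑.when (¬? p?) x
    when-split (yes _) x = sym (ℤ.+-identityʳ x)
    when-split (no _)  x = sym (ℤ.+-identityˡ x)

    when-cong : {P R : Set} (p? : Dec P) (r? : Dec R) {x y : ℤ} → (P → R) → (R → P) → x ≡ y → ∑.when p? x ≡ ∑.when r? y
    when-cong (yes p) r? to from eq = trans eq (sym (∑.when-true r? (to p)))
    when-cong (no ¬p) r? to from eq = sym (∑.when-false r? (λ r → contradiction (from r) ¬p))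

    module _ {p : ℕ} (pr : Prime p) where

      private instance
        p-nonZero : NonZero p
        p-nonZero = prime⇒nonZero pr

      primeTo-term : ∀ n d → ∑.when (¬? (p ℕ.∣? d)) (divisorTerm (n ℕ.* p) d) ≡ ∑.when (¬? (p ℕ.∣? d)) (divisorTerm n d)
      primeTo-term n d with p ℕ.∣? d
      ... | yes _  = refl
      ... | no p∤d = when-cong (d ℕ.∣? (n ℕ.* p)) (d ℕ.∣? n)
        (λ d∣np → coprime-divisor (coprime-sym (prime-coprime pr p∤d)) (subst (d ℕ.∣_) (ℕ.*-comm n p) d∣np))
        (λ d∣n → ℕ.∣m⇒∣m*n p d∣n) refl

      n<Y*p : ∀ n → n ℕ.* p ℕ.< suc n ℕ.* p
      n<Y*p n = ℕ.*-monoˡ-< p (ℕ.n<1+n n)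

      n<X : ∀ n → n ℕ.< suc n ℕ.* p
      n<X n = ℕ.m≤m*n (suc n) p

      0<n*p : ∀ {n} → 0 ℕ.< n → 0 ℕ.< n ℕ.* p
      0<n*p {n} 0<n = ℕ.<-≤-trans 0<n (ℕ.m≤m*n n p)

      s-* : ∀ n → 0 ℕ.< n → s p (n ℕ.* p) ≡ s p n
      s-* n 0<n = trans (sym (s-extend p (0<n*p 0<n) (n<Y*p n)))
        (trans (∑.fold-cong (suc n ℕ.* p) (λ d _ → primeTo-term n d)) (s-extend p 0<n (n<X n)))

      -- The divisors of n p that are multiples of p are the i p with i ∣ n, and they contribute
      -- χ(p) r(n). The others are prime to p and hence divide n.
      r-* : ∀ n → 0 ℕ.< n → r (n ℕ.* p) ≡ χ p * r n + s p n
      r-* n 0<n = begin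
        r (n ℕ.* p)                                                             ≡⟨ sym (r-extend (0<n*p 0<n) (n<Y*p n)) ⟩
        ∑.fold X (divisorTerm (n ℕ.* p))                                        ≡⟨ ∑.fold-cong X (λ d _ → when-split (p ℕ.∣? d) _) ⟩
        ∑.fold X (λ d → ∑.when (p ℕ.∣? d) (divisorTerm (n ℕ.* p) d) +
                        ∑.when (¬? (p ℕ.∣? d)) (divisorTerm (n ℕ.* p) d))       ≡⟨ ∑.fold-∙ X _ _ ⟩
        ∑.fold X (λ d → ∑.when (p ℕ.∣? d) (divisorTerm (n ℕ.* p) d)) +
        ∑.fold X (λ d → ∑.when (¬? (p ℕ.∣? d)) (divisorTerm (n ℕ.* p) d))       ≡⟨ cong₂ _+_ multiples others ⟩
        χ p * r n + s p n                                                       ∎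
        where
        open ≡-Reasoning
        X = suc n ℕ.* p
        scaled : ∀ i → divisorTerm (n ℕ.* p) (i ℕ.* p) ≡ χ p * divisorTerm n i
        scaled i with i ℕ.∣? n
        ... | yes i∣n = trans (∑.when-true ((i ℕ.* p) ℕ.∣? (n ℕ.* p)) (ℕ.*-monoˡ-∣ p i∣n)) (trans (χ-* i p) (ℤ.*-comm (χ i) (χ p)))
        ... | no i∤n  = trans (∑.when-false ((i ℕ.* p) ℕ.∣? (n ℕ.* p)) (λ d → contradiction (ℕ.*-cancelʳ-∣ p d) i∤n)) (sym (ℤ.*-zeroʳ (χ p)))
        multiples : ∑.fold X (λ d → ∑.when (p ℕ.∣? d) (divisorTerm (n ℕ.* p) d)) ≡ χ p * r n
        multiples = trans (∑-multiples p (suc n) (divisorTerm (n ℕ.* p)))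
          (trans (∑.fold-cong (suc n) (λ i _ → scaled i)) (∑-*ˡ (suc n) (χ p) (divisorTerm n)))
        others : ∑.fold X (λ d → ∑.when (¬? (p ℕ.∣? d)) (divisorTerm (n ℕ.* p) d)) ≡ s p n
        others = trans (s-extend p (0<n*p 0<n) (n<Y*p n)) (s-* n 0<n)

      s≡r : ∀ n → ¬ p ℕ.∣ n → s p n ≡ r n
      s≡r n p∤n = ∑.fold-cong (suc n) λ d _ → term d
        where
        term : ∀ d → ∑.when (¬? (p ℕ.∣? d)) (divisorTerm n d) ≡ divisorTerm n d
        term d with p ℕ.∣? d
        ... | yes p∣d = sym (∑.when-false (d ℕ.∣? n) (λ d∣n → contradiction (ℕ.∣-trans p∣d d∣n) p∤n))
        ... | no _    = refl

      -- Horner's form of 1 + χ(p) + ... + χ(p)^v, the local factor of `r` at p.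
      geometric : ℕ → ℤ
      geometric zero    = 1ℤ
      geometric (suc v) = χ p * geometric v + 1ℤ

      module _ {n : ℕ} (0<n : 0 ℕ.< n) (p∤n : ¬ p ℕ.∣ n) where

        power-suc : ∀ v → n ℕ.* p ℕ.^ suc v ≡ n ℕ.* p ℕ.^ v ℕ.* p
        power-suc v = lem n p (p ℕ.^ v)
          where lem : ∀ n p q → n ℕ.* (p ℕ.* q) ≡ n ℕ.* q ℕ.* p
                lem = ℕ.solve-∀

        0<np^v : ∀ v → 0 ℕ.< n ℕ.* p ℕ.^ v
        0<np^v v = ℕ.<-≤-trans 0<n (ℕ.m≤m*n n (p ℕ.^ v) {{ℕ.m^n≢0 p v}})

        s-power : ∀ v → s p (n ℕ.* p ℕ.^ v) ≡ r n
        s-power zero    = trans (cong (s p) (ℕ.*-identityʳ n)) (s≡r n p∤n)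
        s-power (suc v) = trans (cong (s p) (power-suc v)) (trans (s-* _ (0<np^v v)) (s-power v))

        r-power : ∀ v → r (n ℕ.* p ℕ.^ v) ≡ geometric v * r n
        r-power zero    = trans (cong r (ℕ.*-identityʳ n)) (sym (ℤ.*-identityˡ (r n)))
        r-power (suc v) = trans (cong r (power-suc v)) (trans (r-* _ (0<np^v v))
          (trans (cong₂ (λ x y → χ p * x + y) (r-power v) (s-power v)) (lem (χ p) (geometric v) (r n))))
          where lem : ∀ c g r → c * (g * r) + r ≡ (c * g + 1ℤ) * r
                lem = solve-∀

    module Values (χ-1 : χ 1 ≡ 1ℤ) (χ-value : ∀ a → χ a ≡ 0ℤ ⊎ χ a ≡ 1ℤ ⊎ χ a ≡ - 1ℤ) where

      r-1 : r 1 ≡ 1ℤ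
      r-1 = trans (ℤ.+-identityˡ (χ 1)) χ-1

      geometric-pair : ∀ {p} (pr : Prime p) → χ p ≡ - 1ℤ → ∀ v → geometric pr (suc (suc v)) ≡ geometric pr v
      geometric-pair pr eq v rewrite eq = lem (geometric pr v)
        where lem : ∀ g → - 1ℤ * (- 1ℤ * g + 1ℤ) + 1ℤ ≡ g
              lem = solve-∀

      geometric-residue : ∀ {p} (pr : Prime p) → χ p ≡ 1ℤ → ∀ v → geometric pr v ≡ + suc v
      geometric-residue pr eq zero    = refl
      geometric-residue pr eq (suc v) rewrite eq =
        trans (cong (λ t → 1ℤ * t + 1ℤ) (geometric-residue pr eq v))
          (trans (cong (_+ 1ℤ) (ℤ.*-identityˡ (+ suc v))) (cong +_ (ℕ.+-comm (suc v) 1)))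

      geometric-even : ∀ {p} (pr : Prime p) w → 0ℤ ℤ.< geometric pr (w ℕ.+ w)
      geometric-even pr zero    = +<+ (s≤s z≤n)
      geometric-even {p} pr (suc w) with χ-value p
      ... | inj₁ eq rewrite eq = +<+ (s≤s z≤n)
      ... | inj₂ (inj₁ eq) = subst (0ℤ ℤ.<_) (sym (geometric-residue pr eq (suc w ℕ.+ suc w))) (+<+ (s≤s z≤n))
      ... | inj₂ (inj₂ eq) = subst (0ℤ ℤ.<_)
            (sym (trans (cong (geometric pr ∘ suc) (ℕ.+-suc w w)) (geometric-pair pr eq (w ℕ.+ w)))) (geometric-even pr w)

      geometric-odd : ∀ {p} (pr : Prime p) → χ p ≡ - 1ℤ → ∀ w → geometric pr (suc (w ℕ.+ w)) ≡ 0ℤ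
      geometric-odd pr eq zero rewrite eq = refl
      geometric-odd pr eq (suc w) = trans (cong (geometric pr ∘ suc ∘ suc) (ℕ.+-suc w w))
        (trans (geometric-pair pr eq (suc (w ℕ.+ w))) (geometric-odd pr eq w))

      geometric-≥0 : ∀ {p} (pr : Prime p) v → 0ℤ ℤ.≤ geometric pr v
      geometric-≥0 {p} pr v with parity v
      ... | inj₁ (w , refl) = ℤ.<⇒≤ (geometric-even pr w)
      ... | inj₂ (w , refl) with χ-value p
      ...   | inj₁ eq rewrite eq = +≤+ z≤n
      ...   | inj₂ (inj₁ eq) = subst (0ℤ ℤ.≤_) (sym (geometric-residue pr eq (suc (w ℕ.+ w)))) (+≤+ z≤n)
      ...   | inj₂ (inj₂ eq) = ℤ.≤-reflexive (sym (geometric-odd pr eq w))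

      *-≥0 : ∀ {x y} → 0ℤ ℤ.≤ x → 0ℤ ℤ.≤ y → 0ℤ ℤ.≤ x * y
      *-≥0 (+≤+ {n = m} _) (+≤+ {n = n} _) = subst (0ℤ ℤ.≤_) (ℤ.pos-* m n) (+≤+ z≤n)

      *->0 : ∀ {x y} → 0ℤ ℤ.< x → 0ℤ ℤ.< y → 0ℤ ℤ.< x * y
      *->0 (+<+ {n = suc m} _) (+<+ {n = suc n} _) = +<+ (s≤s z≤n)

      r-≥0 : ∀ m → 0 ℕ.< m → 0ℤ ℤ.≤ r m
      r-≥0 = prime-power-induction (λ m → 0ℤ ℤ.≤ r m) (subst (0ℤ ℤ.≤_) (sym r-1) (+≤+ z≤n))
        (λ n v pr 0<n p∤n ih → subst (0ℤ ℤ.≤_) (sym (r-power pr 0<n p∤n (suc v))) (*-≥0 (geometric-≥0 pr (suc v)) ih))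

      -- All exponents in a square are even, and the local factor at an even exponent v is 1, v + 1
      -- or 1 when χ(p) is 0, 1 or -1.
      r-square>0 : ∀ k → 0 ℕ.< k → 0ℤ ℤ.< r (k ℕ.* k)
      r-square>0 = prime-power-induction (λ k → 0ℤ ℤ.< r (k ℕ.* k)) (subst (0ℤ ℤ.<_) (sym r-1) (+<+ (s≤s z≤n))) step
        where
        step : ∀ {p} n v → Prime p → 0 ℕ.< n → ¬ p ℕ.∣ n → 0ℤ ℤ.< r (n ℕ.* n) →
               0ℤ ℤ.< r ((n ℕ.* p ℕ.^ suc v) ℕ.* (n ℕ.* p ℕ.^ suc v))
        step {p} n v pr 0<n p∤n ih = subst (0ℤ ℤ.<_) (sym (trans (cong r square)
            (r-power pr (ℕ.*-mono-< 0<n 0<n) p∤n² (suc v ℕ.+ suc v)))) (*->0 (geometric-even pr (suc v)) ih)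
          where
          p∤n² : ¬ p ℕ.∣ n ℕ.* n
          p∤n² d = [ p∤n , p∤n ]′ (euclidsLemma n n pr d)
          square : (n ℕ.* p ℕ.^ suc v) ℕ.* (n ℕ.* p ℕ.^ suc v) ≡ n ℕ.* n ℕ.* p ℕ.^ (suc v ℕ.+ suc v)
          square = trans (lem n (p ℕ.^ suc v)) (cong (n ℕ.* n ℕ.*_) (sym (ℕ.^-distribˡ-+-* p (suc v) (suc v))))
            where lem : ∀ n q → (n ℕ.* q) ℕ.* (n ℕ.* q) ≡ n ℕ.* n ℕ.* (q ℕ.* q)
                  lem = ℕ.solve-∀

      module Represent (M : ℕ) (Q : ℕ)
        (residue : ∀ p → Prime p → χ p ≡ 1ℤ → ∃[ t ] p ℕ.∣ t ℕ.* t ℕ.+ M)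
        (χ-coprime : ∀ a → Coprime a Q → χ a ≢ 0ℤ) where

        Represented : ℕ → Set
        Represented m = ∃[ m′ ] ∃[ k ] ∃[ t ] (m ≡ m′ ℕ.* (k ℕ.* k)) × (+ m′ ∣ t * t + + M)

        chinese : ∀ {p n} → Coprime p n → ∀ u t → + p ∣ u * u + + M → + n ∣ t * t + + M →
                  ∃[ x ] + (n ℕ.* p) ∣ x * x + + M
        chinese {p} {n} cop u t p∣ n∣ with coprime-inverse cop
        ... | b , bp≡1 = x , ∣ᵤ⇒∣ both
          where
          -- As b p is 0 modulo p and 1 modulo n, this x is u modulo p and t modulo n.
          x = u + + b * + p * (t - u)
          p∣x : + p ∣ x * x + + M
          p∣x = ∣-resp (lem u t (+ b) (+ p) (+ M)) (∣m∣n⇒∣m+n p∣ (∣n⇒∣m*n (+ b * (t - u) * (u + x)) ∣-refl))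
            where lem : ∀ u t b p m → u * u + m + b * (t - u) * (u + (u + b * p * (t - u))) * p ≡
                                      (u + b * p * (t - u)) * (u + b * p * (t - u)) + m
                  lem = solve-∀
          n∣x : + n ∣ x * x + + M
          n∣x = ∣-resp (lem u t (+ b * + p) (+ M)) (∣m∣n⇒∣m+n n∣ (∣m⇒∣m*n ((t - u) * (t + x)) bp≡1))
            where lem : ∀ u t c m → t * t + m + (c - 1ℤ) * ((t - u) * (t + (u + c * (t - u)))) ≡
                                    (u + c * (t - u)) * (u + c * (t - u)) + m
                  lem = solve-∀
          both : n ℕ.* p ℕ.∣ ℤ.∣ x * x + + M ∣
          both = coprime-product (∣⇒∣ᵤ n∣x) (∣⇒∣ᵤ p∣x)
            where
            coprime-product : ∀ {X} → n ℕ.∣ X → p ℕ.∣ X → n ℕ.* p ℕ.∣ X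
            coprime-product (ℕ.divides y refl) d = subst (ℕ._∣ y ℕ.* n) (ℕ.*-comm p n)
              (ℕ.*-monoˡ-∣ n (coprime-divisor cop (subst (p ℕ.∣_) (ℕ.*-comm y n) d)))

        -- An odd exponent of p forces χ(p) = 1, since the local factor vanishes for χ(p) = -1 and
        -- coprimality to Q excludes 0. Then -M is a square modulo p; one factor p joins m′ by the
        -- Chinese remainder theorem, and the remaining even power goes into the square.
        r≢0⇒represented : ∀ m → 0 ℕ.< m → Coprime m Q → r m ≢ 0ℤ → Represented m
        r≢0⇒represented = prime-power-induction (λ m → Coprime m Q → r m ≢ 0ℤ → Represented m)
          (λ _ _ → 1 , 1 , 0ℤ , refl , divides (0ℤ * 0ℤ + + M) (sym (ℤ.*-identityʳ _))) step
          where
          step : ∀ {p} n v → Prime p → 0 ℕ.< n → ¬ p ℕ.∣ n → (Coprime n Q → r n ≢ 0ℤ → Represented n) →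
                 Coprime (n ℕ.* p ℕ.^ suc v) Q → r (n ℕ.* p ℕ.^ suc v) ≢ 0ℤ → Represented (n ℕ.* p ℕ.^ suc v)
          step {p} n v pr 0<n p∤n ih cop r≢0 =
              conclude (parity (suc v)) (ih (λ (d∣n , d∣Q) → cop (ℕ.∣m⇒∣m*n _ d∣n , d∣Q)) rn≢0)
            where
            r≡ : r (n ℕ.* p ℕ.^ suc v) ≡ geometric pr (suc v) * r n
            r≡ = r-power pr 0<n p∤n (suc v)
            rn≢0 : r n ≢ 0ℤ
            rn≢0 eq = r≢0 (trans r≡ (trans (cong (geometric pr (suc v) *_) eq) (ℤ.*-zeroʳ (geometric pr (suc v)))))
            p⊥Q : Coprime p Q
            p⊥Q (d∣p , d∣Q) = cop (ℕ.∣n⇒∣m*n n (ℕ.∣m⇒∣m*n (p ℕ.^ v) d∣p) , d∣Q)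
            χp≡1 : ∀ w → suc v ≡ suc (w ℕ.+ w) → χ p ≡ 1ℤ
            χp≡1 w eq with χ-value p
            ... | inj₁ χ≡0 = contradiction χ≡0 (χ-coprime p p⊥Q)
            ... | inj₂ (inj₁ χ≡1) = χ≡1
            ... | inj₂ (inj₂ χ≡-1) = contradiction
                  (trans r≡ (cong (_* r n) (trans (cong (geometric pr) eq) (geometric-odd pr χ≡-1 w)))) r≢0
            conclude : (∃[ w ] suc v ≡ w ℕ.+ w) ⊎ (∃[ w ] suc v ≡ suc (w ℕ.+ w)) → Represented n →
                       Represented (n ℕ.* p ℕ.^ suc v)
            conclude (inj₁ (w , eq)) (m′ , k , t , n≡ , d) = m′ , k ℕ.* p ℕ.^ w , t ,
              trans (cong₂ ℕ._*_ n≡ (trans (cong (p ℕ.^_) eq) (ℕ.^-distribˡ-+-* p w w))) (lem m′ k (p ℕ.^ w)) , d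
              where lem : ∀ m k q → m ℕ.* (k ℕ.* k) ℕ.* (q ℕ.* q) ≡ m ℕ.* (k ℕ.* q ℕ.* (k ℕ.* q))
                    lem = ℕ.solve-∀
            conclude (inj₂ (w , eq)) (m′ , k , t , n≡ , d) = assemble (chinese (prime-coprime pr p∤m′) (+ proj₁ root) t
                (∣-resp (cong (_+ + M) (ℤ.pos-* (proj₁ root) (proj₁ root))) (∣ᵤ⇒∣ (proj₂ root))) d)
              where
              root : ∃[ u ] p ℕ.∣ u ℕ.* u ℕ.+ M
              root = residue p pr (χp≡1 w eq)
              p∤m′ : ¬ p ℕ.∣ m′
              p∤m′ p∣m′ = p∤n (subst (p ℕ.∣_) (sym n≡) (ℕ.∣m⇒∣m*n (k ℕ.* k) p∣m′))
              lem : ∀ m k p q → m ℕ.* (k ℕ.* k) ℕ.* (p ℕ.* (q ℕ.* q)) ≡ m ℕ.* p ℕ.* (k ℕ.* q ℕ.* (k ℕ.* q))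
              lem = ℕ.solve-∀
              assemble : (∃[ x ] + (m′ ℕ.* p) ∣ x * x + + M) → Represented (n ℕ.* p ℕ.^ suc v)
              assemble (x , d′) = m′ ℕ.* p , k ℕ.* p ℕ.^ w , x ,
                trans (cong₂ ℕ._*_ n≡ (trans (cong (p ℕ.^_) eq) (cong (p ℕ.*_) (ℕ.^-distribˡ-+-* p w w)))) (lem m′ k p (p ℕ.^ w)) , d′

-- Weighted sums of a doubly periodic kernel.

module Kernel where

  open BigOp
  open DivisorSum using (∑-*ˡ)
  open import Data.Nat.Base using (_∸_)
  open import Data.Nat.DivMod using (_/_; _%_; m≡m%n+[m/n]*n; m%n<n; m/n≤m)
  open import Data.Integer.Base using (∣_∣)

  ∑-*ʳ : ∀ n f c → ∑.fold n (λ i → f i * c) ≡ ∑.fold n f * c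
  ∑-*ʳ n f c = trans (∑.fold-cong n (λ i _ → ℤ.*-comm (f i) c)) (trans (∑-*ˡ n c f) (ℤ.*-comm c _))

  ∑-const : ∀ n c → ∑.fold n (λ _ → c) ≡ + n * c
  ∑-const zero    c = refl
  ∑-const (suc n) c = trans (cong (_+ c) (∑-const n c)) (lem (+ n) c)
    where lem : ∀ n c → n * c + c ≡ (1ℤ + n) * c
          lem = solve-∀

  ∣∑∣≤ : ∀ n f B → (∀ i → i ℕ.< n → ∣ f i ∣ ℕ.≤ B) → ∣ ∑.fold n f ∣ ℕ.≤ n ℕ.* B
  ∣∑∣≤ zero    f B bound = z≤n
  ∣∑∣≤ (suc n) f B bound = ℕ.≤-trans (ℤ.∣i+j∣≤∣i∣+∣j∣ (∑.fold n f) (f n))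
    (subst (∣ ∑.fold n f ∣ ℕ.+ ∣ f n ∣ ℕ.≤_) (ℕ.+-comm (n ℕ.* B) B)
      (ℕ.+-mono-≤ (∣∑∣≤ n f B (λ i i<n → bound i (ℕ.m<n⇒m<1+n i<n))) (bound n (ℕ.n<1+n n))))

  ∣*∣≤ : ∀ x y {X Y} → ∣ x ∣ ℕ.≤ X → ∣ y ∣ ℕ.≤ Y → ∣ x * y ∣ ℕ.≤ X ℕ.* Y
  ∣*∣≤ x y {X} {Y} p q = subst (ℕ._≤ X ℕ.* Y) (sym (ℤ.abs-* x y)) (ℕ.*-mono-≤ p q)

  ∣∣≤-resp : ∀ {x y n} → x ≡ y → ∣ x ∣ ℕ.≤ n → ∣ y ∣ ℕ.≤ n
  ∣∣≤-resp refl le = le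

  pos-∸ : ∀ {m n} → m ℕ.≤ n → + (n ∸ m) ≡ + n - + m
  pos-∸ {m} {n} m≤n = trans (sym (ℤ.⊖-≥ m≤n)) (sym (ℤ.m-n≡m⊖n n m))

  module Row (Q : ℕ) .{{_ : NonZero Q}} (k : ℕ → ℤ)
    (k-periodic : ∀ i v → k (i ℕ.* Q ℕ.+ v) ≡ k v)
    (k-sum : ∑.fold Q k ≡ 0ℤ)
    (k-bound : ∀ v → ∣ k v ∣ ℕ.≤ 1) where

    moment : ℤ
    moment = ∑.fold Q (λ v → k v * + v)

    ∣moment∣≤ : ∣ moment ∣ ℕ.≤ Q ℕ.* Q
    ∣moment∣≤ = ∣∑∣≤ Q _ Q (λ v v<Q → ℕ.≤-trans (∣*∣≤ (k v) (+ v) (k-bound v) (ℕ.<⇒≤ v<Q)) (ℕ.≤-reflexive (ℕ.*-identityˡ Q)))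

    -- The constant part of an affine function is annihilated by the zero sum.
    affine-block : ∀ α β → ∑.fold Q (λ v → k v * (α + β * + v)) ≡ β * moment
    affine-block α β = begin
      ∑.fold Q (λ v → k v * (α + β * + v))                    ≡⟨ ∑.fold-cong Q (λ v _ → lem (k v) α β (+ v)) ⟩
      ∑.fold Q (λ v → k v * α + β * (k v * + v))              ≡⟨ ∑.fold-∙ Q _ _ ⟩
      ∑.fold Q (λ v → k v * α) + ∑.fold Q (λ v → β * (k v * + v)) ≡⟨ cong₂ _+_ (trans (∑-*ʳ Q k α) (cong (_* α) k-sum)) (∑-*ˡ Q β _) ⟩
      0ℤ * α + β * moment                                     ≡⟨ lem₂ α (β * moment) ⟩
      β * moment                                              ∎
      where
      open ≡-Reasoning
      lem : ∀ k α β v → k * (α + β * v) ≡ k * α + β * (k * v)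
      lem = solve-∀
      lem₂ : ∀ α x → 0ℤ * α + x ≡ x
      lem₂ = solve-∀

    first-moment : ∀ n → ∑.fold (n ℕ.* Q) (λ b → k b * + b) ≡ + n * moment
    first-moment n = trans (∑.fold-blocks n Q _) (trans (∑.fold-cong n (λ i _ → block i)) (∑-const n moment))
      where
      block : ∀ i → ∑.fold Q (λ v → k (i ℕ.* Q ℕ.+ v) * + (i ℕ.* Q ℕ.+ v)) ≡ moment
      block i = trans (∑.fold-cong Q (λ v _ → cong₂ _*_ (k-periodic i v)
          (trans (ℤ.pos-+ (i ℕ.* Q) v) (cong (λ t → + (i ℕ.* Q) + t) (sym (ℤ.*-identityˡ (+ v)))))))
        (trans (affine-block (+ (i ℕ.* Q)) 1ℤ) (ℤ.*-identityˡ moment))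

    total : ∀ n → ∑.fold (n ℕ.* Q) k ≡ 0ℤ
    total n = trans (∑.fold-blocks n Q k)
      (∑.fold-ε n (λ i _ → trans (∑.fold-cong Q (λ v _ → k-periodic i v)) k-sum))

    module _ (Zq a : ℕ) .{{_ : NonZero a}} where

      private
        Z = Zq ℕ.* Q
        n = Zq / a
        ρ = Zq % a

      weighted : ℤ
      weighted = ∑.fold (suc Zq ℕ.* Q) (λ b → k b * + (Z ∸ a ℕ.* b))

      private
        -- The contribution of one period. The truncated weight is affine on the periods i < n,
        -- breaks off within the period n and vanishes from then on.
        β : ℕ → ℤ
        β i = ∑.fold Q (λ v → k v * + (Z ∸ a ℕ.* (i ℕ.* Q ℕ.+ v)))

        na≤Zq : n ℕ.* a ℕ.≤ Zq
        na≤Zq = subst (n ℕ.* a ℕ.≤_) (sym (m≡m%n+[m/n]*n Zq a)) (ℕ.m≤n+m (n ℕ.* a) ρ)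

        Zq<[1+n]a : Zq ℕ.< suc n ℕ.* a
        Zq<[1+n]a = subst (ℕ._< suc n ℕ.* a) (sym (m≡m%n+[m/n]*n Zq a)) (ℕ.+-monoˡ-< (n ℕ.* a) (m%n<n Zq a))

        inner : ∀ i → i ℕ.< n → β i ≡ - (+ a) * moment
        inner i i<n = trans (∑.fold-cong Q (λ v v<Q → cong (k v *_) (affine v v<Q)))
                            (affine-block (+ Z - + a * + (i ℕ.* Q)) (- (+ a)))
          where
          small : ∀ v → v ℕ.< Q → a ℕ.* (i ℕ.* Q ℕ.+ v) ℕ.≤ Z
          small v v<Q = ℕ.≤-trans (ℕ.*-monoʳ-≤ a (ℕ.≤-trans (ℕ.+-monoʳ-≤ (i ℕ.* Q) (ℕ.<⇒≤ v<Q))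
              (subst (ℕ._≤ n ℕ.* Q) (ℕ.+-comm Q (i ℕ.* Q)) (ℕ.*-monoˡ-≤ Q i<n))))
            (subst (ℕ._≤ Z) (lem a n Q) (ℕ.*-monoˡ-≤ Q na≤Zq))
            where lem : ∀ a n Q → n ℕ.* a ℕ.* Q ≡ a ℕ.* (n ℕ.* Q)
                  lem = ℕ.solve-∀
          affine : ∀ v → v ℕ.< Q → + (Z ∸ a ℕ.* (i ℕ.* Q ℕ.+ v)) ≡ (+ Z - + a * + (i ℕ.* Q)) + - (+ a) * + v
          affine v v<Q = trans (pos-∸ (small v v<Q)) (trans
            (cong (λ t → + Z - t) (trans (ℤ.pos-* a _) (cong (+ a *_) (ℤ.pos-+ (i ℕ.* Q) v))))
            (lem (+ Z) (+ a) (+ (i ℕ.* Q)) (+ v)))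
            where lem : ∀ Z a x v → Z - a * (x + v) ≡ (Z - a * x) + - a * v
                  lem = solve-∀

        boundary : ∣ β n ∣ ℕ.≤ Q ℕ.* (a ℕ.* Q)
        boundary = ∣∑∣≤ Q _ (a ℕ.* Q) (λ v v<Q → ℕ.≤-trans
            (∣*∣≤ (k v) (+ (Z ∸ a ℕ.* (n ℕ.* Q ℕ.+ v))) (k-bound v) (value v)) (ℕ.≤-reflexive (ℕ.*-identityˡ (a ℕ.* Q))))
          where
          value : ∀ v → Z ∸ a ℕ.* (n ℕ.* Q ℕ.+ v) ℕ.≤ a ℕ.* Q
          value v = ℕ.m≤n+o⇒m∸n≤o Z _ (ℕ.≤-trans (ℕ.*-monoˡ-≤ Q (ℕ.<⇒≤ Zq<[1+n]a))
            (subst (ℕ._≤ a ℕ.* (n ℕ.* Q ℕ.+ v) ℕ.+ a ℕ.* Q) (lem a n Q)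
              (ℕ.+-monoˡ-≤ (a ℕ.* Q) (ℕ.*-monoʳ-≤ a (ℕ.m≤m+n (n ℕ.* Q) v)))))
            where lem : ∀ a n Q → a ℕ.* (n ℕ.* Q) ℕ.+ a ℕ.* Q ≡ suc n ℕ.* a ℕ.* Q
                  lem = ℕ.solve-∀

        outer : ∀ j → β (suc n ℕ.+ j) ≡ 0ℤ
        outer j = ∑.fold-ε Q (λ v _ → trans (cong (λ t → k v * + t) (ℕ.m≤n⇒m∸n≡0 (large v))) (ℤ.*-zeroʳ (k v)))
          where
          large : ∀ v → Z ℕ.≤ a ℕ.* ((suc n ℕ.+ j) ℕ.* Q ℕ.+ v)
          large v = ℕ.≤-trans (ℕ.*-monoˡ-≤ Q (ℕ.<⇒≤ Zq<[1+n]a)) (subst (ℕ._≤ a ℕ.* ((suc n ℕ.+ j) ℕ.* Q ℕ.+ v)) (lem a (suc n) Q)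
              (ℕ.*-monoʳ-≤ a (ℕ.≤-trans (ℕ.*-monoˡ-≤ Q (ℕ.m≤m+n (suc n) j)) (ℕ.m≤m+n _ v))))
            where lem : ∀ a n Q → a ℕ.* (n ℕ.* Q) ≡ n ℕ.* a ℕ.* Q
                  lem = ℕ.solve-∀

        split : weighted ≡ + n * (- (+ a) * moment) + β n
        split = begin
          weighted                                        ≡⟨ ∑.fold-blocks (suc Zq) Q _ ⟩
          ∑.fold (suc Zq) (λ i → ∑.fold Q (λ v → k (i ℕ.* Q ℕ.+ v) * + (Z ∸ a ℕ.* (i ℕ.* Q ℕ.+ v))))
                                                          ≡⟨ ∑.fold-cong (suc Zq) (λ i _ → ∑.fold-cong Q (λ v _ → cong (_* + (Z ∸ a ℕ.* (i ℕ.* Q ℕ.+ v))) (k-periodic i v))) ⟩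
          ∑.fold (suc Zq) β                               ≡⟨ cong (λ t → ∑.fold (suc t) β) (sym (ℕ.m+[n∸m]≡n (m/n≤m Zq a))) ⟩
          ∑.fold (suc n ℕ.+ (Zq ∸ n)) β                   ≡⟨ ∑.fold-+ (suc n) (Zq ∸ n) β ⟩
          ∑.fold n β + β n + ∑.fold (Zq ∸ n) (λ j → β (suc n ℕ.+ j)) ≡⟨ cong₂ (λ x y → x + β n + y) (trans (∑.fold-cong n inner) (∑-const n _)) (∑.fold-ε (Zq ∸ n) (λ j _ → outer j)) ⟩
          + n * (- (+ a) * moment) + β n + 0ℤ             ≡⟨ ℤ.+-identityʳ _ ⟩
          + n * (- (+ a) * moment) + β n                  ∎
          where open ≡-Reasoning

      -- The n full periods contribute -a `moment` each, and n a = Zq - ρ with ρ < a. So the main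
      -- term -Zq `moment` has a factor Zq that is the same for every row, and it can cancel when
      -- rows are summed.
      weighted-bound : ∣ weighted + + Zq * moment ∣ ℕ.≤ a ℕ.* (Q ℕ.* Q) ℕ.+ a ℕ.* (Q ℕ.* Q)
      weighted-bound = ∣∣≤-resp (sym value) (ℕ.≤-trans (ℤ.∣i+j∣≤∣i∣+∣j∣ (+ ρ * moment) (β n))
          (ℕ.+-mono-≤ (∣*∣≤ (+ ρ) moment (ℕ.<⇒≤ (m%n<n Zq a)) ∣moment∣≤)
                      (subst (∣ β n ∣ ℕ.≤_) (lem₂ a Q) boundary)))
        where
        lem₂ : ∀ a Q → Q ℕ.* (a ℕ.* Q) ≡ a ℕ.* (Q ℕ.* Q)
        lem₂ = ℕ.solve-∀
        lem : ∀ n a μ b ρ → n * (- a * μ) + b + (ρ + n * a) * μ ≡ ρ * μ + b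
        lem = solve-∀
        value : weighted + + Zq * moment ≡ + ρ * moment + β n
        value = trans (cong₂ (λ x y → x + y * moment) split
            (trans (cong +_ (m≡m%n+[m/n]*n Zq a)) (trans (ℤ.pos-+ ρ (n ℕ.* a)) (cong (λ t → + ρ + t) (ℤ.pos-* n a)))))
          (lem (+ n) (+ a) moment (β n) (+ ρ))

  module TwoSided (Q : ℕ) .{{_ : NonZero Q}} (k : ℕ → ℕ → ℤ)
    (k-periodicʳ : ∀ a i v → k a (i ℕ.* Q ℕ.+ v) ≡ k a v)
    (k-periodicˡ : ∀ b i u → k (i ℕ.* Q ℕ.+ u) b ≡ k u b)
    (rows : ∀ a → ∑.fold Q (k a) ≡ 0ℤ)
    (columns : ∀ b → ∑.fold Q (λ a → k a b) ≡ 0ℤ)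
    (k-0 : ∀ b → k 0 b ≡ 0ℤ)
    (k-bound : ∀ a b → ∣ k a b ∣ ℕ.≤ 1)
    (B : ℕ) where

    module R (a : ℕ) = Row Q (k a) (k-periodicʳ a) (rows a) (k-bound a)

    -- Z = A² puts the corner of the hyperbola a b = Z at (A, A), and all of A, Z and X are
    -- multiples of Q, so that the ranges consist of whole periods.
    A Zq Z X : ℕ
    A  = B ℕ.* Q
    Zq = B ℕ.* A
    Z  = Zq ℕ.* Q
    X  = suc Zq ℕ.* Q

    κ : ℕ → ℤ
    κ a = R.moment a

    κ-periodic : ∀ i u → κ (i ℕ.* Q ℕ.+ u) ≡ κ u
    κ-periodic i u = ∑.fold-cong Q (λ v _ → cong (_* + v) (k-periodicˡ v i u))

    κ-sum : ∑.fold Q κ ≡ 0ℤ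
    κ-sum = trans (∑.fold-swap Q Q _) (∑.fold-ε Q (λ v _ →
      trans (∑-*ʳ Q (λ u → k u v) (+ v)) (trans (cong (_* + v) (columns v)) refl)))

    term : ℕ → ℕ → ℤ
    term a b = k a b * + (Z ∸ a ℕ.* b)

    row : ∀ a → a ℕ.< A → ∣ ∑.fold X (term a) + + Zq * κ a ∣ ℕ.≤ A ℕ.* (Q ℕ.* Q) ℕ.+ A ℕ.* (Q ℕ.* Q)
    row zero    _   = ∣∣≤-resp (sym (trans
        (cong₂ (λ x y → x + + Zq * y) (∑.fold-ε X (λ b _ → cong (_* + (Z ∸ 0)) (k-0 b))) (∑.fold-ε Q (λ v _ → cong (_* + v) (k-0 v))))
        (trans (ℤ.+-identityˡ _) (ℤ.*-zeroʳ (+ Zq))))) z≤n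
    row (suc a) a<A = ℕ.≤-trans (R.weighted-bound (suc a) Zq (suc a)) (ℕ.+-mono-≤ le le)
      where le = ℕ.*-monoˡ-≤ (Q ℕ.* Q) (ℕ.<⇒≤ a<A)

    κ-total : ∑.fold A κ ≡ 0ℤ
    κ-total = trans (∑.fold-blocks B Q κ) (∑.fold-ε B (λ i _ → trans (∑.fold-cong Q (λ u _ → κ-periodic i u)) κ-sum))

    strip : ℤ
    strip = ∑.fold A (λ a → ∑.fold X (term a))

    -- The main terms Zq κ(a) add up to 0 over a < A, because A is a multiple of Q and κ inherits a
    -- zero sum from the columns. Only the A row errors are left.
    strip-bound : ∣ strip ∣ ℕ.≤ A ℕ.* (A ℕ.* (Q ℕ.* Q) ℕ.+ A ℕ.* (Q ℕ.* Q))
    strip-bound = ∣∣≤-resp value (∣∑∣≤ A _ _ row)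
      where
      value : ∑.fold A (λ a → ∑.fold X (term a) + + Zq * κ a) ≡ strip
      value = trans (∑.fold-∙ A _ _) (trans (cong (λ t → strip + t)
        (trans (∑-*ˡ A (+ Zq) κ) (trans (cong (+ Zq *_) κ-total) (ℤ.*-zeroʳ (+ Zq))))) (ℤ.+-identityʳ strip))

    square : ℤ
    square = ∑.fold A (λ a → ∑.fold A (term a))

    κ-moment : ℤ
    κ-moment = ∑.fold Q (λ u → κ u * + u)

    -- For a, b < A the subtraction is exact, so the weight is Z - a b. The constant Z is killed by
    -- the zero row sums, and a b factors into first moments; over B periods each of these is B
    -- times the moment of one period, again by the zero sums.
    square-value : square ≡ - (+ B * (+ B * κ-moment))
    square-value = begin
      square                                         ≡⟨ ∑.fold-cong A inner ⟩
      ∑.fold A (λ a → - (+ B) * (κ a * + a))         ≡⟨ ∑-*ˡ A (- (+ B)) _ ⟩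
      - (+ B) * ∑.fold A (λ a → κ a * + a)           ≡⟨ cong (- (+ B) *_) κ-first-moment ⟩
      - (+ B) * (+ B * κ-moment)                     ≡⟨ sym (ℤ.neg-distribˡ-* (+ B) _) ⟩
      - (+ B * (+ B * κ-moment))                     ∎
      where
      open ≡-Reasoning
      inner : ∀ a → a ℕ.< A → ∑.fold A (term a) ≡ - (+ B) * (κ a * + a)
      inner a a<A = begin
        ∑.fold A (term a)                                                ≡⟨ ∑.fold-cong A (λ b b<A → trans (cong (k a b *_) (exact b b<A)) (lem (k a b) (+ Z) (+ a) (+ b))) ⟩
        ∑.fold A (λ b → k a b * + Z + - (+ a) * (k a b * + b))           ≡⟨ ∑.fold-∙ A _ _ ⟩
        ∑.fold A (λ b → k a b * + Z) + ∑.fold A (λ b → - (+ a) * (k a b * + b))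
                                                                         ≡⟨ cong₂ _+_ (trans (∑-*ʳ A (k a) (+ Z)) (cong (_* + Z) (R.total a B)))
                                                                                      (trans (∑-*ˡ A (- (+ a)) _) (cong (- (+ a) *_) (R.first-moment a B))) ⟩
        0ℤ * + Z + - (+ a) * (+ B * κ a)                                 ≡⟨ lem₂ (+ Z) (+ a) (+ B) (κ a) ⟩
        - (+ B) * (κ a * + a)                                            ∎
        where
        lem : ∀ k Z a b → k * (Z - a * b) ≡ k * Z + - a * (k * b)
        lem = solve-∀
        lem₂ : ∀ Z a B κ → 0ℤ * Z + - a * (B * κ) ≡ - B * (κ * a)
        lem₂ = solve-∀
        A²≡Z : A ℕ.* A ≡ Z
        A²≡Z = lem₃ B Q
          where lem₃ : ∀ B Q → (B ℕ.* Q) ℕ.* (B ℕ.* Q) ≡ B ℕ.* (B ℕ.* Q) ℕ.* Q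
                lem₃ = ℕ.solve-∀
        exact : ∀ b → b ℕ.< A → + (Z ∸ a ℕ.* b) ≡ + Z - + a * + b
        exact b b<A = trans (pos-∸ (subst (a ℕ.* b ℕ.≤_) A²≡Z (ℕ.*-mono-≤ (ℕ.<⇒≤ a<A) (ℕ.<⇒≤ b<A))))
          (cong (λ t → + Z - t) (ℤ.pos-* a b))
      κ-first-moment : ∑.fold A (λ a → κ a * + a) ≡ + B * κ-moment
      κ-first-moment = trans (∑.fold-blocks B Q _) (trans (∑.fold-cong B (λ i _ → block i)) (∑-const B κ-moment))
        where
        block : ∀ i → ∑.fold Q (λ u → κ (i ℕ.* Q ℕ.+ u) * + (i ℕ.* Q ℕ.+ u)) ≡ κ-moment
        block i = trans (∑.fold-cong Q (λ u _ → trans (cong₂ _*_ (κ-periodic i u) (ℤ.pos-+ (i ℕ.* Q) u)) (ℤ.*-distribˡ-+ (κ u) _ _)))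
          (trans (∑.fold-∙ Q _ _) (trans (cong (_+ κ-moment) (trans (∑-*ʳ Q κ _) (cong (_* + (i ℕ.* Q)) κ-sum))) (ℤ.+-identityˡ κ-moment)))

    square-bound : ∣ square ∣ ℕ.≤ B ℕ.* (B ℕ.* (Q ℕ.* (Q ℕ.* Q ℕ.* Q)))
    square-bound = ∣∣≤-resp (sym square-value) (subst (ℕ._≤ B ℕ.* (B ℕ.* (Q ℕ.* (Q ℕ.* Q ℕ.* Q)))) (sym (ℤ.∣-i∣≡∣i∣ (+ B * (+ B * κ-moment))))
      (∣*∣≤ (+ B) (+ B * κ-moment) ℕ.≤-refl (∣*∣≤ (+ B) κ-moment ℕ.≤-refl
        (∣∑∣≤ Q _ _ (λ u u<Q → ∣*∣≤ (κ u) (+ u) (R.∣moment∣≤ u) (ℕ.<⇒≤ u<Q))))))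

-- Comparing the class of c with the class of 1.

module Analytic where

  open BigOp
  open Folding using (∣-resp; pos-∣)
  open Arith using (coprime-inverse)
  open DivisorSum
  open Kernel
  open import Data.Nat.Base using (_∸_)
  open import Data.Nat.Coprimality using (Coprime; coprime?)
  open import Data.Nat.DivMod using (_/_; _%_; m≡m%n+[m/n]*n; m%n<n; m<n⇒m%n≡m; [m+kn]%n≡m%n; m%n%n≡m%n; %-congˡ)
  open import Data.Integer.Base using (∣_∣; +≤+)
  open import Data.Integer.Divisibility.Signed
  open import Relation.Binary.Definitions using (tri<; tri≈; tri>)
  open import Relation.Nullary.Decidable using (decidable-stable)
  open import Relation.Nullary using (¬?; _×-dec_)

  ∑-mono-≤ : ∀ n {f g} → (∀ i → i ℕ.< n → f i ℤ.≤ g i) → ∑.fold n f ℤ.≤ ∑.fold n g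
  ∑-mono-≤ zero    f≤g = ℤ.≤-refl
  ∑-mono-≤ (suc n) f≤g = ℤ.+-mono-≤ (∑-mono-≤ n (λ i i<n → f≤g i (ℕ.m<n⇒m<1+n i<n))) (f≤g n (ℕ.n<1+n n))

  module _ (Q : ℕ) .{{_ : NonZero Q}} where

    %-cong⇒∣ : ∀ {x y} → x % Q ≡ y % Q → + Q ∣ + x - + y
    %-cong⇒∣ {x} {y} eq = divides (+ (x / Q) - + (y / Q)) (begin
      + x - + y                                                       ≡⟨ cong₂ _-_ (split x) (split y) ⟩
      (+ (x % Q) + + (x / Q) * + Q) - (+ (y % Q) + + (y / Q) * + Q)   ≡⟨ cong (λ t → (+ t + + (x / Q) * + Q) - (+ (y % Q) + + (y / Q) * + Q)) eq ⟩
      (+ (y % Q) + + (x / Q) * + Q) - (+ (y % Q) + + (y / Q) * + Q)   ≡⟨ lem (+ (y % Q)) (+ (x / Q)) (+ (y / Q)) (+ Q) ⟩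
      (+ (x / Q) - + (y / Q)) * + Q                                   ∎)
      where
      open ≡-Reasoning
      split : ∀ x → + x ≡ + (x % Q) + + (x / Q) * + Q
      split x = trans (cong +_ (m≡m%n+[m/n]*n x Q)) (trans (ℤ.pos-+ (x % Q) _) (cong (λ t → + (x % Q) + t) (ℤ.pos-* (x / Q) Q)))
      lem : ∀ r x y q → (r + x * q) - (r + y * q) ≡ (x - y) * q
      lem = solve-∀

    ∣⇒%-cong : ∀ {x y} → + Q ∣ + x - + y → x % Q ≡ y % Q
    ∣⇒%-cong {x} {y} d with ℕ.≤-total y x
    ... | inj₁ y≤x = go y≤x d
      where
      go : ∀ {x y} → y ℕ.≤ x → + Q ∣ + x - + y → x % Q ≡ y % Q
      go {x} {y} y≤x d with ∣⇒∣ᵤ (∣-resp (sym (pos-∸ y≤x)) d)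
      ... | ℕ.divides k eq = trans (%-congˡ {o = Q} (trans (sym (ℕ.m+[n∸m]≡n y≤x)) (cong (y ℕ.+_) eq))) ([m+kn]%n≡m%n y k Q)
    ... | inj₂ x≤y with ∣⇒∣ᵤ (∣-resp (trans (lem (+ x) (+ y)) (sym (pos-∸ x≤y))) (∣m⇒∣-m d))
      where lem : ∀ x y → - (x - y) ≡ y - x
            lem = solve-∀
    ...   | ℕ.divides k eq = sym (trans (%-congˡ {o = Q} (trans (sym (ℕ.m+[n∸m]≡n x≤y)) (cong (x ℕ.+_) eq))) ([m+kn]%n≡m%n x k Q))

    solve-linear : ∀ {a} → Coprime a Q → ∀ c → ∃[ v ] v ℕ.< Q × (a ℕ.* v) % Q ≡ c % Q ×
                   (∀ u → u ℕ.< Q → (a ℕ.* u) % Q ≡ c % Q → u ≡ v)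
    solve-linear {a} cop c with coprime-inverse cop
    ... | b , ba≡1 = v , m%n<n (b ℕ.* c) Q , ∣⇒%-cong solves , unique
      where
      v = (b ℕ.* c) % Q
      v≡bc : + Q ∣ + v - + b * + c
      v≡bc = subst (λ t → + Q ∣ + v - t) (ℤ.pos-* b c) (%-cong⇒∣ (m%n%n≡m%n (b ℕ.* c) Q))
      solves : + Q ∣ + (a ℕ.* v) - + c
      solves = ∣-resp (trans (lem (+ a) (+ v) (+ b) (+ c)) (cong (_- + c) (sym (ℤ.pos-* a v))))
        (∣m∣n⇒∣m+n (∣n⇒∣m*n (+ a) v≡bc) (∣n⇒∣m*n (+ c) ba≡1))
        where lem : ∀ a v b c → a * (v - b * c) + c * (b * a - 1ℤ) ≡ a * v - c
              lem = solve-∀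
      unique : ∀ u → u ℕ.< Q → (a ℕ.* u) % Q ≡ c % Q → u ≡ v
      unique u u<Q eq = trans (sym (m<n⇒m%n≡m u<Q)) (trans (∣⇒%-cong u≡v) (m<n⇒m%n≡m (m%n<n (b ℕ.* c) Q)))
        where
        au≡c : + Q ∣ + a * + u - + c
        au≡c = ∣-resp (cong (_- + c) (ℤ.pos-* a u)) (%-cong⇒∣ eq)
        u≡v : + Q ∣ + u - + v
        u≡v = ∣-resp (lem (+ a) (+ u) (+ v) (+ b) (+ c))
          (∣m∣n⇒∣m-n (∣m∣n⇒∣m-n (∣n⇒∣m*n (+ b) au≡c) (∣n⇒∣m*n (+ u) ba≡1)) v≡bc)
          where lem : ∀ a u v b c → (b * (a * u - c) - u * (b * a - 1ℤ)) - (v - b * c) ≡ u - v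
                lem = solve-∀

  module Class (Q : ℕ) .{{_ : NonZero Q}} (1<Q : 1 ℕ.< Q) (χ : ℕ → ℤ)
    (χ-* : ∀ a b → χ (a ℕ.* b) ≡ χ a * χ b)
    (χ-periodic : ∀ i u → χ (i ℕ.* Q ℕ.+ u) ≡ χ u)
    (χ-noncoprime : ∀ a → ¬ Coprime a Q → χ a ≡ 0ℤ)
    (χ-coprime : ∀ a → Coprime a Q → χ a * χ a ≡ 1ℤ)
    (χ-value : ∀ a → χ a ≡ 0ℤ ⊎ χ a ≡ 1ℤ ⊎ χ a ≡ - 1ℤ)
    (χ-1 : χ 1 ≡ 1ℤ)
    (c : ℕ) (c⊥Q : Coprime c Q) (χ-c : χ c ≡ 1ℤ) where

    open Sum χ χ-*
    open Values χ-1 χ-value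

    class : ℕ → ℕ → ℤ
    class d x = ∑.when (x % Q ℕ.≟ d % Q) 1ℤ

    class-periodic : ∀ d x y → x % Q ≡ y % Q → class d x ≡ class d y
    class-periodic d x y eq = cong (λ t → ∑.when (t ℕ.≟ d % Q) 1ℤ) eq

    indicator : ℕ → ℤ
    indicator x = class c x - class 1 x

    indicator-periodic : ∀ x y → x % Q ≡ y % Q → indicator x ≡ indicator y
    indicator-periodic x y eq = cong₂ _-_ (class-periodic c x y eq) (class-periodic 1 x y eq)

    ∣indicator∣≤1 : ∀ x → ∣ indicator x ∣ ℕ.≤ 1
    ∣indicator∣≤1 x with x % Q ℕ.≟ c % Q | x % Q ℕ.≟ 1 % Q
    ... | yes _ | yes _ = z≤n
    ... | yes _ | no _  = s≤s z≤n
    ... | no _  | yes _ = s≤s z≤n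
    ... | no _  | no _  = z≤n

    ∣χ∣≤1 : ∀ a → ∣ χ a ∣ ℕ.≤ 1
    ∣χ∣≤1 a with χ a | χ-value a
    ... | _ | inj₁ refl        = z≤n
    ... | _ | inj₂ (inj₁ refl) = s≤s z≤n
    ... | _ | inj₂ (inj₂ refl) = s≤s z≤n

    -- Summed over a b = m, for m > 0, it yields r(m) times the difference of the two class
    -- indicators.
    K : ℕ → ℕ → ℤ
    K a b = χ a * indicator (a ℕ.* b)

    K-periodicʳ : ∀ a i v → K a (i ℕ.* Q ℕ.+ v) ≡ K a v
    K-periodicʳ a i v = cong (χ a *_) (indicator-periodic _ _
      (trans (%-congˡ {o = Q} (lem a i Q v)) ([m+kn]%n≡m%n (a ℕ.* v) (a ℕ.* i) Q)))
      where lem : ∀ a i Q v → a ℕ.* (i ℕ.* Q ℕ.+ v) ≡ a ℕ.* v ℕ.+ (a ℕ.* i) ℕ.* Q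
            lem = ℕ.solve-∀

    K-periodicˡ : ∀ b i u → K (i ℕ.* Q ℕ.+ u) b ≡ K u b
    K-periodicˡ b i u = cong₂ _*_ (χ-periodic i u) (indicator-periodic _ _
      (trans (%-congˡ {o = Q} (lem b i Q u)) ([m+kn]%n≡m%n (u ℕ.* b) (b ℕ.* i) Q)))
      where lem : ∀ b i Q u → (i ℕ.* Q ℕ.+ u) ℕ.* b ≡ u ℕ.* b ℕ.+ (b ℕ.* i) ℕ.* Q
            lem = ℕ.solve-∀

    K-bound : ∀ a b → ∣ K a b ∣ ℕ.≤ 1
    K-bound a b = ∣*∣≤ (χ a) _ (∣χ∣≤1 a) (∣indicator∣≤1 (a ℕ.* b))

    0%Q≢ : ∀ {d} → Coprime d Q → 0 % Q ≢ d % Q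
    0%Q≢ {d} cop eq = ℕ.<⇒≢ 1<Q (sym (cop (∣⇒∣ᵤ (∣-resp (lem (+ d)) (∣m⇒∣-m (%-cong⇒∣ Q {0} {d} eq))) , ℕ.∣-refl)))
      where lem : ∀ d → - (0ℤ - d) ≡ d
            lem = solve-∀

    1⊥Q : Coprime 1 Q
    1⊥Q (d∣1 , _) = ℕ.∣1⇒≡1 d∣1

    indicator-0 : indicator 0 ≡ 0ℤ
    indicator-0 = cong₂ _-_ (∑.when-false (0 % Q ℕ.≟ c % Q) (λ eq → contradiction eq (0%Q≢ c⊥Q)))
                            (∑.when-false (0 % Q ℕ.≟ 1 % Q) (λ eq → contradiction eq (0%Q≢ 1⊥Q)))

    K-0ʳ : ∀ a → K a 0 ≡ 0ℤ
    K-0ʳ a = trans (cong (λ t → χ a * indicator t) (ℕ.*-zeroʳ a)) (trans (cong (χ a *_) indicator-0) (ℤ.*-zeroʳ (χ a)))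

    K-0ˡ : ∀ b → K 0 b ≡ 0ℤ
    K-0ˡ b = trans (cong (χ 0 *_) indicator-0) (ℤ.*-zeroʳ (χ 0))

    ∑-class : ∀ {a} → Coprime a Q → ∀ d (g : ℕ → ℤ) x → (∀ v → (a ℕ.* v) % Q ≡ d % Q → g v ≡ x) →
              ∑.fold Q (λ v → g v * class d (a ℕ.* v)) ≡ x
    ∑-class {a} cop d g x constant = conclude (solve-linear Q cop d)
      where
      conclude : (∃[ v ] v ℕ.< Q × (a ℕ.* v) % Q ≡ d % Q × (∀ u → u ℕ.< Q → (a ℕ.* u) % Q ≡ d % Q → u ≡ v)) →
                 ∑.fold Q (λ v → g v * class d (a ℕ.* v)) ≡ x
      conclude (v , v<Q , solves , unique) = trans
        (∑.fold-single Q v v<Q (λ u u<Q u≢v → trans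
          (cong (g u *_) (∑.when-false ((a ℕ.* u) % Q ℕ.≟ d % Q) (λ eq → contradiction (unique u u<Q eq) u≢v))) (ℤ.*-zeroʳ (g u))))
        (trans (cong (g v *_) (∑.when-true ((a ℕ.* v) % Q ℕ.≟ d % Q) solves)) (trans (ℤ.*-identityʳ (g v)) (constant v solves)))

    ∑-indicator : ∀ {a} → Coprime a Q → ∀ (g : ℕ → ℤ) x →
                  (∀ v → (a ℕ.* v) % Q ≡ c % Q → g v ≡ x) → (∀ v → (a ℕ.* v) % Q ≡ 1 % Q → g v ≡ x) →
                  ∑.fold Q (λ v → g v * indicator (a ℕ.* v)) ≡ 0ℤ
    ∑-indicator {a} cop g x const-c const-1 = begin
      ∑.fold Q (λ v → g v * indicator (a ℕ.* v))                                     ≡⟨ ∑.fold-cong Q (λ v _ → lem (g v) (class c (a ℕ.* v)) (class 1 (a ℕ.* v))) ⟩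
      ∑.fold Q (λ v → g v * class c (a ℕ.* v) + - 1ℤ * (g v * class 1 (a ℕ.* v)))    ≡⟨ ∑.fold-∙ Q _ _ ⟩
      ∑.fold Q (λ v → g v * class c (a ℕ.* v)) + ∑.fold Q (λ v → - 1ℤ * (g v * class 1 (a ℕ.* v)))
                                                                                     ≡⟨ cong₂ _+_ (∑-class cop c g x const-c) (trans (∑-*ˡ Q (- 1ℤ) _) (cong (- 1ℤ *_) (∑-class cop 1 g x const-1))) ⟩
      x + - 1ℤ * x                                                                   ≡⟨ lem₂ x ⟩
      0ℤ                                                                             ∎
      where
      open ≡-Reasoning
      lem : ∀ g s t → g * (s - t) ≡ g * s + - 1ℤ * (g * t)
      lem = solve-∀
      lem₂ : ∀ x → x + - 1ℤ * x ≡ 0ℤ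
      lem₂ = solve-∀

    -- For a prime to Q each of a v ≡ c and a v ≡ 1 has one solution v modulo Q, and both are
    -- weighted by the same χ(a).
    K-rows : ∀ a → ∑.fold Q (K a) ≡ 0ℤ
    K-rows a = by-cases (coprime? a Q)
      where
      by-cases : Dec (Coprime a Q) → ∑.fold Q (K a) ≡ 0ℤ
      by-cases (yes cop) = ∑-indicator cop (λ _ → χ a) (χ a) (λ _ _ → refl) (λ _ _ → refl)
      by-cases (no ¬cop) = ∑.fold-ε Q (λ v _ → cong (_* indicator (a ℕ.* v)) (χ-noncoprime a ¬cop))

    χ-% : ∀ x → χ x ≡ χ (x % Q)
    χ-% x = trans (cong χ (trans (m≡m%n+[m/n]*n x Q) (ℕ.+-comm (x % Q) _))) (χ-periodic (x / Q) (x % Q))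

    χ-quotient : ∀ b u d → χ d ≡ 1ℤ → Coprime b Q → (b ℕ.* u) % Q ≡ d % Q → χ u ≡ χ b
    χ-quotient b u d χd≡1 cop eq = begin
      χ u                ≡⟨ sym (ℤ.*-identityˡ (χ u)) ⟩
      1ℤ * χ u           ≡⟨ cong (_* χ u) (sym (χ-coprime b cop)) ⟩
      χ b * χ b * χ u    ≡⟨ ℤ.*-assoc (χ b) (χ b) (χ u) ⟩
      χ b * (χ b * χ u)  ≡⟨ cong (χ b *_) (sym (χ-* b u)) ⟩
      χ b * χ (b ℕ.* u)  ≡⟨ cong (χ b *_) (trans (χ-% (b ℕ.* u)) (trans (cong χ eq) (trans (sym (χ-% d)) χd≡1))) ⟩
      χ b * 1ℤ           ≡⟨ ℤ.*-identityʳ (χ b) ⟩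
      χ b                ∎
      where open ≡-Reasoning

    class-noncoprime : ∀ {b} d u → Coprime d Q → ¬ Coprime b Q → class d (u ℕ.* b) ≡ 0ℤ
    class-noncoprime {b} d u d⊥Q ¬cop = ∑.when-false ((u ℕ.* b) % Q ℕ.≟ d % Q) λ eq → contradiction (λ {e} → divisor eq {e}) ¬cop
      where
      divisor : (u ℕ.* b) % Q ≡ d % Q → Coprime b Q
      divisor eq {e} (e∣b , e∣Q) = d⊥Q (∣⇒∣ᵤ (∣-resp (lem (+ (u ℕ.* b)) (+ d))
        (∣m∣n⇒∣m-n (pos-∣ (ℕ.∣n⇒∣m*n u e∣b)) (∣-trans (pos-∣ e∣Q) (%-cong⇒∣ Q eq)))) , e∣Q)
        where lem : ∀ x d → x - (x - d) ≡ d
              lem = solve-∀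

    -- For b prime to Q the solutions a of a b ≡ c and of a b ≡ 1 both have χ(a) = χ(b). For the
    -- first one this is where χ(c) = 1 enters.
    K-columns : ∀ b → ∑.fold Q (λ a → K a b) ≡ 0ℤ
    K-columns b = by-cases (coprime? b Q)
      where
      by-cases : Dec (Coprime b Q) → ∑.fold Q (λ a → K a b) ≡ 0ℤ
      by-cases (yes cop) = trans (∑.fold-cong Q (λ a _ → cong (λ t → χ a * indicator t) (ℕ.*-comm a b)))
        (∑-indicator cop χ (χ b) (λ u → χ-quotient b u c χ-c cop) (λ u → χ-quotient b u 1 χ-1 cop))
      by-cases (no ¬cop) = ∑.fold-ε Q (λ a _ → trans
        (cong (χ a *_) (cong₂ _-_ (class-noncoprime c a c⊥Q ¬cop) (class-noncoprime 1 a 1⊥Q ¬cop))) (ℤ.*-zeroʳ (χ a)))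

    module Comparison (H : ℕ) (0<H : 0 ℕ.< H) where

      -- Doubled so that A = 2HQ: the numbers 1 + iQ with i < H are at most A / 2, their squares at
      -- most E = Z / 4, and the weights of these squares at least 3E.
      B : ℕ
      B = H ℕ.+ H

      module L = TwoSided Q K K-periodicʳ K-periodicˡ K-rows K-columns K-0ˡ K-bound B
      module T = TwoSided Q (λ b a → K a b) K-periodicˡ K-periodicʳ K-columns K-rows K-0ʳ (λ b a → K-bound a b) B

      open L using (A; Zq; Z; X)

      F : ℕ → ℕ → ℤ
      F a b = K a b * + (Z ∸ a ℕ.* b)

      S : ℤ
      S = ∑.fold X (λ a → ∑.fold X (F a))

      A²≡Z : A ℕ.* A ≡ Z
      A²≡Z = lem B Q
        where lem : ∀ B Q → (B ℕ.* Q) ℕ.* (B ℕ.* Q) ≡ B ℕ.* (B ℕ.* Q) ℕ.* Q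
              lem = ℕ.solve-∀

      F-large : ∀ a b → Z ℕ.≤ a ℕ.* b → F a b ≡ 0ℤ
      F-large a b le = trans (cong (λ t → K a b * + t) (ℕ.m≤n⇒m∸n≡0 le)) (ℤ.*-zeroʳ (K a b))

      0<B : 0 ℕ.< B
      0<B = ℕ.<-≤-trans 0<H (ℕ.m≤m+n H H)

      A≤X : A ℕ.≤ X
      A≤X = ℕ.*-monoˡ-≤ Q (ℕ.m≤n⇒m≤1+n (ℕ.m≤m*n B A {{ℕ.m*n≢0 B Q {{ℕ.>-nonZero 0<B}}}}))

      -- Hyperbola method: a pair with a, b ≥ A has weight 0.
      hyperbola : S + L.square ≡ L.strip + T.strip
      hyperbola = begin
        S + L.square                                    ≡⟨ cong (λ t → ∑.fold t (λ a → ∑.fold X (F a)) + L.square) (sym X≡) ⟩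
        ∑.fold (A ℕ.+ D) (λ a → ∑.fold X (F a)) + L.square
                                                        ≡⟨ cong (_+ L.square) (∑.fold-+ A D _) ⟩
        L.strip + ∑.fold D (λ i → ∑.fold X (F (A ℕ.+ i))) + L.square
                                                        ≡⟨ cong (λ t → L.strip + t + L.square) (∑.fold-cong D (λ i _ → ∑.fold-extend (F (A ℕ.+ i)) A≤X (tail i))) ⟩
        L.strip + ∑.fold D (λ i → ∑.fold A (F (A ℕ.+ i))) + L.square
                                                        ≡⟨ lem L.strip _ L.square ⟩
        L.strip + (L.square + ∑.fold D (λ i → ∑.fold A (F (A ℕ.+ i))))
                                                        ≡⟨ cong (λ t → L.strip + t) (sym (∑.fold-+ A D _)) ⟩
        L.strip + ∑.fold (A ℕ.+ D) (λ a → ∑.fold A (F a))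
                                                        ≡⟨ cong (λ t → L.strip + ∑.fold t (λ a → ∑.fold A (F a))) X≡ ⟩
        L.strip + ∑.fold X (λ a → ∑.fold A (F a))       ≡⟨ cong (λ t → L.strip + t) (∑.fold-swap X A F) ⟩
        L.strip + ∑.fold A (λ b → ∑.fold X (λ a → F a b))
                                                        ≡⟨ cong (λ t → L.strip + t) (∑.fold-cong A (λ b _ → ∑.fold-cong X (λ a _ → cong (λ t → K a b * + (Z ∸ t)) (ℕ.*-comm a b)))) ⟩
        L.strip + T.strip                               ∎
        where
        open ≡-Reasoning
        D = X ∸ A
        X≡ : A ℕ.+ D ≡ X
        X≡ = ℕ.m+[n∸m]≡n A≤X
        tail : ∀ i b → A ℕ.≤ b → F (A ℕ.+ i) b ≡ 0ℤ
        tail i b A≤b = F-large (A ℕ.+ i) b (subst (ℕ._≤ (A ℕ.+ i) ℕ.* b) A²≡Z (ℕ.*-mono-≤ (ℕ.m≤m+n A i) A≤b))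
        lem : ∀ x y z → x + y + z ≡ x + (z + y)
        lem = solve-∀

      E : ℕ
      E = (H ℕ.* Q) ℕ.* (H ℕ.* Q)

      -- Each of the two strips is bounded by 2 A² Q² = 8 Q² E, and the square by B² Q⁴ = 4 Q² E.
      ∣S∣≤ : ∣ S ∣ ℕ.≤ 20 ℕ.* (Q ℕ.* Q) ℕ.* E
      ∣S∣≤ = ∣∣≤-resp (sym value) (ℕ.≤-trans (ℤ.∣i+j∣≤∣i∣+∣j∣ (L.strip + T.strip) (- L.square))
          (ℕ.≤-trans (ℕ.+-mono-≤ (ℕ.≤-trans (ℤ.∣i+j∣≤∣i∣+∣j∣ L.strip T.strip) (ℕ.+-mono-≤ L.strip-bound T.strip-bound))
                                 (subst (ℕ._≤ B ℕ.* (B ℕ.* (Q ℕ.* (Q ℕ.* Q ℕ.* Q)))) (sym (ℤ.∣-i∣≡∣i∣ L.square)) L.square-bound))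
            (ℕ.≤-reflexive (lem₂ H Q))))
        where
        lem : ∀ s q → s ≡ s + q - q
        lem = solve-∀
        value : S ≡ L.strip + T.strip - L.square
        value = trans (lem S L.square) (cong (_- L.square) hyperbola)
        lem₂ : ∀ H Q → let B = H ℕ.+ H ; A = B ℕ.* Q in
               A ℕ.* (A ℕ.* (Q ℕ.* Q) ℕ.+ A ℕ.* (Q ℕ.* Q)) ℕ.+ A ℕ.* (A ℕ.* (Q ℕ.* Q) ℕ.+ A ℕ.* (Q ℕ.* Q)) ℕ.+
               B ℕ.* (B ℕ.* (Q ℕ.* (Q ℕ.* Q ℕ.* Q))) ≡ 20 ℕ.* (Q ℕ.* Q) ℕ.* ((H ℕ.* Q) ℕ.* (H ℕ.* Q))
        lem₂ = ℕ.solve-∀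

      w : ℕ → ℤ
      w m = + (Z ∸ m)

      g : ℕ → ℤ
      g m = indicator m * w m

      Z≤X : Z ℕ.≤ X
      Z≤X = ℕ.m≤n+m Z Q

      divisor-expand : ∀ m a → 0 ℕ.< m → m ℕ.< Z →
                       ∑.when (a ℕ.∣? m) (χ a) * g m ≡ ∑.fold X (λ b → ∑.when (a ℕ.* b ℕ.≟ m) (χ a * g m))
      divisor-expand m a 0<m m<Z = by-cases (a ℕ.∣? m)
        where
        by-cases : (d? : Dec (a ℕ.∣ m)) → ∑.when d? (χ a) * g m ≡ ∑.fold X (λ b → ∑.when (a ℕ.* b ℕ.≟ m) (χ a * g m))
        by-cases (no a∤m) = sym (∑.fold-ε X (λ b _ → ∑.when-false (a ℕ.* b ℕ.≟ m)
          (λ eq → contradiction (ℕ.divides b (trans (sym eq) (ℕ.*-comm a b))) a∤m)))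
        by-cases (yes (ℕ.divides q m≡qa)) = sym (trans
          (∑.fold-single X q q<X (λ b _ b≢q → ∑.when-false (a ℕ.* b ℕ.≟ m)
            (λ eq → contradiction (ℕ.*-cancelˡ-≡ b q a {{a≢0}} (trans eq m≡aq)) b≢q)))
          (∑.when-true (a ℕ.* q ℕ.≟ m) (sym m≡aq)))
          where
          m≡aq : m ≡ a ℕ.* q
          m≡aq = trans m≡qa (ℕ.*-comm q a)
          a≢0 : NonZero a
          a≢0 = ℕ.≢-nonZero (λ a≡0 → ℕ.<⇒≢ 0<m (sym (trans m≡aq (cong (ℕ._* q) a≡0))))
          q<X : q ℕ.< X
          q<X = ℕ.≤-<-trans (ℕ.∣⇒≤ {{ℕ.>-nonZero 0<m}} (ℕ.divides a m≡aq)) (ℕ.<-≤-trans m<Z Z≤X)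

      -- At m = 0, where every d is a divisor, both sides vanish: neither c nor 1 is 0 modulo Q, so
      -- g(0) = 0.
      r-expand : ∀ m → m ℕ.< Z → r m * g m ≡ ∑.fold X (λ a → ∑.fold X (λ b → ∑.when (a ℕ.* b ℕ.≟ m) (χ a * g m)))
      r-expand zero m<Z = trans (cong (r 0 *_) g0≡0) (trans (ℤ.*-zeroʳ (r 0)) (sym (∑.fold-ε X (λ a _ → ∑.fold-ε X (λ b _ →
          ∑.when-false (a ℕ.* b ℕ.≟ 0) (λ _ → trans (cong (χ a *_) g0≡0) (ℤ.*-zeroʳ (χ a))))))))
        where
        g0≡0 : g 0 ≡ 0ℤ
        g0≡0 = cong (_* w 0) indicator-0
      r-expand m@(suc _) m<Z = trans (cong (_* g m) (sym (r-extend {m} {X} (s≤s z≤n) (ℕ.<-≤-trans m<Z Z≤X))))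
        (trans (sym (∑-*ʳ X (divisorTerm m) (g m))) (∑.fold-cong X (λ a _ → divisor-expand m a (s≤s z≤n) m<Z)))

      collapse : ∀ a b → ∑.fold Z (λ m → ∑.when (a ℕ.* b ℕ.≟ m) (χ a * g m)) ≡ F a b
      collapse a b = by-cases (a ℕ.* b ℕ.<? Z)
        where
        by-cases : Dec (a ℕ.* b ℕ.< Z) → ∑.fold Z (λ m → ∑.when (a ℕ.* b ℕ.≟ m) (χ a * g m)) ≡ F a b
        by-cases (yes lt) = trans (∑.fold-single Z (a ℕ.* b) lt (λ m _ m≢ → ∑.when-false (a ℕ.* b ℕ.≟ m) (λ eq → contradiction (sym eq) m≢)))
          (trans (∑.when-true (a ℕ.* b ℕ.≟ a ℕ.* b) refl) (sym (ℤ.*-assoc (χ a) (indicator (a ℕ.* b)) (w (a ℕ.* b)))))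
        by-cases (no ≮) = trans (∑.fold-ε Z (λ m m<Z → ∑.when-false (a ℕ.* b ℕ.≟ m) (λ eq → contradiction (subst (ℕ._< Z) (sym eq) m<Z) ≮)))
          (sym (F-large a b (ℕ.≮⇒≥ ≮)))

      S≡∑r : S ≡ ∑.fold Z (λ m → r m * g m)
      S≡∑r = sym (begin
        ∑.fold Z (λ m → r m * g m)                                                        ≡⟨ ∑.fold-cong Z r-expand ⟩
        ∑.fold Z (λ m → ∑.fold X (λ a → ∑.fold X (λ b → ∑.when (a ℕ.* b ℕ.≟ m) (χ a * g m)))) ≡⟨ ∑.fold-swap Z X _ ⟩
        ∑.fold X (λ a → ∑.fold Z (λ m → ∑.fold X (λ b → ∑.when (a ℕ.* b ℕ.≟ m) (χ a * g m)))) ≡⟨ ∑.fold-cong X (λ a _ → trans (∑.fold-swap Z X _) (∑.fold-cong X (λ b _ → collapse a b))) ⟩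
        S                                                                                 ∎)
        where open ≡-Reasoning

      -- Roots congruent to 1 modulo Q, so that their squares lie in the class of 1.
      root : ℕ → ℕ
      root i = suc (i ℕ.* Q)

      low : ℕ → ℤ
      low m = ∑.fold H (λ i → ∑.when (root i ℕ.* root i ℕ.≟ m) (w m))

      root-injective : ∀ i j → root i ℕ.* root i ≡ root j ℕ.* root j → i ≡ j
      root-injective i j eq = ℕ.*-cancelʳ-≡ i j Q (ℕ.suc-injective (square-injective (root i) (root j) eq))
        where
        square-injective : ∀ x y → x ℕ.* x ≡ y ℕ.* y → x ≡ y
        square-injective x y eq with ℕ.<-cmp x y
        ... | tri< x<y _ _ = contradiction eq (ℕ.<⇒≢ (ℕ.*-mono-< x<y x<y))
        ... | tri≈ _ x≡y _ = x≡y
        ... | tri> _ _ y<x = contradiction (sym eq) (ℕ.<⇒≢ (ℕ.*-mono-< y<x y<x))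

      root-bound : ∀ i → i ℕ.< H → root i ℕ.* root i ℕ.≤ E
      root-bound i i<H = ℕ.*-mono-≤ le le
        where
        le : root i ℕ.≤ H ℕ.* Q
        le = ℕ.≤-trans (ℕ.+-monoˡ-≤ (i ℕ.* Q) (ℕ.>-nonZero⁻¹ Q)) (ℕ.*-monoˡ-≤ Q i<H)

      Z≡4E : Z ≡ E ℕ.+ 3 ℕ.* E
      Z≡4E = lem H Q
        where lem : ∀ H Q → (H ℕ.+ H) ℕ.* ((H ℕ.+ H) ℕ.* Q) ℕ.* Q ≡ (H ℕ.* Q) ℕ.* (H ℕ.* Q) ℕ.+ 3 ℕ.* ((H ℕ.* Q) ℕ.* (H ℕ.* Q))
              lem = ℕ.solve-∀

      w-root : ∀ i → i ℕ.< H → + (3 ℕ.* E) ℤ.≤ w (root i ℕ.* root i)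
      w-root i i<H = +≤+ (ℕ.m+n≤o⇒m≤o∸n (3 ℕ.* E) (ℕ.≤-trans (ℕ.+-monoʳ-≤ (3 ℕ.* E) (root-bound i i<H))
        (ℕ.≤-reflexive (trans (ℕ.+-comm (3 ℕ.* E) E) (sym Z≡4E)))))

      0<E : 0 ℕ.< E
      0<E = ℕ.*-mono-< 0<HQ 0<HQ
        where 0<HQ = ℕ.*-mono-< 0<H (ℕ.>-nonZero⁻¹ Q)

      root<Z : ∀ i → i ℕ.< H → root i ℕ.* root i ℕ.< Z
      root<Z i i<H = subst (root i ℕ.* root i ℕ.<_) (sym Z≡4E) (ℕ.≤-<-trans (root-bound i i<H) (ℕ.m<m+n E (ℕ.*-mono-< {0} {3} (s≤s z≤n) 0<E)))

      ∑low : + (H ℕ.* (3 ℕ.* E)) ℤ.≤ ∑.fold Z low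
      ∑low = subst₂ ℤ._≤_ (trans (∑-const H (+ (3 ℕ.* E))) (sym (ℤ.pos-* H (3 ℕ.* E)))) (sym value) (∑-mono-≤ H w-root)
        where
        value : ∑.fold Z low ≡ ∑.fold H (λ i → w (root i ℕ.* root i))
        value = trans (∑.fold-swap Z H _) (∑.fold-cong H (λ i i<H → trans
          (∑.fold-single Z (root i ℕ.* root i) (root<Z i i<H) (λ m _ m≢ → ∑.when-false (root i ℕ.* root i ℕ.≟ m) (λ eq → contradiction (sym eq) m≢)))
          (∑.when-true (root i ℕ.* root i ℕ.≟ root i ℕ.* root i) refl)))

      module _ (vanishes : ∀ m → 0 ℕ.< m → m ℕ.< Z → m % Q ≡ c % Q → r m ≡ 0ℤ) where

        class-c-term : ∀ m → 0 ℕ.< m → m ℕ.< Z → class c m * r m ≡ 0ℤ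
        class-c-term m 0<m m<Z = by-cases (m % Q ℕ.≟ c % Q)
          where
          by-cases : (d? : Dec (m % Q ≡ c % Q)) → ∑.when d? 1ℤ * r m ≡ 0ℤ
          by-cases (yes eq) = cong (1ℤ *_) (vanishes m 0<m m<Z eq)
          by-cases (no _)   = refl

        -- Away from the chosen squares nonnegativity of r is enough; at a chosen square r is a
        -- positive integer, hence at least 1.
        low≤ : ∀ m → 0 ℕ.< m → low m ℤ.≤ class 1 m * (w m * r m)
        low≤ m 0<m = by-cases (ℕ.anyUpTo? (λ i → root i ℕ.* root i ℕ.≟ m) H)
          where
          w*r≥0 : 0ℤ ℤ.≤ w m * r m
          w*r≥0 = *-≥0 {w m} {r m} (+≤+ z≤n) (r-≥0 m 0<m)
          class≥0 : 0ℤ ℤ.≤ class 1 m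
          class≥0 = nonneg (m % Q ℕ.≟ 1 % Q)
            where
            nonneg : (d? : Dec (m % Q ≡ 1 % Q)) → 0ℤ ℤ.≤ ∑.when d? 1ℤ
            nonneg (yes _) = +≤+ z≤n
            nonneg (no _)  = +≤+ z≤n
          by-cases : Dec (∃[ i ] i ℕ.< H × root i ℕ.* root i ≡ m) → low m ℤ.≤ class 1 m * (w m * r m)
          by-cases (no none) = subst (ℤ._≤ class 1 m * (w m * r m))
            (sym (∑.fold-ε H (λ i i<H → ∑.when-false (root i ℕ.* root i ℕ.≟ m) (λ eq → contradiction (i , i<H , eq) none))))
            (*-≥0 class≥0 w*r≥0)
          by-cases (yes (i , i<H , eq)) = subst₂ ℤ._≤_ (trans (ℤ.*-identityʳ (w m)) (sym low≡w)) (sym class≡) w≤wr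
            where
            low≡w : low m ≡ w m
            low≡w = trans (∑.fold-single H i i<H (λ j _ j≢i → ∑.when-false (root j ℕ.* root j ℕ.≟ m)
                (λ eq′ → contradiction (root-injective j i (trans eq′ (sym eq))) j≢i)))
              (∑.when-true (root i ℕ.* root i ℕ.≟ m) eq)
            m≡1 : m % Q ≡ 1 % Q
            m≡1 = trans (%-congˡ {o = Q} (trans (sym eq) (lem i Q))) ([m+kn]%n≡m%n 1 (i ℕ.+ i ℕ.+ i ℕ.* i ℕ.* Q) Q)
              where lem : ∀ i Q → suc (i ℕ.* Q) ℕ.* suc (i ℕ.* Q) ≡ 1 ℕ.+ (i ℕ.+ i ℕ.+ i ℕ.* i ℕ.* Q) ℕ.* Q
                    lem = ℕ.solve-∀
            class≡ : class 1 m * (w m * r m) ≡ w m * r m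
            class≡ = trans (cong (_* (w m * r m)) (∑.when-true (m % Q ℕ.≟ 1 % Q) m≡1)) (ℤ.*-identityˡ _)
            w≤wr : w m * 1ℤ ℤ.≤ w m * r m
            w≤wr = ℤ.*-monoˡ-≤-nonNeg (w m) (ℤ.i<j⇒suc[i]≤j (subst (λ t → 0ℤ ℤ.< r t) eq (r-square>0 (root i) (s≤s z≤n))))

        term≤ : ∀ m → m ℕ.< Z → r m * g m ℤ.≤ - low m
        term≤ zero    m<Z = ℤ.≤-reflexive (trans (cong (r 0 *_) (cong (_* w 0) indicator-0)) (trans (ℤ.*-zeroʳ (r 0))
          (cong -_ (sym (∑.fold-ε H (λ i _ → ∑.when-false (root i ℕ.* root i ℕ.≟ 0) {w 0} (λ ())))))))
        term≤ m@(suc _) m<Z = subst (ℤ._≤ - low m) (sym value) (ℤ.neg-mono-≤ (low≤ m (s≤s z≤n)))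
          where
          lem : ∀ r s t w → r * ((s - t) * w) ≡ s * r * w - t * (w * r)
          lem = solve-∀
          lem₂ : ∀ w x → 0ℤ * w - x ≡ - x
          lem₂ = solve-∀
          value : r m * g m ≡ - (class 1 m * (w m * r m))
          value = trans (lem (r m) (class c m) (class 1 m) (w m))
            (trans (cong (λ t → t * w m - class 1 m * (w m * r m)) (class-c-term m (s≤s z≤n) m<Z)) (lem₂ (w m) (class 1 m * (w m * r m))))

        ∑-neg : ∀ n f → ∑.fold n (λ i → - f i) ≡ - ∑.fold n f
        ∑-neg zero    f = refl
        ∑-neg (suc n) f = trans (cong (_+ - f n) (∑-neg n f)) (sym (ℤ.neg-distrib-+ (∑.fold n f) (f n)))

        S≤ : S ℤ.≤ - + (H ℕ.* (3 ℕ.* E))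
        S≤ = ℤ.≤-trans (subst₂ ℤ._≤_ (sym S≡∑r) (∑-neg Z low) (∑-mono-≤ Z term≤)) (ℤ.neg-mono-≤ ∑low)

        contradictory-bounds : H ℕ.* (3 ℕ.* E) ℕ.≤ 20 ℕ.* (Q ℕ.* Q) ℕ.* E
        contradictory-bounds = ℕ.≤-trans (ℤ.drop‿+≤+ (ℤ.≤-trans
            (subst (ℤ._≤ - S) (ℤ.neg-involutive _) (ℤ.neg-mono-≤ S≤)) (i≤∣i∣ (- S))))
            (ℕ.≤-trans (ℕ.≤-reflexive (ℤ.∣-i∣≡∣i∣ S)) ∣S∣≤)
          where
          i≤∣i∣ : ∀ i → i ℤ.≤ + ∣ i ∣
          i≤∣i∣ (+ n)       = ℤ.≤-refl
          i≤∣i∣ ℤ.-[1+ n ] = ℤ.-≤+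

    class-represented : ∃[ m ] 0 ℕ.< m × m % Q ≡ c % Q × r m ≢ 0ℤ
    class-represented = by-cases (ℕ.anyUpTo? (λ m → (0 ℕ.<? m) ×-dec ((m % Q ℕ.≟ c % Q) ×-dec ¬? (r m ℤ.≟ 0ℤ))) Z)
      where
      -- Any H with 3H > 20 Q² contradicts 3 H E ≤ 20 Q² E.
      H = suc (7 ℕ.* (Q ℕ.* Q))
      open Comparison H (s≤s z≤n)
      open L using (Z)
      too-large : 20 ℕ.* (Q ℕ.* Q) ℕ.* E ℕ.< H ℕ.* (3 ℕ.* E)
      too-large = subst₂ ℕ._<_ refl (lem H E) (ℕ.*-monoˡ-< E {{ℕ.>-nonZero 0<E}} (subst (20 ℕ.* (Q ℕ.* Q) ℕ.<_) (sym (lem₂ (Q ℕ.* Q)))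
          (ℕ.m<m+n (20 ℕ.* (Q ℕ.* Q)) (s≤s z≤n))))
        where
        lem : ∀ H E → H ℕ.* 3 ℕ.* E ≡ H ℕ.* (3 ℕ.* E)
        lem = ℕ.solve-∀
        lem₂ : ∀ q → suc (7 ℕ.* q) ℕ.* 3 ≡ 20 ℕ.* q ℕ.+ suc (2 ℕ.+ q)
        lem₂ = ℕ.solve-∀
      by-cases : Dec (∃[ m ] m ℕ.< Z × 0 ℕ.< m × m % Q ≡ c % Q × r m ≢ 0ℤ) → ∃[ m ] 0 ℕ.< m × m % Q ≡ c % Q × r m ≢ 0ℤ
      by-cases (yes (m , _ , found)) = m , found
      by-cases (no none) = contradiction (contradictory-bounds vanishes) (ℕ.<⇒≱ too-large)
        where
        vanishes : ∀ m → 0 ℕ.< m → m ℕ.< Z → m % Q ≡ c % Q → r m ≡ 0ℤ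
        vanishes m 0<m m<Z eq = decidable-stable (r m ℤ.≟ 0ℤ) (λ r≢0 → none (m , m<Z , 0<m , eq , r≢0))

-- The symbol as a Dirichlet character modulo 4M.

module Existence where

  open BigOp
  open Folding using (∣-resp; pos-∣)
  open Arith
  open Character
  open Residue
  open DivisorSum
  open Analytic
  open import Data.Nat.Coprimality using (Coprime; coprime?; coprime-divisor)
  open import Data.Nat.DivMod using (_%_)
  open import Data.Nat.Primality using (Prime)
  open import Data.Integer.Divisibility.Signed

  coprime-* : ∀ {a b n} → Coprime a n → Coprime b n → Coprime (a ℕ.* b) n
  coprime-* {a} {b} a⊥n b⊥n {d} (d∣ab , d∣n) =
    b⊥n (coprime-divisor (λ (e∣d , e∣a) → a⊥n (e∣a , ℕ.∣-trans e∣d d∣n)) d∣ab , d∣n)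

  coprime-factorˡ : ∀ {a b n} → Coprime (a ℕ.* b) n → Coprime a n
  coprime-factorˡ {a} {b} ab⊥n (d∣a , d∣n) = ab⊥n (ℕ.∣m⇒∣m*n b d∣a , d∣n)

  coprime-factorʳ : ∀ {a b n} → Coprime (a ℕ.* b) n → Coprime b n
  coprime-factorʳ {a} {b} ab⊥n (d∣b , d∣n) = ab⊥n (ℕ.∣n⇒∣m*n a d∣b , d∣n)

  coprime-even⇒odd : ∀ {a n} → Coprime a (n ℕ.+ n) → ∃[ h ] a ≡ suc (h ℕ.+ h)
  coprime-even⇒odd {a} {n} cop with parity a
  ... | inj₂ odd = odd
  ... | inj₁ (w , refl) = contradiction (cop (double w , double n)) (λ ())
    where
    double : ∀ w → 2 ℕ.∣ w ℕ.+ w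
    double w = ℕ.divides w (lem w)
      where lem : ∀ w → w ℕ.+ w ≡ w ℕ.* 2
            lem = ℕ.solve-∀

  module Extended (l : ℕ) where

    M n Q : ℕ
    M = suc (suc (l ℕ.+ l))
    n = M ℕ.+ M
    Q = n ℕ.+ n

    open Symbol M using (symbol; symbol-periodic; symbol-*; symbol-²≡1; symbol-±1)

    χ : ℕ → ℤ
    χ a = ∑.when (coprime? a Q) (symbol a)

    χ-unit : ∀ {a} → Coprime a Q → χ a ≡ symbol a
    χ-unit {a} cop = ∑.when-true (coprime? a Q) cop

    χ-noncoprime : ∀ a → ¬ Coprime a Q → χ a ≡ 0ℤ
    χ-noncoprime a ¬cop = ∑.when-false (coprime? a Q) (λ cop → contradiction (λ {d} → cop {d}) ¬cop)

    ⊥Q⇒⊥n : ∀ {a} → Coprime a Q → Coprime a n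
    ⊥Q⇒⊥n cop (d∣a , d∣n) = cop (d∣a , ℕ.∣m∣n⇒∣m+n d∣n d∣n)

    symbol-*′ : ∀ {a b} → Coprime a Q → Coprime b Q → symbol (a ℕ.* b) ≡ symbol a * symbol b
    symbol-*′ {a} {b} a⊥Q b⊥Q = odd (coprime-even⇒odd {b} {n} b⊥Q)
      where
      odd : (∃[ h ] b ≡ suc (h ℕ.+ h)) → symbol (a ℕ.* b) ≡ symbol a * symbol b
      odd (h , eq) = trans (cong (λ t → symbol (a ℕ.* t)) eq)
        (trans (symbol-* h (⊥Q⇒⊥n a⊥Q) (subst (λ t → Coprime t n) eq (⊥Q⇒⊥n b⊥Q))) (cong (λ t → symbol a * symbol t) (sym eq)))

    χ-* : ∀ a b → χ (a ℕ.* b) ≡ χ a * χ b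
    χ-* a b = by-cases (coprime? a Q) (coprime? b Q)
      where
      by-cases : Dec (Coprime a Q) → Dec (Coprime b Q) → χ (a ℕ.* b) ≡ χ a * χ b
      by-cases (yes p) (yes q) = trans (χ-unit (coprime-* p q)) (trans (symbol-*′ p q) (sym (cong₂ _*_ (χ-unit p) (χ-unit q))))
      by-cases (no ¬p) _ = trans (χ-noncoprime (a ℕ.* b) (λ cop → ¬p (coprime-factorˡ {a} {b} cop)))
        (sym (cong (_* χ b) (χ-noncoprime a ¬p)))
      by-cases (yes _) (no ¬q) = trans (χ-noncoprime (a ℕ.* b) (λ cop → ¬q (coprime-factorʳ {a} {b} cop)))
        (sym (trans (cong (χ a *_) (χ-noncoprime b ¬q)) (ℤ.*-zeroʳ (χ a))))

    symbol-shift : ∀ i u → symbol (i ℕ.* Q ℕ.+ u) ≡ symbol u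
    symbol-shift zero    u = refl
    symbol-shift (suc i) u = trans (cong symbol (lem Q (i ℕ.* Q) u)) (trans (symbol-periodic (i ℕ.* Q ℕ.+ u)) (symbol-shift i u))
      where lem : ∀ q x u → q ℕ.+ x ℕ.+ u ≡ x ℕ.+ u ℕ.+ q
            lem = ℕ.solve-∀

    χ-periodic : ∀ i u → χ (i ℕ.* Q ℕ.+ u) ≡ χ u
    χ-periodic i u = by-cases (coprime? u Q)
      where
      down : Coprime (i ℕ.* Q ℕ.+ u) Q → Coprime u Q
      down cop (d∣u , d∣Q) = cop (ℕ.∣m∣n⇒∣m+n (ℕ.∣n⇒∣m*n i d∣Q) d∣u , d∣Q)
      up : Coprime u Q → Coprime (i ℕ.* Q ℕ.+ u) Q
      up cop (d∣ , d∣Q) = cop (ℕ.∣m+n∣m⇒∣n d∣ (ℕ.∣n⇒∣m*n i d∣Q) , d∣Q)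
      by-cases : Dec (Coprime u Q) → χ (i ℕ.* Q ℕ.+ u) ≡ χ u
      by-cases (yes cop) = trans (χ-unit (up cop)) (trans (symbol-shift i u) (sym (χ-unit cop)))
      by-cases (no ¬cop) = trans (χ-noncoprime (i ℕ.* Q ℕ.+ u) (λ cop → ¬cop (down cop))) (sym (χ-noncoprime u ¬cop))

    χ-coprime : ∀ a → Coprime a Q → χ a * χ a ≡ 1ℤ
    χ-coprime a cop = trans (cong₂ _*_ (χ-unit cop) (χ-unit cop)) (symbol-²≡1 a)

    χ-value : ∀ a → χ a ≡ 0ℤ ⊎ χ a ≡ 1ℤ ⊎ χ a ≡ - 1ℤ
    χ-value a = by-cases (coprime? a Q)
      where
      by-cases : Dec (Coprime a Q) → χ a ≡ 0ℤ ⊎ χ a ≡ 1ℤ ⊎ χ a ≡ - 1ℤ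
      by-cases (no ¬cop) = inj₁ (χ-noncoprime a ¬cop)
      by-cases (yes cop) = inj₂ (subst (λ t → t ≡ 1ℤ ⊎ t ≡ - 1ℤ) (sym (χ-unit cop)) (symbol-±1 a))

    1⊥ : Coprime 1 Q
    1⊥ (d∣1 , _) = ℕ.∣1⇒≡1 d∣1

    χ-1 : χ 1 ≡ 1ℤ
    χ-1 = trans (sym (ℤ.*-identityˡ (χ 1))) (trans (cong (_* χ 1) (sym (χ-coprime 1 1⊥)))
      (trans (cong (λ t → t * χ 1) (sym (χ-* 1 1))) (χ-coprime 1 1⊥)))

    residue : ∀ p → Prime p → χ p ≡ 1ℤ → ∃[ t ] p ℕ.∣ t ℕ.* t ℕ.+ M
    residue p pr χp≡1 = by-cases (coprime? p Q)
      where
      by-cases : Dec (Coprime p Q) → ∃[ t ] p ℕ.∣ t ℕ.* t ℕ.+ M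
      by-cases (no ¬cop) = contradiction (trans (sym χp≡1) (χ-noncoprime p ¬cop)) (λ ())
      by-cases (yes cop) = odd p pr (⊥Q⇒⊥n cop) (trans (sym (χ-unit cop)) χp≡1) (coprime-even⇒odd {p} {n} cop)
        where
        odd : ∀ p → Prime p → Coprime p n → symbol p ≡ 1ℤ → (∃[ h ] p ≡ suc (h ℕ.+ h)) → ∃[ t ] p ℕ.∣ t ℕ.* t ℕ.+ M
        odd _ pr cop eq (h , refl) = OddPrime.symbol≡1⇒residue h pr l cop eq

    open Sum χ χ-* using (module Values)
    open Values χ-1 χ-value using (module Represent)
    open Represent M Q residue (λ a cop χ≡0 → contradiction (trans (sym (χ-coprime a cop)) (cong (λ t → t * t) χ≡0)) (λ ()))

    -- The member of the class is m k² and not m itself. The condition N ∣ 1 + e m s² is made to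
    -- absorb this square, with s = k.
    class-contains-represented : ∀ c → Coprime c Q → symbol c ≡ 1ℤ →
      ∃[ m ] ∃[ k ] ∃[ t ] 0 ℕ.< m × Coprime m Q × (+ Q ∣ + (m ℕ.* (k ℕ.* k)) - + c) × (+ m ∣ t * t + + M)
    class-contains-represented c cop eq = unpack
        (Class.class-represented Q (s≤s (s≤s z≤n)) χ χ-* χ-periodic χ-noncoprime χ-coprime χ-value χ-1 c cop (trans (χ-unit cop) eq))
      where
      Goal : Set
      Goal = ∃[ m ] ∃[ k ] ∃[ t ] 0 ℕ.< m × Coprime m Q × (+ Q ∣ + (m ℕ.* (k ℕ.* k)) - + c) × (+ m ∣ t * t + + M)
      unpack : (∃[ x ] 0 ℕ.< x × x % Q ≡ c % Q × Sum.r χ χ-* x ≢ 0ℤ) → Goal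
      unpack (x , 0<x , x≡c , r≢0) = finish (r≢0⇒represented x 0<x x⊥Q r≢0)
        where
        Q∣ : + Q ∣ + x - + c
        Q∣ = %-cong⇒∣ Q {x} {c} x≡c
        x⊥Q : Coprime x Q
        x⊥Q {d} (d∣x , d∣Q) = cop (∣⇒∣ᵤ (∣-resp (lem (+ x) (+ c)) (∣m∣n⇒∣m-n (pos-∣ d∣x) (∣-trans (pos-∣ d∣Q) Q∣))) , d∣Q)
          where
          lem : ∀ x c → x - (x - c) ≡ c
          lem = solve-∀
        finish : Represented x → Goal
        finish (m , k , t , x≡ , d) = m , k , t , 0<m m (subst (0 ℕ.<_) x≡ 0<x) ,
            coprime-factorˡ {m} {k ℕ.* k} (subst (λ y → Coprime y Q) x≡ x⊥Q) , subst (λ y → + Q ∣ + y - + c) x≡ Q∣ , d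
          where
          0<m : ∀ m → 0 ℕ.< m ℕ.* (k ℕ.* k) → 0 ℕ.< m
          0<m (suc m) _ = s≤s z≤n

-- Reduction of positive ternary forms.

module Ternary where

  open import Data.Nat.Induction using (<-rec)
  open import Data.Integer.Base using (∣_∣)
  open import Data.Integer.DivMod using (_/ℕ_; _%ℕ_; a≡a%ℕn+[a/ℕn]*n; n%ℕd<d)

  -- The Gram matrix [[a,b,c],[b,d,e],[c,e,f]].
  record Form : Set where
    constructor form
    field a b c d e f : ℤ

  eval : Form → ℤ → ℤ → ℤ → ℤ
  eval (form a b c d e f) x y z =
    a * (x * x) + d * (y * y) + f * (z * z) + + 2 * (b * (x * y) + c * (x * z) + e * (y * z))

  det : Form → ℤ
  det (form a b c d e f) = a * d * f + + 2 * (b * c * e) - a * (e * e) - d * (c * c) - f * (b * b)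

  -- With l = ax + by + cz one has a F = l² + minor y² + 2 mixed yz + cominor z².
  minor mixed cominor : Form → ℤ
  minor   (form a b c d e f) = a * d - b * b
  mixed   (form a b c d e f) = a * e - b * c
  cominor (form a b c d e f) = a * f - c * c

  _∈ᵛ_ : ℤ → Form → Set
  n ∈ᵛ F = ∃[ x ] ∃[ y ] ∃[ z ] eval F x y z ≡ n

  infix 4 _∈ᵛ_ _≃_

  -- Equality of the sets of values, which is what the classification retains of an integral change
  -- of variables.
  record _≃_ (F G : Form) : Set where
    field
      to   : ∀ {n} → n ∈ᵛ F → n ∈ᵛ G
      from : ∀ {n} → n ∈ᵛ G → n ∈ᵛ F

  open _≃_ public

  ≃-trans : ∀ {F G H} → F ≃ G → G ≃ H → F ≃ H
  ≃-trans p q = record { to = λ v → to q (to p v) ; from = λ v → from p (from q v) }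

  shift₂₁ : ℤ → Form → Form
  shift₂₁ k (form a b c d e f) = form a (b + k * a) c (d + + 2 * (k * b) + k * k * a) (e + k * c) f

  swap₂₃ : Form → Form
  swap₂₃ (form a b c d e f) = form a c b f e d

  swap₁₂ : Form → Form
  swap₁₂ (form a b c d e f) = form d b e a c f

  shift₃₁ : ℤ → Form → Form
  shift₃₁ k F = swap₂₃ (shift₂₁ k (swap₂₃ F))

  shift₃₂ : ℤ → Form → Form
  shift₃₂ k F = swap₁₂ (shift₃₁ k (swap₁₂ F))

  shift₂₁-≃ : ∀ k F → F ≃ shift₂₁ k F
  shift₂₁-≃ k (form a b c d e f) = record
    { to   = λ (x , y , z , eq) → x - k * y , y , z , trans (lem₁ k a b c d e f x y z) eq
    ; from = λ (x , y , z , eq) → x + k * y , y , z , trans (lem₂ k a b c d e f x y z) eq }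
    where
    lem₁ : ∀ k a b c d e f x y z → a * ((x - k * y) * (x - k * y)) + (d + + 2 * (k * b) + k * k * a) * (y * y) + f * (z * z) + + 2 * ((b + k * a) * ((x - k * y) * y) + c * ((x - k * y) * z) + (e + k * c) * (y * z)) ≡
             a * (x * x) + d * (y * y) + f * (z * z) + + 2 * (b * (x * y) + c * (x * z) + e * (y * z))
    lem₁ = solve-∀
    lem₂ : ∀ k a b c d e f x y z → a * ((x + k * y) * (x + k * y)) + d * (y * y) + f * (z * z) + + 2 * (b * ((x + k * y) * y) + c * ((x + k * y) * z) + e * (y * z)) ≡
             a * (x * x) + (d + + 2 * (k * b) + k * k * a) * (y * y) + f * (z * z) + + 2 * ((b + k * a) * (x * y) + c * (x * z) + (e + k * c) * (y * z))
    lem₂ = solve-∀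

  swap₂₃-≃ : ∀ F → F ≃ swap₂₃ F
  swap₂₃-≃ (form a b c d e f) = record
    { to   = λ (x , y , z , eq) → x , z , y , trans (lem a b c d e f x y z) eq
    ; from = λ (x , y , z , eq) → x , z , y , trans (sym (lem a b c d e f x z y)) eq }
    where
    lem : ∀ a b c d e f x y z → a * (x * x) + f * (z * z) + d * (y * y) + + 2 * (c * (x * z) + b * (x * y) + e * (z * y)) ≡
             a * (x * x) + d * (y * y) + f * (z * z) + + 2 * (b * (x * y) + c * (x * z) + e * (y * z))
    lem = solve-∀

  swap₁₂-≃ : ∀ F → F ≃ swap₁₂ F
  swap₁₂-≃ (form a b c d e f) = record
    { to   = λ (x , y , z , eq) → y , x , z , trans (lem a b c d e f x y z) eq
    ; from = λ (x , y , z , eq) → y , x , z , trans (sym (lem a b c d e f y x z)) eq }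
    where
    lem : ∀ a b c d e f x y z → d * (y * y) + a * (x * x) + f * (z * z) + + 2 * (b * (y * x) + e * (y * z) + c * (x * z)) ≡
             a * (x * x) + d * (y * y) + f * (z * z) + + 2 * (b * (x * y) + c * (x * z) + e * (y * z))
    lem = solve-∀

  shift₃₁-≃ : ∀ k F → F ≃ shift₃₁ k F
  shift₃₁-≃ k F = ≃-trans (swap₂₃-≃ F) (≃-trans (shift₂₁-≃ k (swap₂₃ F)) (swap₂₃-≃ (shift₂₁ k (swap₂₃ F))))

  shift₃₂-≃ : ∀ k F → F ≃ shift₃₂ k F
  shift₃₂-≃ k F = ≃-trans (swap₁₂-≃ F) (≃-trans (shift₃₁-≃ k (swap₁₂ F)) (swap₁₂-≃ (shift₃₁ k (swap₁₂ F))))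

  shift₂₁-det : ∀ k F → det (shift₂₁ k F) ≡ det F
  shift₂₁-det k (form a b c d e f) = lem k a b c d e f
    where lem : ∀ k a b c d e f → a * (d + + 2 * (k * b) + k * k * a) * f + + 2 * ((b + k * a) * c * (e + k * c)) - a * ((e + k * c) * (e + k * c)) - (d + + 2 * (k * b) + k * k * a) * (c * c) - f * ((b + k * a) * (b + k * a)) ≡
             a * d * f + + 2 * (b * c * e) - a * (e * e) - d * (c * c) - f * (b * b)
          lem = solve-∀

  swap₂₃-det : ∀ F → det (swap₂₃ F) ≡ det F
  swap₂₃-det (form a b c d e f) = lem a b c d e f
    where lem : ∀ a b c d e f → a * f * d + + 2 * (c * b * e) - a * (e * e) - f * (b * b) - d * (c * c) ≡
             a * d * f + + 2 * (b * c * e) - a * (e * e) - d * (c * c) - f * (b * b)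
          lem = solve-∀

  swap₁₂-det : ∀ F → det (swap₁₂ F) ≡ det F
  swap₁₂-det (form a b c d e f) = lem a b c d e f
    where lem : ∀ a b c d e f → d * a * f + + 2 * (b * e * c) - d * (c * c) - a * (e * e) - f * (b * b) ≡
             a * d * f + + 2 * (b * c * e) - a * (e * e) - d * (c * c) - f * (b * b)
          lem = solve-∀

  shift₃₁-det : ∀ k F → det (shift₃₁ k F) ≡ det F
  shift₃₁-det k F = trans (swap₂₃-det (shift₂₁ k (swap₂₃ F))) (trans (shift₂₁-det k (swap₂₃ F)) (swap₂₃-det F))

  shift₃₂-det : ∀ k F → det (shift₃₂ k F) ≡ det F
  shift₃₂-det k F = trans (swap₁₂-det (shift₃₁ k (swap₁₂ F))) (trans (shift₃₁-det k (swap₁₂ F)) (swap₁₂-det F))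

  -- The Desnanot-Jacobi identity: the binary form complementary to the square of l has determinant
  -- a `det`, so positivity passes from `minor` to `cominor`.
  minor*cominor : ∀ F → minor F * cominor F ≡ mixed F * mixed F + Form.a F * det F
  minor*cominor (form a b c d e f) = lem a b c d e f
    where lem : ∀ a b c d e f → (a * d - b * b) * (a * f - c * c) ≡
                (a * e - b * c) * (a * e - b * c) + a * (a * d * f + + 2 * (b * c * e) - a * (e * e) - d * (c * c) - f * (b * b))
          lem = solve-∀

  nearest : ∀ n .{{_ : NonZero n}} (x : ℤ) → ∃[ k ] ∣ x + k * + n ∣ ℕ.+ ∣ x + k * + n ∣ ℕ.≤ n
  nearest n x = by-cases ((r ℕ.+ r) ℕ.≤? n)
    where
    r = x %ℕ n
    q = x /ℕ n
    x≡ : x ≡ + r + q * + n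
    x≡ = a≡a%ℕn+[a/ℕn]*n x n
    lem₁ : ∀ r q n → r + q * n + - q * n ≡ r
    lem₁ = solve-∀
    lem₂ : ∀ r q n → r + q * n + (- q - 1ℤ) * n ≡ - (n - r)
    lem₂ = solve-∀
    goal : ∀ {k i} → ∣ x + k * + n ∣ ≡ i → i ℕ.+ i ℕ.≤ n → ∃[ k ] ∣ x + k * + n ∣ ℕ.+ ∣ x + k * + n ∣ ℕ.≤ n
    goal {k} eq le = k , subst (λ t → t ℕ.+ t ℕ.≤ n) (sym eq) le
    by-cases : Dec (r ℕ.+ r ℕ.≤ n) → ∃[ k ] ∣ x + k * + n ∣ ℕ.+ ∣ x + k * + n ∣ ℕ.≤ n
    by-cases (yes 2r≤n) = goal { - q} (cong ∣_∣ (trans (cong (_+ - q * + n) x≡) (lem₁ (+ r) q (+ n)))) 2r≤n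
    by-cases (no 2r≰n) = goal { - q - 1ℤ} {s}
        (trans (cong ∣_∣ (trans (cong (_+ (- q - 1ℤ) * + n) x≡) (lem₂ (+ r) q (+ n))))
          (trans (ℤ.∣-i∣≡∣i∣ (+ n - + r)) (cong ∣_∣ (trans (ℤ.m-n≡m⊖n n r) (ℤ.⊖-≥ r≤n))))) 2s≤n
      where
      s = n ℕ.∸ r
      r≤n : r ℕ.≤ n
      r≤n = ℕ.<⇒≤ (n%ℕd<d x n)
      s≤r : s ℕ.≤ r
      s≤r = ℕ.m≤n+o⇒m∸n≤o n r (ℕ.<⇒≤ (ℕ.≰⇒> 2r≰n))
      2s≤n : s ℕ.+ s ℕ.≤ n
      2s≤n = ℕ.≤-trans (ℕ.+-monoʳ-≤ s s≤r) (ℕ.≤-reflexive (ℕ.m∸n+n≡m r≤n))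

  abs-square : ∀ x → x * x ≡ + (∣ x ∣ ℕ.* ∣ x ∣)
  abs-square (+ n)      = sym (ℤ.pos-* n n)
  abs-square ℤ.-[1+ n ] = refl

  positive-factor : ∀ {m n} x → + suc m * x ≡ + suc n → ∃[ k ] 0 ℕ.< k × x ≡ + k
  positive-factor {m} (+ zero)    eq = contradiction (trans (sym (ℤ.*-zeroʳ (+ suc m))) eq) (λ ())
  positive-factor (+ suc k)   eq = suc k , s≤s z≤n , refl
  positive-factor ℤ.-[1+ k ] ()

  positive-cofactor : ∀ {m n x} → 0 ℕ.< m → 0 ℕ.< n → + m * x ≡ + n → ∃[ k ] 0 ℕ.< k × x ≡ + k
  positive-cofactor {suc m} {suc n} {x} _ _ eq = positive-factor {m} {n} x eq

  -- Sylvester's criterion. The leading minors a and A are indices because they are what the two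
  -- reductions decrease.
  record Positive (D : ℕ) (F : Form) (a A : ℕ) : Set where
    field
      a≡     : Form.a F ≡ + a
      minor≡ : minor F ≡ + A
      det≡   : det F ≡ + D
      0<a    : 0 ℕ.< a
      0<A    : 0 ℕ.< A
      0<D    : 0 ℕ.< D

  -- Gauss-reducedness of A y² + 2 `mixed` y z + C z², the binary form left when the square of l is
  -- split off from a F.
  record BinaryReduced (F : Form) (a A : ℕ) : Set where
    field
      C         : ℕ
      cominor≡  : cominor F ≡ + C
      mixed≤    : ∣ mixed F ∣ ℕ.+ ∣ mixed F ∣ ℕ.≤ A
      A≤C       : A ℕ.≤ C

  module _ {D : ℕ} {F : Form} {a A : ℕ} (p : Positive D F a A) where

    open Positive p

    minor*cominor-positive : + A * cominor F ≡ + (∣ mixed F ∣ ℕ.* ∣ mixed F ∣ ℕ.+ a ℕ.* D)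
    minor*cominor-positive = begin
      + A * cominor F                                            ≡⟨ cong (_* cominor F) (sym minor≡) ⟩
      minor F * cominor F                                        ≡⟨ minor*cominor F ⟩
      mixed F * mixed F + Form.a F * det F                       ≡⟨ cong₂ _+_ (abs-square (mixed F)) (trans (cong₂ _*_ a≡ det≡) (sym (ℤ.pos-* a D))) ⟩
      + (∣ mixed F ∣ ℕ.* ∣ mixed F ∣) + + (a ℕ.* D)              ≡⟨ sym (ℤ.pos-+ (∣ mixed F ∣ ℕ.* ∣ mixed F ∣) (a ℕ.* D)) ⟩
      + (∣ mixed F ∣ ℕ.* ∣ mixed F ∣ ℕ.+ a ℕ.* D)                ∎
      where open ≡-Reasoning

    cominor-positive : ∃[ C ] 0 ℕ.< C × cominor F ≡ + C
    cominor-positive = positive-cofactor 0<A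
      (ℕ.<-≤-trans (ℕ.*-mono-< 0<a 0<D) (ℕ.m≤n+m (a ℕ.* D) (∣ mixed F ∣ ℕ.* ∣ mixed F ∣))) minor*cominor-positive

  module _ (F : Form) where

    mixed-shift₃₂ : ∀ k → mixed (shift₃₂ k F) ≡ mixed F + k * minor F
    mixed-shift₃₂ k = lem k (Form.a F) (Form.b F) (Form.c F) (Form.d F) (Form.e F)
      where lem : ∀ k a b c d e → a * (e + k * d) - b * (c + k * b) ≡ a * e - b * c + k * (a * d - b * b)
            lem = solve-∀

    minor-shift₂₁ : ∀ k → minor (shift₂₁ k F) ≡ minor F
    minor-shift₂₁ k = lem k (Form.a F) (Form.b F) (Form.d F)
      where lem : ∀ k a b d → a * (d + + 2 * (k * b) + k * k * a) - (b + k * a) * (b + k * a) ≡ a * d - b * b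
            lem = solve-∀

    mixed-shift₂₁ : ∀ k → mixed (shift₂₁ k F) ≡ mixed F
    mixed-shift₂₁ k = lem k (Form.a F) (Form.b F) (Form.c F) (Form.e F)
      where lem : ∀ k a b c e → a * (e + k * c) - (b + k * a) * c ≡ a * e - b * c
            lem = solve-∀

    mixed-shift₃₁ : ∀ k → mixed (shift₃₁ k F) ≡ mixed F
    mixed-shift₃₁ k = lem k (Form.a F) (Form.b F) (Form.c F) (Form.e F)
      where lem : ∀ k a b c e → a * (e + k * b) - b * (c + k * a) ≡ a * e - b * c
            lem = solve-∀

    cominor-shift₃₁ : ∀ k → cominor (shift₃₁ k F) ≡ cominor F
    cominor-shift₃₁ k = lem k (Form.a F) (Form.c F) (Form.f F)
      where lem : ∀ k a c f → a * (f + + 2 * (k * c) + k * k * a) - (c + k * a) * (c + k * a) ≡ a * f - c * c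
            lem = solve-∀

    minor-swap₁₂ : minor (swap₁₂ F) ≡ minor F
    minor-swap₁₂ = lem (Form.a F) (Form.b F) (Form.d F)
      where lem : ∀ a b d → d * a - b * b ≡ a * d - b * b
            lem = solve-∀

  BinaryResult : ℕ → Form → ℕ → Set
  BinaryResult D F a = ∃[ G ] ∃[ A ] F ≃ G × Positive D G a A × BinaryReduced G a A

  -- Gauss's reduction acts on y and z only and so keeps a: a shift makes `mixed` small, and as long
  -- as C < A a swap lowers A.
  binary-reduce : ∀ {D a} A F → Positive D F a A → BinaryResult D F a
  binary-reduce {D} {a} = <-rec _ step
    where
    step : ∀ A → (∀ {A′} → A′ ℕ.< A → ∀ F → Positive D F a A′ → BinaryResult D F a) →
           ∀ F → Positive D F a A → BinaryResult D F a
    step A rec F p = by-cases (cominor-positive q)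
      where
      open Positive p
      k-near = nearest A {{ℕ.>-nonZero 0<A}} (mixed F)
      k = proj₁ k-near
      G = shift₃₂ k F
      q : Positive D G a A
      q = record { a≡ = a≡ ; minor≡ = minor≡ ; det≡ = trans (shift₃₂-det k F) det≡ ; 0<a = 0<a ; 0<A = 0<A ; 0<D = 0<D }
      mixed-G : ∣ mixed G ∣ ℕ.+ ∣ mixed G ∣ ℕ.≤ A
      mixed-G = subst (λ t → ∣ t ∣ ℕ.+ ∣ t ∣ ℕ.≤ A)
        (sym (trans (mixed-shift₃₂ F k) (cong (λ t → mixed F + k * t) minor≡))) (proj₂ k-near)
      by-cases : (∃[ C ] 0 ℕ.< C × cominor G ≡ + C) → BinaryResult D F a
      by-cases (C , 0<C , C≡) = compare (A ℕ.≤? C)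
        where
        swapped : C ℕ.< A → BinaryResult D F a
        swapped C<A = prepend (rec C<A (swap₂₃ G) (record
            { a≡ = a≡ ; minor≡ = C≡ ; det≡ = trans (swap₂₃-det G) (Positive.det≡ q) ; 0<a = 0<a ; 0<A = 0<C ; 0<D = 0<D }))
          where
          prepend : BinaryResult D (swap₂₃ G) a → BinaryResult D F a
          prepend (H , A′ , ≃H , rest) = H , A′ , ≃-trans (shift₃₂-≃ k F) (≃-trans (swap₂₃-≃ G) ≃H) , rest
        compare : Dec (A ℕ.≤ C) → BinaryResult D F a
        compare (yes A≤C) = G , A , shift₃₂-≃ k F , q , record { C = C ; cominor≡ = C≡ ; mixed≤ = mixed-G ; A≤C = A≤C }
        compare (no A≰C)  = swapped (ℕ.≰⇒> A≰C)

  four-squares-bound : ∀ x y → x ℕ.+ x ℕ.≤ y → 4 ℕ.* (x ℕ.* x) ℕ.≤ y ℕ.* y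
  four-squares-bound x y le = subst (ℕ._≤ y ℕ.* y) (lem x) (ℕ.*-mono-≤ le le)
    where lem : ∀ x → (x ℕ.+ x) ℕ.* (x ℕ.+ x) ≡ 4 ℕ.* (x ℕ.* x)
          lem = ℕ.solve-∀

  -- The classical estimate A² ≤ A C = B² + δ ≤ A² / 4 + δ.
  reduced-bound : ∀ A B C δ → A ℕ.≤ C → B ℕ.+ B ℕ.≤ A → A ℕ.* C ≡ B ℕ.* B ℕ.+ δ → 3 ℕ.* (A ℕ.* A) ℕ.≤ 4 ℕ.* δ
  reduced-bound A B C δ A≤C 2B≤A eq = ℕ.+-cancelˡ-≤ (A ℕ.* A) _ _ (begin
    A ℕ.* A ℕ.+ 3 ℕ.* (A ℕ.* A)      ≡⟨⟩
    4 ℕ.* (A ℕ.* A)                  ≤⟨ ℕ.*-monoʳ-≤ 4 (ℕ.*-monoʳ-≤ A A≤C) ⟩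
    4 ℕ.* (A ℕ.* C)                  ≡⟨ cong (4 ℕ.*_) eq ⟩
    4 ℕ.* (B ℕ.* B ℕ.+ δ)            ≡⟨ ℕ.*-distribˡ-+ 4 (B ℕ.* B) δ ⟩
    4 ℕ.* (B ℕ.* B) ℕ.+ 4 ℕ.* δ      ≤⟨ ℕ.+-monoˡ-≤ (4 ℕ.* δ) (four-squares-bound B A 2B≤A) ⟩
    A ℕ.* A ℕ.+ 4 ℕ.* δ              ∎)
    where open ℕ.≤-Reasoning

  record Reduced (D : ℕ) (F : Form) (a A : ℕ) : Set where
    field
      positive : Positive D F a A
      binary   : BinaryReduced F a A
      b≤       : ∣ Form.b F ∣ ℕ.+ ∣ Form.b F ∣ ℕ.≤ a
      c≤       : ∣ Form.c F ∣ ℕ.+ ∣ Form.c F ∣ ℕ.≤ a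
      d        : ℕ
      d≡       : Form.d F ≡ + d
      a≤d      : a ℕ.≤ d

    open Positive positive public
    open BinaryReduced binary public

    ad≡ : a ℕ.* d ≡ ∣ Form.b F ∣ ℕ.* ∣ Form.b F ∣ ℕ.+ A
    ad≡ = ℤ.+-injective (begin
      + (a ℕ.* d)                                        ≡⟨ ℤ.pos-* a d ⟩
      + a * + d                                          ≡⟨ cong₂ _*_ (sym a≡) (sym d≡) ⟩
      Form.a F * Form.d F                                ≡⟨ lem (Form.a F * Form.d F) (Form.b F * Form.b F) ⟩
      Form.b F * Form.b F + minor F                      ≡⟨ cong₂ _+_ (abs-square (Form.b F)) minor≡ ⟩
      + (∣ Form.b F ∣ ℕ.* ∣ Form.b F ∣) + + A            ≡⟨ sym (ℤ.pos-+ (∣ Form.b F ∣ ℕ.* ∣ Form.b F ∣) A) ⟩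
      + (∣ Form.b F ∣ ℕ.* ∣ Form.b F ∣ ℕ.+ A)            ∎)
      where
      open ≡-Reasoning
      lem : ∀ x y → x ≡ y + (x - y)
      lem = solve-∀

    AC≡ : A ℕ.* C ≡ ∣ mixed F ∣ ℕ.* ∣ mixed F ∣ ℕ.+ a ℕ.* D
    AC≡ = ℤ.+-injective (trans (ℤ.pos-* A C) (trans (cong (+ A *_) (sym cominor≡)) (minor*cominor-positive positive)))

    3a²≤4A : 3 ℕ.* (a ℕ.* a) ℕ.≤ 4 ℕ.* A
    3a²≤4A = reduced-bound a ∣ Form.b F ∣ d A a≤d b≤ ad≡

    3A²≤4aD : 3 ℕ.* (A ℕ.* A) ℕ.≤ 4 ℕ.* (a ℕ.* D)
    3A²≤4aD = reduced-bound A ∣ mixed F ∣ C (a ℕ.* D) A≤C mixed≤ AC≡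

  Result : ℕ → Form → Set
  Result D F = ∃[ G ] ∃[ a ] ∃[ A ] F ≃ G × Reduced D G a A

  -- Shifting x by multiples of y and z makes b and c small and leaves `minor`, `mixed` and
  -- `cominor` alone. If then d < a, exchanging x and y lowers a, at the price of another binary
  -- reduction.
  reduce : ∀ {D} a F {A} → Positive D F a A → Result D F
  reduce {D} = <-rec _ step
    where
    step : ∀ a → (∀ {a′} → a′ ℕ.< a → ∀ F {A} → Positive D F a′ A → Result D F) →
           ∀ F {A} → Positive D F a A → Result D F
    step a rec F {A₀} p₀ = continue (binary-reduce A₀ F p₀)
      where
      continue : BinaryResult D F a → Result D F
      continue (G , A , F≃G , p , br) = by-cases d-positive
        where
        open Positive p
        open BinaryReduced br
        instance
          a≢0 : NonZero a
          a≢0 = ℕ.>-nonZero 0<a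
        k-near = nearest a (Form.b G)
        k = proj₁ k-near
        l-near = nearest a (Form.c G)
        l = proj₁ l-near
        G₁ = shift₂₁ k G
        G₂ = shift₃₁ l G₁
        F≃G₂ : F ≃ G₂
        F≃G₂ = ≃-trans F≃G (≃-trans (shift₂₁-≃ k G) (shift₃₁-≃ l G₁))
        q : Positive D G₂ a A
        q = record { a≡ = a≡ ; minor≡ = trans (minor-shift₂₁ G k) minor≡
                   ; det≡ = trans (shift₃₁-det l G₁) (trans (shift₂₁-det k G) det≡)
                   ; 0<a = 0<a ; 0<A = 0<A ; 0<D = 0<D }
        mixed≡ : mixed G₂ ≡ mixed G
        mixed≡ = trans (mixed-shift₃₁ G₁ l) (mixed-shift₂₁ G k)
        br₂ : BinaryReduced G₂ a A
        br₂ = record { C = C ; cominor≡ = trans (cominor-shift₃₁ G₁ l) cominor≡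
                     ; mixed≤ = subst (λ t → ∣ t ∣ ℕ.+ ∣ t ∣ ℕ.≤ A) (sym mixed≡) mixed≤ ; A≤C = A≤C }
        b-small : ∣ Form.b G₂ ∣ ℕ.+ ∣ Form.b G₂ ∣ ℕ.≤ a
        b-small = subst (λ t → ∣ Form.b G + k * t ∣ ℕ.+ ∣ Form.b G + k * t ∣ ℕ.≤ a) (sym a≡) (proj₂ k-near)
        c-small : ∣ Form.c G₂ ∣ ℕ.+ ∣ Form.c G₂ ∣ ℕ.≤ a
        c-small = subst (λ t → ∣ Form.c G + l * t ∣ ℕ.+ ∣ Form.c G + l * t ∣ ℕ.≤ a) (sym a≡) (proj₂ l-near)
        d-positive : ∃[ d ] 0 ℕ.< d × Form.d G₂ ≡ + d
        d-positive = positive-cofactor 0<a (ℕ.<-≤-trans 0<A (ℕ.m≤n+m A (∣ Form.b G₂ ∣ ℕ.* ∣ Form.b G₂ ∣))) (begin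
          + a * Form.d G₂                                        ≡⟨ cong (_* Form.d G₂) (sym (Positive.a≡ q)) ⟩
          Form.a G₂ * Form.d G₂                                  ≡⟨ lem (Form.a G₂ * Form.d G₂) (Form.b G₂ * Form.b G₂) ⟩
          Form.b G₂ * Form.b G₂ + minor G₂                       ≡⟨ cong₂ _+_ (abs-square (Form.b G₂)) (Positive.minor≡ q) ⟩
          + (∣ Form.b G₂ ∣ ℕ.* ∣ Form.b G₂ ∣) + + A              ≡⟨ sym (ℤ.pos-+ (∣ Form.b G₂ ∣ ℕ.* ∣ Form.b G₂ ∣) A) ⟩
          + (∣ Form.b G₂ ∣ ℕ.* ∣ Form.b G₂ ∣ ℕ.+ A)              ∎)
          where
          open ≡-Reasoning
          lem : ∀ x y → x ≡ y + (x - y)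
          lem = solve-∀
        by-cases : (∃[ d ] 0 ℕ.< d × Form.d G₂ ≡ + d) → Result D F
        by-cases (d , 0<d , d≡) = compare (a ℕ.≤? d)
          where
          prepend : Result D (swap₁₂ G₂) → Result D F
          prepend (H , a′ , A′ , ≃H , rest) = H , a′ , A′ , ≃-trans F≃G₂ (≃-trans (swap₁₂-≃ G₂) ≃H) , rest
          compare : Dec (a ℕ.≤ d) → Result D F
          compare (yes a≤d) = G₂ , a , A , F≃G₂ ,
            record { positive = q ; binary = br₂ ; b≤ = b-small ; c≤ = c-small ; d = d ; d≡ = d≡ ; a≤d = a≤d }
          compare (no a≰d) = prepend (rec (ℕ.≰⇒> a≰d) (swap₁₂ G₂) (record
            { a≡ = d≡ ; minor≡ = trans (minor-swap₁₂ G₂) (Positive.minor≡ q) ; det≡ = trans (swap₁₂-det G₂) (Positive.det≡ q)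
            ; 0<a = 0<d ; 0<A = 0<A ; 0<D = 0<D }))

-- The reduced forms of determinant 1, 3 and 5.

module Classify where

  open Ternary
  open import Data.Integer.Base using (∣_∣)
  open import Relation.Nullary.Decidable using (from-yes; from-no)

  -- Hermite's bound on the minimum, obtained by eliminating A from 3a² ≤ 4A and 3A² ≤ 4aD.
  cube-bound : ∀ {D G a A} → Reduced D G a A → 27 ℕ.* (a ℕ.* (a ℕ.* a)) ℕ.≤ 64 ℕ.* D
  cube-bound {D} {G} {a} {A} red = ℕ.*-cancelˡ-≤ a {{ℕ.>-nonZero 0<a}} (begin
    a ℕ.* (27 ℕ.* (a ℕ.* (a ℕ.* a)))                       ≡⟨ lem₁ a ⟩
    3 ℕ.* ((3 ℕ.* (a ℕ.* a)) ℕ.* (3 ℕ.* (a ℕ.* a)))        ≤⟨ ℕ.*-monoʳ-≤ 3 (ℕ.*-mono-≤ 3a²≤4A 3a²≤4A) ⟩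
    3 ℕ.* ((4 ℕ.* A) ℕ.* (4 ℕ.* A))                        ≡⟨ lem₂ A ⟩
    16 ℕ.* (3 ℕ.* (A ℕ.* A))                               ≤⟨ ℕ.*-monoʳ-≤ 16 3A²≤4aD ⟩
    16 ℕ.* (4 ℕ.* (a ℕ.* D))                               ≡⟨ lem₃ a D ⟩
    a ℕ.* (64 ℕ.* D)                                       ∎)
    where
    open Reduced red
    open ℕ.≤-Reasoning
    lem₁ : ∀ a → a ℕ.* (27 ℕ.* (a ℕ.* (a ℕ.* a))) ≡ 3 ℕ.* ((3 ℕ.* (a ℕ.* a)) ℕ.* (3 ℕ.* (a ℕ.* a)))
    lem₁ = ℕ.solve-∀
    lem₂ : ∀ A → 3 ℕ.* ((4 ℕ.* A) ℕ.* (4 ℕ.* A)) ≡ 16 ℕ.* (3 ℕ.* (A ℕ.* A))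
    lem₂ = ℕ.solve-∀
    lem₃ : ∀ a D → 16 ℕ.* (4 ℕ.* (a ℕ.* D)) ≡ a ℕ.* (64 ℕ.* D)
    lem₃ = ℕ.solve-∀

  square≤⇒≤ : ∀ k A {N} → 3 ℕ.* (A ℕ.* A) ℕ.≤ N → N ℕ.< 3 ℕ.* (suc k ℕ.* suc k) → A ℕ.≤ k
  square≤⇒≤ k A le lt = ℕ.≮⇒≥ λ k<A → ℕ.<⇒≱ lt (ℕ.≤-trans (ℕ.*-monoʳ-≤ 3 (ℕ.*-mono-≤ k<A k<A)) le)

  cube≤⇒≤ : ∀ k a {N} → 27 ℕ.* (a ℕ.* (a ℕ.* a)) ℕ.≤ N → N ℕ.< 27 ℕ.* (suc k ℕ.* (suc k ℕ.* suc k)) → a ℕ.≤ k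
  cube≤⇒≤ k a le lt = ℕ.≮⇒≥ λ k<a → ℕ.<⇒≱ lt (ℕ.≤-trans (ℕ.*-monoʳ-≤ 27 (ℕ.*-mono-≤ k<a (ℕ.*-mono-≤ k<a k<a))) le)

  double≤1⇒≡0 : ∀ n → n ℕ.+ n ℕ.≤ 1 → n ≡ 0
  double≤1⇒≡0 zero    _ = refl
  double≤1⇒≡0 (suc n) (s≤s le) = contradiction (subst (ℕ._≤ 0) (ℕ.+-suc n n) le) λ ()

  -- For a = 1 the bounds on 2|b| and 2|c| force b = c = 0, so x² splits off and what remains is the
  -- complementary binary form itself.
  unit-form : ∀ {D G A} (red : Reduced D G 1 A) →
              G ≡ form 1ℤ 0ℤ 0ℤ (+ A) (mixed G) (+ Reduced.C red)
  unit-form {D} {form a b c d e f} {A} red = go a≡ b≡0 c≡0 minor≡ cominor≡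
    where
    open Reduced red hiding (d)
    b≡0 : b ≡ 0ℤ
    b≡0 = ℤ.∣i∣≡0⇒i≡0 (double≤1⇒≡0 ∣ b ∣ b≤)
    c≡0 : c ≡ 0ℤ
    c≡0 = ℤ.∣i∣≡0⇒i≡0 (double≤1⇒≡0 ∣ c ∣ c≤)
    lem : ∀ d → 1ℤ * d - 0ℤ * 0ℤ ≡ d
    lem = solve-∀
    go : ∀ {a b c d e f A C} → a ≡ 1ℤ → b ≡ 0ℤ → c ≡ 0ℤ → minor (form a b c d e f) ≡ + A → cominor (form a b c d e f) ≡ + C →
         form a b c d e f ≡ form 1ℤ 0ℤ 0ℤ (+ A) (mixed (form a b c d e f)) (+ C)
    go {d = d} {e} {f} refl refl refl minor≡ cominor≡ =
      trans (cong₂ (λ x y → form 1ℤ 0ℤ 0ℤ x e y) (trans (sym (lem d)) minor≡) (trans (sym (lem f)) cominor≡))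
        (cong (λ x → form 1ℤ 0ℤ 0ℤ _ x _) (sym (lem e)))

  ∣∣≡1⇒±1 : ∀ x → ∣ x ∣ ≡ 1 → x ≡ 1ℤ ⊎ x ≡ - 1ℤ
  ∣∣≡1⇒±1 (+ _)      refl = inj₁ refl
  ∣∣≡1⇒±1 ℤ.-[1+ 0 ] refl = inj₂ refl

  -- The reduced binary forms A y² ± 2β y z + C z² of determinant 1, 3 and 5; `hex` is the form of
  -- the hexagonal lattice.
  data Solution (A β C : ℕ) : ℕ → Set where
    one   : A ≡ 1 → β ≡ 0 → C ≡ 1 → Solution A β C 1
    three : A ≡ 1 → β ≡ 0 → C ≡ 3 → Solution A β C 3
    hex   : A ≡ 2 → β ≡ 1 → C ≡ 2 → Solution A β C 3
    five  : A ≡ 1 → β ≡ 0 → C ≡ 5 → Solution A β C 5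
    skew  : A ≡ 2 → β ≡ 1 → C ≡ 3 → Solution A β C 5

  unit-coefficient : ∀ {C n} → 1 ℕ.* C ≡ n → C ≡ n
  unit-coefficient {C} eq = trans (sym (ℕ.*-identityˡ C)) eq

  indivisible : ∀ {k C n} → ¬ k ℕ.∣ n → k ℕ.* C ≢ n
  indivisible {k} {C} k∤n eq = k∤n (ℕ.divides C (trans (sym eq) (ℕ.*-comm k C)))

  solve₁ : ∀ A β C → 0 ℕ.< A → A ℕ.≤ 1 → β ℕ.+ β ℕ.≤ A → A ℕ.* C ≡ β ℕ.* β ℕ.+ 1 → Solution A β C 1
  solve₁ 1 0 C _ _ _ eq = one refl refl (unit-coefficient eq)
  solve₁ 1 (suc β) C _ _ le eq = contradiction (double≤1⇒≡0 (suc β) le) λ ()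
  solve₁ (suc (suc A)) β C _ (s≤s ()) _ _

  double≤2⇒≤1 : ∀ n → n ℕ.+ n ℕ.≤ 2 → n ≡ 0 ⊎ n ≡ 1
  double≤2⇒≤1 zero          _ = inj₁ refl
  double≤2⇒≤1 (suc zero)    _ = inj₂ refl
  double≤2⇒≤1 (suc (suc n)) (s≤s (s≤s le)) = contradiction (ℕ.≤-trans (ℕ.m≤n+m (suc (suc n)) n) le) λ ()

  solve₃ : ∀ A β C → 0 ℕ.< A → A ℕ.≤ 2 → β ℕ.+ β ℕ.≤ A → A ℕ.* C ≡ β ℕ.* β ℕ.+ 3 → Solution A β C 3
  solve₃ 1 β C _ _ le eq with double≤1⇒≡0 β le
  ... | refl = three refl refl (unit-coefficient eq)
  solve₃ 2 β C _ _ le eq with double≤2⇒≤1 β le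
  ... | inj₁ refl = contradiction eq (indivisible {2} {C} (from-no (2 ℕ.∣? 3)))
  ... | inj₂ refl = hex refl refl (ℕ.*-cancelˡ-≡ C 2 2 eq)
  solve₃ (suc (suc (suc A))) β C _ (s≤s (s≤s ())) _ _

  solve₅ : ∀ A β C → 0 ℕ.< A → A ℕ.≤ 2 → β ℕ.+ β ℕ.≤ A → A ℕ.* C ≡ β ℕ.* β ℕ.+ 5 → Solution A β C 5
  solve₅ 1 β C _ _ le eq with double≤1⇒≡0 β le
  ... | refl = five refl refl (unit-coefficient eq)
  solve₅ 2 β C _ _ le eq with double≤2⇒≤1 β le
  ... | inj₁ refl = contradiction eq (indivisible {2} {C} (from-no (2 ℕ.∣? 5)))
  ... | inj₂ refl = skew refl refl (ℕ.*-cancelˡ-≡ C 3 2 eq)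
  solve₅ (suc (suc (suc A))) β C _ (s≤s (s≤s ())) _ _

  unit-AC≡ : ∀ {D G A} (red : Reduced D G 1 A) → A ℕ.* Reduced.C red ≡ ∣ mixed G ∣ ℕ.* ∣ mixed G ∣ ℕ.+ D
  unit-AC≡ {D} {G} red = trans (Reduced.AC≡ red) (cong (∣ mixed G ∣ ℕ.* ∣ mixed G ∣ ℕ.+_) (ℕ.*-identityˡ D))

  ≡1 : ∀ {a} → 0 ℕ.< a → a ℕ.≤ 1 → a ≡ 1
  ≡1 {suc zero}    _ _ = refl
  ≡1 {suc (suc _)} _ (s≤s ())

  no-mixed : ∀ {A C x} → ∣ x ∣ ≡ 0 → form 1ℤ 0ℤ 0ℤ A x C ≡ form 1ℤ 0ℤ 0ℤ A 0ℤ C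
  no-mixed {A} {C} eq = cong (λ t → form 1ℤ 0ℤ 0ℤ A t C) (ℤ.∣i∣≡0⇒i≡0 eq)

  classify₁ : ∀ {a A F} → Positive 1 F a A → ∀ {n} → n ∈ᵛ F → ∃[ x ] ∃[ y ] ∃[ z ] x * x + y * y + z * z ≡ n
  classify₁ {a} {A} {F} p {n} n∈F = go (reduce a F p)
    where
    go : Result 1 F → ∃[ x ] ∃[ y ] ∃[ z ] x * x + y * y + z * z ≡ n
    go (G , a′ , A′ , F≃G , red) = unit (≡1 (Reduced.0<a red) (cube≤⇒≤ 1 a′ (cube-bound red) (from-yes (64 ℕ.<? 216)))) red
      where
      unit : a′ ≡ 1 → Reduced 1 G a′ A′ → ∃[ x ] ∃[ y ] ∃[ z ] x * x + y * y + z * z ≡ n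
      unit refl red = finish (solve₁ A′ ∣ mixed G ∣ C 0<A (square≤⇒≤ 1 A′ 3A²≤4aD (from-yes (4 ℕ.<? 12))) mixed≤ (unit-AC≡ red))
        where
        open Reduced red
        lem : ∀ x y z → 1ℤ * (x * x) + 1ℤ * (y * y) + 1ℤ * (z * z) + + 2 * (0ℤ * (x * y) + 0ℤ * (x * z) + 0ℤ * (y * z)) ≡ x * x + y * y + z * z
        lem = solve-∀
        finish : Solution A′ ∣ mixed G ∣ C 1 → ∃[ x ] ∃[ y ] ∃[ z ] x * x + y * y + z * z ≡ n
        finish (one refl β≡0 C≡1) with subst (n ∈ᵛ_) (trans (unit-form red) (trans (no-mixed β≡0) (cong (λ t → form 1ℤ 0ℤ 0ℤ 1ℤ 0ℤ (+ t)) C≡1))) (to F≃G n∈F)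
        ... | x , y , z , eq = x , y , z , trans (sym (lem x y z)) eq

  -- The value 6 separates the two candidates: the hexagonal one takes it at (0, 1, ±1).
  classify₃ : ∀ {a A F} → Positive 3 F a A → ¬ + 6 ∈ᵛ F → ∀ {n} → n ∈ᵛ F → ∃[ x ] ∃[ y ] ∃[ z ] x * x + y * y + + 3 * (z * z) ≡ n
  classify₃ {a} {A} {F} p 6∉F {n} n∈F = go (reduce a F p)
    where
    go : Result 3 F → ∃[ x ] ∃[ y ] ∃[ z ] x * x + y * y + + 3 * (z * z) ≡ n
    go (G , a′ , A′ , F≃G , red) = unit (≡1 (Reduced.0<a red) (cube≤⇒≤ 1 a′ (cube-bound red) (from-yes (192 ℕ.<? 216)))) red
      where
      unit : a′ ≡ 1 → Reduced 3 G a′ A′ → ∃[ x ] ∃[ y ] ∃[ z ] x * x + y * y + + 3 * (z * z) ≡ n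
      unit refl red = finish (solve₃ A′ ∣ mixed G ∣ C 0<A (square≤⇒≤ 2 A′ 3A²≤4aD (from-yes (12 ℕ.<? 27))) mixed≤ (unit-AC≡ red))
        where
        open Reduced red
        lem : ∀ x y z → 1ℤ * (x * x) + 1ℤ * (y * y) + + 3 * (z * z) + + 2 * (0ℤ * (x * y) + 0ℤ * (x * z) + 0ℤ * (y * z)) ≡ x * x + y * y + + 3 * (z * z)
        lem = solve-∀
        six : ∀ B → B ≡ 1ℤ ⊎ B ≡ - 1ℤ → + 6 ∈ᵛ form 1ℤ 0ℤ 0ℤ (+ 2) B (+ 2)
        six _ (inj₁ refl) = 0ℤ , 1ℤ , 1ℤ , refl
        six _ (inj₂ refl) = 0ℤ , 1ℤ , - 1ℤ , refl
        finish : Solution A′ ∣ mixed G ∣ C 3 → ∃[ x ] ∃[ y ] ∃[ z ] x * x + y * y + + 3 * (z * z) ≡ n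
        finish (three refl β≡0 C≡3) with subst (n ∈ᵛ_) (trans (unit-form red) (trans (no-mixed β≡0) (cong (λ t → form 1ℤ 0ℤ 0ℤ 1ℤ 0ℤ (+ t)) C≡3))) (to F≃G n∈F)
        ... | x , y , z , eq = x , y , z , trans (sym (lem x y z)) eq
        finish (hex refl β≡1 C≡2) = contradiction (from F≃G (subst (+ 6 ∈ᵛ_)
          (sym (trans (unit-form red) (cong (λ t → form 1ℤ 0ℤ 0ℤ (+ 2) (mixed G) (+ t)) C≡2))) (six (mixed G) (∣∣≡1⇒±1 (mixed G) β≡1)))) 6∉F

  -- For a = 1 the competitor x² + y² + 5z² is excluded by its value 5. For a = 2 the bounds force A
  -- = 3, and 3C = β² + 10 has no solution with β ≤ 1.
  classify₅ : ∀ {a A F} → Positive 5 F a A → ¬ + 5 ∈ᵛ F → ∀ {n} → n ∈ᵛ F →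
              ∃[ x ] ∃[ y ] ∃[ z ] x * x + + 2 * (y * y) + + 2 * (y * z) + + 3 * (z * z) ≡ n
  classify₅ {a} {A} {F} p 5∉F {n} n∈F = go (reduce a F p)
    where
    Goal : Set
    Goal = ∃[ x ] ∃[ y ] ∃[ z ] x * x + + 2 * (y * y) + + 2 * (y * z) + + 3 * (z * z) ≡ n
    go : Result 5 F → Goal
    go (G , a′ , A′ , F≃G , red) = by-cases a′ (Reduced.0<a red) (cube≤⇒≤ 2 a′ (cube-bound red) (from-yes (320 ℕ.<? 729))) red
      where
      unit : Reduced 5 G 1 A′ → Goal
      unit red = finish (solve₅ A′ ∣ mixed G ∣ C 0<A (square≤⇒≤ 2 A′ 3A²≤4aD (from-yes (20 ℕ.<? 27))) mixed≤ (unit-AC≡ red))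
        where
        open Reduced red
        lem₊ : ∀ x y z → 1ℤ * (x * x) + + 2 * (y * y) + + 3 * (z * z) + + 2 * (0ℤ * (x * y) + 0ℤ * (x * z) + 1ℤ * (y * z)) ≡
                         x * x + + 2 * (y * y) + + 2 * (y * z) + + 3 * (z * z)
        lem₊ = solve-∀
        lem₋ : ∀ x y z → 1ℤ * (x * x) + + 2 * (y * y) + + 3 * (z * z) + + 2 * (0ℤ * (x * y) + 0ℤ * (x * z) + - 1ℤ * (y * z)) ≡
                         x * x + + 2 * (y * y) + + 2 * (y * - z) + + 3 * (- z * - z)
        lem₋ = solve-∀
        skewed : ∀ B → B ≡ 1ℤ ⊎ B ≡ - 1ℤ → n ∈ᵛ form 1ℤ 0ℤ 0ℤ (+ 2) B (+ 3) → Goal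
        skewed _ (inj₁ refl) (x , y , z , eq) = x , y , z , trans (sym (lem₊ x y z)) eq
        skewed _ (inj₂ refl) (x , y , z , eq) = x , y , - z , trans (sym (lem₋ x y z)) eq
        finish : Solution A′ ∣ mixed G ∣ C 5 → Goal
        finish (five refl β≡0 C≡5) = contradiction (from F≃G (subst (+ 5 ∈ᵛ_)
          (sym (trans (unit-form red) (trans (no-mixed β≡0) (cong (λ t → form 1ℤ 0ℤ 0ℤ 1ℤ 0ℤ (+ t)) C≡5)))) (0ℤ , 0ℤ , 1ℤ , refl))) 5∉F
        finish (skew refl β≡1 C≡3) = skewed (mixed G) (∣∣≡1⇒±1 (mixed G) β≡1)
          (subst (n ∈ᵛ_) (trans (unit-form red) (cong (λ t → form 1ℤ 0ℤ 0ℤ (+ 2) (mixed G) (+ t)) C≡3)) (to F≃G n∈F))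
      A≤3 : Reduced 5 G 2 A′ → A′ ℕ.≤ 3
      A≤3 red = square≤⇒≤ 3 A′ (Reduced.3A²≤4aD red) (from-yes (40 ℕ.<? 48))
      impossible : Reduced 5 G 2 A′ → ¬ A′ ℕ.≤ 3
      impossible red A≤3 = mixed-values β (subst (β ℕ.+ β ℕ.≤_) A≡3 mixed≤) (trans (cong (ℕ._* C) (sym A≡3)) AC≡)
        where
        open Reduced red
        β = ∣ mixed G ∣
        3≤A : 3 ℕ.≤ A′
        3≤A = ℕ.*-cancelˡ-≤ {3} {A′} 4 3a²≤4A
        mixed-values : ∀ β → β ℕ.+ β ℕ.≤ 3 → ¬ 3 ℕ.* C ≡ β ℕ.* β ℕ.+ 10
        mixed-values 0 _ = indivisible {3} {C} (from-no (3 ℕ.∣? 10))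
        mixed-values 1 _ = indivisible {3} {C} (from-no (3 ℕ.∣? 11))
        mixed-values (suc (suc β)) (s≤s (s≤s le)) _ = contradiction (ℕ.≤-trans (ℕ.m≤n+m (suc (suc β)) β) le) λ { (s≤s ()) }
        A≡3 : A′ ≡ 3
        A≡3 = ℕ.≤-antisym A≤3 3≤A
      by-cases : ∀ a′ → 0 ℕ.< a′ → a′ ℕ.≤ 2 → Reduced 5 G a′ A′ → Goal
      by-cases 1 _ _ red = unit red
      by-cases 2 _ _ red = contradiction (A≤3 red) (impossible red)
      by-cases (suc (suc (suc _))) _ (s≤s (s≤s ())) _

-- Proving congruences by running through residues.

module Congruence where

  open Folding using (∣-resp)
  open import Data.Bool.Base using (Bool; true; T; _∧_)
  open import Data.Bool.Properties using (T-∧)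
  open import Data.Fin.Base using (Fin; zero; suc)
  open import Data.Integer.DivMod using (_/ℕ_; _%ℕ_; a≡a%ℕn+[a/ℕn]*n; n%ℕd<d)
  open import Data.Integer.Divisibility.Signed
  open import Data.Vec.Base using (Vec; []; _∷_; lookup)
  open import Function.Bundles using (Equivalence)
  open import Relation.Nullary using (does)
  open import Relation.Nullary.Decidable using (_×-dec_; _⊎-dec_; _→-dec_)

  infixl 7 _⊗_
  infixl 6 _⊕_ _⊖_
  infix 5 _∣′_
  infixr 3 _∧′_
  infixr 2 _∨′_
  infixr 1 _⇒′_

  data Expr (n : ℕ) : Set where
    var         : Fin n → Expr n
    con         : ℤ → Expr n
    _⊕_ _⊖_ _⊗_ : Expr n → Expr n → Expr n

  -- Falsity has no constant of its own; `k ∣′ con (+ 1)` with k > 1 stands for it.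
  data Formula (n : ℕ) : Set where
    _∣′_            : ℕ → Expr n → Formula n
    _∧′_ _∨′_ _⇒′_  : Formula n → Formula n → Formula n

  x₀ : ∀ {n} → Expr (suc n)
  x₀ = var zero

  x₁ : ∀ {n} → Expr (suc (suc n))
  x₁ = var (suc zero)

  x₂ : ∀ {n} → Expr (suc (suc (suc n)))
  x₂ = var (suc (suc zero))

  value : ∀ {n} → Expr n → Vec ℤ n → ℤ
  value (var i) ρ = lookup ρ i
  value (con c) ρ = c
  value (s ⊕ t) ρ = value s ρ + value t ρ
  value (s ⊖ t) ρ = value s ρ - value t ρ
  value (s ⊗ t) ρ = value s ρ * value t ρ

  Holds : ∀ {n} → Formula n → Vec ℤ n → Set
  Holds (k ∣′ e) ρ = + k ∣ value e ρ
  Holds (φ ∧′ ψ) ρ = Holds φ ρ × Holds ψ ρ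
  Holds (φ ∨′ ψ) ρ = Holds φ ρ ⊎ Holds ψ ρ
  Holds (φ ⇒′ ψ) ρ = Holds φ ρ → Holds ψ ρ

  holds? : ∀ {n} (φ : Formula n) ρ → Dec (Holds φ ρ)
  holds? (k ∣′ e) ρ = + k ∣? value e ρ
  holds? (φ ∧′ ψ) ρ = holds? φ ρ ×-dec holds? ψ ρ
  holds? (φ ∨′ ψ) ρ = holds? φ ρ ⊎-dec holds? ψ ρ
  holds? (φ ⇒′ ψ) ρ = holds? φ ρ →-dec holds? ψ ρ

  module _ (K : ℕ) where

    moduliDivide : ∀ {n} → Formula n → Bool
    moduliDivide (k ∣′ _) = does (k ℕ.∣? K)
    moduliDivide (φ ∧′ ψ) = moduliDivide φ ∧ moduliDivide ψ
    moduliDivide (φ ∨′ ψ) = moduliDivide φ ∧ moduliDivide ψ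
    moduliDivide (φ ⇒′ ψ) = moduliDivide φ ∧ moduliDivide ψ

    Congruent : ∀ {n} → Vec ℤ n → Vec ℤ n → Set
    Congruent ρ σ = ∀ i → + K ∣ lookup ρ i - lookup σ i

    value-cong : ∀ {n} (e : Expr n) {ρ σ} → Congruent ρ σ → + K ∣ value e ρ - value e σ
    value-cong (var i) c = c i
    value-cong (con k) c = ∣-resp (sym (ℤ.+-inverseʳ k)) (divides 0ℤ refl)
    value-cong (s ⊕ t) {ρ} {σ} c = ∣-resp (lem (value s ρ) (value t ρ) (value s σ) (value t σ)) (∣m∣n⇒∣m+n (value-cong s c) (value-cong t c))
      where lem : ∀ a b c d → (a - c) + (b - d) ≡ (a + b) - (c + d)
            lem = solve-∀
    value-cong (s ⊖ t) {ρ} {σ} c = ∣-resp (lem (value s ρ) (value t ρ) (value s σ) (value t σ)) (∣m∣n⇒∣m-n (value-cong s c) (value-cong t c))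
      where lem : ∀ a b c d → (a - c) - (b - d) ≡ (a - b) - (c - d)
            lem = solve-∀
    value-cong (s ⊗ t) {ρ} {σ} c = ∣-resp (lem (value s ρ) (value t ρ) (value s σ) (value t σ))
        (∣m∣n⇒∣m+n (∣m⇒∣m*n (value t ρ) (value-cong s c)) (∣n⇒∣m*n (value s σ) (value-cong t c)))
      where lem : ∀ a b c d → (a - c) * b + c * (b - d) ≡ a * b - c * d
            lem = solve-∀

    Congruent-sym : ∀ {n} {ρ σ : Vec ℤ n} → Congruent ρ σ → Congruent σ ρ
    Congruent-sym {ρ = ρ} {σ} c i = ∣-resp (lem (lookup ρ i) (lookup σ i)) (∣m⇒∣-m (c i))
      where lem : ∀ a b → - (a - b) ≡ b - a
            lem = solve-∀

    Holds-cong : ∀ {n} (φ : Formula n) → T (moduliDivide φ) → ∀ {ρ σ} → Congruent ρ σ → Holds φ ρ → Holds φ σ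
    Holds-cong (k ∣′ e) wf {ρ} {σ} c h with k ℕ.∣? K
    ... | yes k∣K = ∣-resp (lem (value e ρ) (value e σ)) (∣m∣n⇒∣m-n h (∣-trans (∣ᵤ⇒∣ k∣K) (value-cong e c)))
      where lem : ∀ a b → a - (a - b) ≡ b
            lem = solve-∀
    Holds-cong (φ ∧′ ψ) wf c (h , h′) = let (wφ , wψ) = Equivalence.to T-∧ wf in Holds-cong φ wφ c h , Holds-cong ψ wψ c h′
    Holds-cong (φ ∨′ ψ) wf c (inj₁ h) = inj₁ (Holds-cong φ (proj₁ (Equivalence.to T-∧ wf)) c h)
    Holds-cong (φ ∨′ ψ) wf c (inj₂ h) = inj₂ (Holds-cong ψ (proj₂ (Equivalence.to (T-∧ {moduliDivide φ}) wf)) c h)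
    Holds-cong (φ ⇒′ ψ) wf {ρ} {σ} c h h′ = let (wφ , wψ) = Equivalence.to T-∧ wf in
      Holds-cong ψ wψ c (h (Holds-cong φ wφ (λ i → Congruent-sym {ρ = ρ} {σ} c i) h′))

    below : ℕ → (ℕ → Bool) → Bool
    below zero    p = true
    below (suc m) p = p m ∧ below m p

    below-sound : ∀ m p → T (below m p) → ∀ i → i ℕ.< m → T (p i)
    below-sound (suc m) p t i i<1+m with ℕ.m<1+n⇒m<n∨m≡n i<1+m
    ... | inj₁ i<m  = below-sound m p (proj₂ (Equivalence.to (T-∧ {p m}) t)) i i<m
    ... | inj₂ refl = proj₁ (Equivalence.to T-∧ t)

    allResidues : ∀ n → (Vec ℤ n → Bool) → Bool
    allResidues zero    p = p []
    allResidues (suc n) p = below K (λ i → allResidues n (λ ρ → p (+ i ∷ ρ)))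

    residues : ∀ {n} .{{_ : NonZero K}} → Vec ℤ n → Vec ℤ n
    residues []      = []
    residues (x ∷ ρ) = + (x %ℕ K) ∷ residues ρ

    allResidues-sound : ∀ n .{{_ : NonZero K}} p → T (allResidues n p) → ∀ ρ → T (p (residues ρ))
    allResidues-sound zero    p t []      = t
    allResidues-sound (suc n) p t (x ∷ ρ) = allResidues-sound n _
      (below-sound K (λ i → allResidues n (λ ρ → p (+ i ∷ ρ))) t (x %ℕ K) (n%ℕd<d x K)) ρ

    residues-congruent : ∀ {n} .{{_ : NonZero K}} (ρ : Vec ℤ n) → Congruent (residues ρ) ρ
    residues-congruent (x ∷ ρ) zero = divides (- (x /ℕ K)) (trans (cong (λ t → + (x %ℕ K) - t) (a≡a%ℕn+[a/ℕn]*n x K)) (lem (+ (x %ℕ K)) (x /ℕ K) (+ K)))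
      where lem : ∀ r q k → r - (r + q * k) ≡ - q * k
            lem = solve-∀
    residues-congruent (x ∷ ρ) (suc i) = residues-congruent ρ i

    does-sound : {P : Set} (p? : Dec P) → T (does p?) → P
    does-sound (yes p) _ = p

    -- When all moduli of a formula divide K, its truth depends only on the variables modulo K;
    -- evaluation at all tuples of residues then settles it for all integers.
    by-residues : ∀ {n} .{{_ : NonZero K}} (φ : Formula n) → T (moduliDivide φ ∧ allResidues n (λ ρ → does (holds? φ ρ))) →
                  ∀ ρ → Holds φ ρ
    by-residues {n} φ t ρ = let (wf , checked) = Equivalence.to (T-∧ {moduliDivide φ}) t in
      Holds-cong φ wf (residues-congruent ρ) (does-sound (holds? φ (residues ρ)) (allResidues-sound n (λ ρ → does (holds? φ ρ)) checked ρ))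

-- A form of determinant e D that represents e N.

module Represent where

  open Folding using (∣-resp)
  open Arith using (coprime-inverse)
  open Character using (module Symbol)
  open Existence
  open Ternary
  open import Data.Nat.Coprimality using (Coprime; coprime-divisor)
  open import Data.Integer.Divisibility.Signed

  -- N F = e (N x − m s y + t s z)² + (m y² − 2 t y z + α z²),
  -- and the binary form on the right has determinant D N.
  module Construction (N D e m : ℕ) (0<N : 0 ℕ.< N) (0<D : 0 ℕ.< D) (0<e : 0 ℕ.< e) (0<m : 0 ℕ.< m) (s t : ℤ)
    (m∣ : + m ∣ t * t + + D * + N) (N∣ : + N ∣ 1ℤ + + e * + m * (s * s)) where

    α g : ℤ
    α = _∣_.quotient m∣
    g = _∣_.quotient N∣

    Δ₁≡0 : + N * g - (1ℤ + + e * + m * (s * s)) ≡ 0ℤ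
    Δ₁≡0 = ℤ.i≡j⇒i-j≡0 (trans (ℤ.*-comm (+ N) g) (sym (_∣_.equality N∣)))

    Δ₂≡0 : + m * α - (t * t + + D * + N) ≡ 0ℤ
    Δ₂≡0 = ℤ.i≡j⇒i-j≡0 (trans (ℤ.*-comm (+ m) α) (sym (_∣_.equality m∣)))

    -- Dividing the right-hand side of the identity by N leaves integers: 1 + e m s² = g N is a
    -- factor of the y² and y z coefficients, and t² = m α - D N turns that of z² into α g - e D s².
    F : Form
    F = form (+ e * + N) (- (+ e * + m * s)) (+ e * t * s) (+ m * g) (- (t * g)) (α * g - + e * + D * (s * s))

    -- Identities that hold modulo the two divisibility relations become polynomial identities with
    -- explicit cofactors A and B, which are discarded here.
    vanish : ∀ {P} A B {x y} → x ≡ 0ℤ → y ≡ 0ℤ → P + (A * x + B * y) ≡ P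
    vanish {P} A B refl refl = lem P A B
      where lem : ∀ P A B → P + (A * 0ℤ + B * 0ℤ) ≡ P
            lem = solve-∀

    minor-F : minor F ≡ + e * + m
    minor-F = trans (lem (+ N) (+ e) (+ m) s g) (vanish (+ e * + m) 0ℤ Δ₁≡0 Δ₂≡0)
      where lem : ∀ N e m s g → e * N * (m * g) - - (e * m * s) * - (e * m * s) ≡
                  e * m + (e * m * (N * g - (1ℤ + e * m * (s * s))) + 0ℤ * 0ℤ)
            lem = solve-∀

    mixed-F : mixed F ≡ - (+ e * t)
    mixed-F = trans (lem (+ N) (+ e) (+ m) s t g) (vanish (- (+ e * t)) 0ℤ Δ₁≡0 Δ₂≡0)
      where lem : ∀ N e m s t g → e * N * - (t * g) - - (e * m * s) * (e * t * s) ≡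
                  - (e * t) + (- (e * t) * (N * g - (1ℤ + e * m * (s * s))) + 0ℤ * 0ℤ)
            lem = solve-∀

    cominor-F : cominor F ≡ + e * α
    cominor-F = trans (lem (+ N) (+ D) (+ e) (+ m) s t g α) (vanish (+ e * α) (+ e * + e * (s * s)) Δ₁≡0 Δ₂≡0)
      where lem : ∀ N D e m s t g α → e * N * (α * g - e * D * (s * s)) - e * t * s * (e * t * s) ≡
                  e * α + (e * α * (N * g - (1ℤ + e * m * (s * s))) + e * e * (s * s) * (m * α - (t * t + D * N)))
            lem = solve-∀

    instance
      eN-nonZero : ℤ.NonZero (+ e * + N)
      eN-nonZero = ℤ.i*j≢0 (+ e) (+ N) {{ℕ.>-nonZero 0<e}} {{ℕ.>-nonZero 0<N}}

    -- With `minor`, `mixed` and `cominor` equal to e m, -e t and e α, the relation m α - t² = D N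
    -- gives e N `det` = e N e D, and e N is cancelled.
    det-F : det F ≡ + e * + D
    det-F = ℤ.*-cancelˡ-≡ (+ e * + N) (det F) (+ e * + D) (begin
      + e * + N * det F                                          ≡⟨ lem₁ _ (mixed F * mixed F) ⟩
      mixed F * mixed F + + e * + N * det F - mixed F * mixed F  ≡⟨ cong (_- mixed F * mixed F) (sym (minor*cominor F)) ⟩
      minor F * cominor F - mixed F * mixed F                    ≡⟨ cong₂ _-_ (cong₂ _*_ minor-F cominor-F) (cong₂ _*_ mixed-F mixed-F) ⟩
      + e * + m * (+ e * α) - - (+ e * t) * - (+ e * t)          ≡⟨ lem₂ (+ N) (+ D) (+ e) (+ m) t α ⟩
      + e * + N * (+ e * + D) + (+ e * + e * (+ m * α - (t * t + + D * + N)) + 0ℤ * 0ℤ) ≡⟨ vanish (+ e * + e) 0ℤ Δ₂≡0 refl ⟩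
      + e * + N * (+ e * + D)                                    ∎)
      where
      open ≡-Reasoning
      lem₁ : ∀ x y → x ≡ y + x - y
      lem₁ = solve-∀
      lem₂ : ∀ N D e m t α → e * m * (e * α) - - (e * t) * - (e * t) ≡
             e * N * (e * D) + (e * e * (m * α - (t * t + D * N)) + 0ℤ * 0ℤ)
      lem₂ = solve-∀

    positive : Positive (e ℕ.* D) F (e ℕ.* N) (e ℕ.* m)
    positive = record
      { a≡ = sym (ℤ.pos-* e N) ; minor≡ = trans minor-F (sym (ℤ.pos-* e m)) ; det≡ = trans det-F (sym (ℤ.pos-* e D))
      ; 0<a = ℕ.*-mono-< 0<e 0<N ; 0<A = ℕ.*-mono-< 0<e 0<m ; 0<D = ℕ.*-mono-< 0<e 0<D }

    eN∈F : + (e ℕ.* N) ∈ᵛ F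
    eN∈F = 1ℤ , 0ℤ , 0ℤ , trans (lem (+ e * + N) (Form.b F) (Form.c F) (Form.d F) (Form.e F) (Form.f F)) (sym (ℤ.pos-* e N))
      where lem : ∀ a b c d e f → a * (1ℤ * 1ℤ) + d * (0ℤ * 0ℤ) + f * (0ℤ * 0ℤ) + + 2 * (b * (1ℤ * 0ℤ) + c * (1ℤ * 0ℤ) + e * (0ℤ * 0ℤ)) ≡ a
            lem = solve-∀

    -- The square is completed in the binary form too; in this diagonal shape congruences can
    -- exclude values of F.
    diagonal : ∀ {n} → n ∈ᵛ F → ∃[ L ] ∃[ T ] ∃[ x ] + m * + N * n ≡ + e * + m * (L * L) + T * T + + D * + N * (x * x)
    diagonal (x , y , z , eq) = + N * x - + m * s * y + t * s * z , + m * y - t * z , z ,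
      trans (cong (+ m * + N *_) (sym eq)) (trans (lem (+ N) (+ D) (+ e) (+ m) s t g α x y z)
        (vanish (+ m * (+ m * (y * y) - + 2 * (t * y * z) + α * (z * z))) (z * z + + m * + e * (s * s) * (z * z)) Δ₁≡0 Δ₂≡0))
      where
      lem : ∀ N D e m s t g α x y z →
        m * N * (e * N * (x * x) + m * g * (y * y) + (α * g - e * D * (s * s)) * (z * z) +
                 + 2 * (- (e * m * s) * (x * y) + e * t * s * (x * z) + - (t * g) * (y * z))) ≡
        e * m * ((N * x - m * s * y + t * s * z) * (N * x - m * s * y + t * s * z)) +
        (m * y - t * z) * (m * y - t * z) + D * N * (z * z) +
        (m * (m * (y * y) - + 2 * (t * y * z) + α * (z * z)) * (N * g - (1ℤ + e * m * (s * s))) +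
         (z * z + m * e * (s * s) * (z * z)) * (m * α - (t * t + D * N)))
      lem = solve-∀

  -- M = v² D N: dividing by v modulo m turns m ∣ t² + M into m ∣ t² + D N.
  find-modulus : ∀ N D v l c → let open Extended l in M ≡ v ℕ.* v ℕ.* (D ℕ.* N) → Coprime c Q → Symbol.symbol M c ≡ 1ℤ →
    ∃[ m ] ∃[ s ] ∃[ t ] 0 ℕ.< m × Coprime m Q × (+ Q ∣ + m * (s * s) - + c) × (+ m ∣ t * t + + D * + N)
  find-modulus N D v l c M≡ c⊥Q symbol≡1 = convert (class-contains-represented c c⊥Q symbol≡1)
    where
    open Extended l
    v∣Q : v ℕ.∣ Q
    v∣Q = ℕ.∣m∣n⇒∣m+n v∣n v∣n
      where
      v∣M : v ℕ.∣ M
      v∣M = subst (v ℕ.∣_) (sym M≡) (ℕ.∣m⇒∣m*n (D ℕ.* N) (ℕ.m∣m*n v))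
      v∣n : v ℕ.∣ n
      v∣n = ℕ.∣m∣n⇒∣m+n v∣M v∣M
    convert : (∃[ m ] ∃[ k ] ∃[ t ] 0 ℕ.< m × Coprime m Q × (+ Q ∣ + (m ℕ.* (k ℕ.* k)) - + c) × (+ m ∣ t * t + + M)) →
              ∃[ m ] ∃[ s ] ∃[ t ] 0 ℕ.< m × Coprime m Q × (+ Q ∣ + m * (s * s) - + c) × (+ m ∣ t * t + + D * + N)
    convert (m , k , t , 0<m , m⊥Q , Q∣ , m∣) = m , + k , + b * t , 0<m , m⊥Q ,
        subst (λ y → + Q ∣ y - + c) (trans (ℤ.pos-* m (k ℕ.* k)) (cong (+ m *_) (ℤ.pos-* k k))) Q∣ ,
        ∣-resp (lem (+ b) t (+ v) (+ D * + N)) (∣m∣n⇒∣m-n (∣n⇒∣m*n (+ b * + b) m∣′) (∣m⇒∣m*n ((+ b * + v + 1ℤ) * (+ D * + N)) (proj₂ inverse)))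
      where
      v⊥m : Coprime v m
      v⊥m (d∣v , d∣m) = m⊥Q (d∣m , ℕ.∣-trans d∣v v∣Q)
      inverse : ∃[ b ] + m ∣ + b * + v - 1ℤ
      inverse = coprime-inverse v⊥m
      b = proj₁ inverse
      M-pos : + M ≡ + v * + v * (+ D * + N)
      M-pos = trans (cong +_ M≡) (trans (ℤ.pos-* (v ℕ.* v) (D ℕ.* N)) (cong₂ _*_ (ℤ.pos-* v v) (ℤ.pos-* D N)))
      m∣′ : + m ∣ t * t + + v * + v * (+ D * + N)
      m∣′ = subst (λ y → + m ∣ t * t + y) M-pos m∣
      lem : ∀ b t v x → b * b * (t * t + v * v * x) - (b * v - 1ℤ) * ((b * v + 1ℤ) * x) ≡ b * t * (b * t) + x
      lem = solve-∀

  odd-root : ∀ {m N} → Coprime m 2 → ∀ t → + m ∣ t * t + + N → + 2 ∣ + N - 1ℤ → + 2 ∣ + m - 1ℤ → ∃[ u ] + (2 ℕ.* m) ∣ u * u + + N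
  odd-root {m} {N} m⊥2 t m∣ 2∣N-1 2∣m-1 = u , ∣ᵤ⇒∣ (coprime-product (∣⇒∣ᵤ 2∣) (∣⇒∣ᵤ m∣u))
    where
    -- u ≡ t modulo m, and u ≡ 1 modulo 2.
    u = t + (1ℤ - t) * + m
    m∣u : + m ∣ u * u + + N
    m∣u = ∣-resp (lem t (+ m) (+ N)) (∣m∣n⇒∣m+n m∣ (∣n⇒∣m*n ((1ℤ - t) * (t + u)) ∣-refl))
      where lem : ∀ t m n → t * t + n + (1ℤ - t) * (t + (t + (1ℤ - t) * m)) * m ≡ (t + (1ℤ - t) * m) * (t + (1ℤ - t) * m) + n
            lem = solve-∀
    2∣ : + 2 ∣ u * u + + N
    2∣ = ∣-resp (lem t (+ m) (+ N)) (∣m∣n⇒∣m+n (∣m∣n⇒∣m+n 2∣N-1 (∣n⇒∣m*n ((1ℤ - t) * (1ℤ + u)) 2∣m-1)) (∣n⇒∣m*n 1ℤ ∣-refl))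
      where lem : ∀ t m n → n - 1ℤ + (1ℤ - t) * (1ℤ + (t + (1ℤ - t) * m)) * (m - 1ℤ) + 1ℤ * + 2 ≡
                            (t + (1ℤ - t) * m) * (t + (1ℤ - t) * m) + n
            lem = solve-∀
    coprime-product : ∀ {X} → 2 ℕ.∣ X → m ℕ.∣ X → 2 ℕ.* m ℕ.∣ X
    coprime-product (ℕ.divides y refl) d = subst (ℕ._∣ y ℕ.* 2) (ℕ.*-comm m 2)
      (ℕ.*-monoˡ-∣ 2 (coprime-divisor {m} {2} {y} m⊥2 (subst (m ℕ.∣_) (ℕ.*-comm y 2) d)))

-- Five arithmetic progressions.

module Families where

  open Folding using (∣-resp; pos-∣)
  open Character using (module Symbol; symbol-congruent)
  open Existence
  open Ternary using (_∈ᵛ_)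
  open Classify using (classify₁; classify₃; classify₅)
  open Congruence
  open Represent
  open import Data.Fin.Base using (zero; suc)
  open import Data.Nat.Coprimality using (Coprime) renaming (sym to coprime-sym)
  open import Data.Integer.Divisibility.Signed
  open import Data.Unit.Base using (tt)
  open import Data.Vec.Base using ([]; _∷_)
  open import Relation.Nullary.Decidable using (from-no)

  coprime-1+ : ∀ i r → Coprime (suc (r ℕ.* i)) r
  coprime-1+ i r {d} (d∣ , d∣r) = ℕ.∣1⇒≡1 (ℕ.∣m+n∣m⇒∣n (subst (d ℕ.∣_) (ℕ.+-comm 1 (r ℕ.* i)) d∣) (ℕ.∣m⇒∣m*n i d∣r))

  coprime-shift : ∀ {c R} k → Coprime c R → Coprime c (k ℕ.* c ℕ.+ R)
  coprime-shift k c⊥R (d∣c , d∣) = c⊥R (d∣c , ℕ.∣m+n∣m⇒∣n d∣ (ℕ.∣n⇒∣m*n k d∣c))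

  coprime-*ʳ : ∀ {c m n} → Coprime c m → Coprime c n → Coprime c (m ℕ.* n)
  coprime-*ʳ c⊥m c⊥n = coprime-sym (coprime-* (coprime-sym c⊥m) (coprime-sym c⊥n))

  odd⊥2 : ∀ h → Coprime (suc (h ℕ.+ h)) 2
  odd⊥2 h = subst (λ t → Coprime (suc t) 2) (lem h) (coprime-1+ h 2)
    where lem : ∀ h → 2 ℕ.* h ≡ h ℕ.+ h
          lem = ℕ.solve-∀

  odd⊥4 : ∀ h → Coprime (suc (h ℕ.+ h)) 4
  odd⊥4 h = coprime-*ʳ {m = 2} {2} (odd⊥2 h) (odd⊥2 h)

  odd⊥8 : ∀ h → Coprime (suc (h ℕ.+ h)) 8
  odd⊥8 h = coprime-*ʳ {m = 2} {4} (odd⊥2 h) (odd⊥4 h)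

  odd⊥16 : ∀ h → Coprime (suc (h ℕ.+ h)) 16
  odd⊥16 h = coprime-*ʳ {m = 4} {4} (odd⊥4 h) (odd⊥4 h)

  even : ℕ → ℕ
  even l = suc (suc (l ℕ.+ l))

  -- The class of c = 2h + 1 modulo Q = 4 v² D N, whose symbol is evaluated by reducing v² D N modulo c.
  module Family (N D v l l′ h q k R : ℕ)
    (M≡  : even l ≡ v ℕ.* v ℕ.* (D ℕ.* N))
    (M≡′ : even l ≡ even l′ ℕ.+ q ℕ.* suc (h ℕ.+ h))
    (Q≡  : (even l ℕ.+ even l) ℕ.+ (even l ℕ.+ even l) ≡ k ℕ.* suc (h ℕ.+ h) ℕ.+ R)
    (c⊥R : Coprime (suc (h ℕ.+ h)) R)
    (c⊥M′ : Coprime (suc (h ℕ.+ h)) (even l′ ℕ.+ even l′))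
    (symbol′ : Symbol.symbol (even l′) (suc (h ℕ.+ h)) ≡ 1ℤ) where

    open Extended l using (Q; ⊥Q⇒⊥n)

    c : ℕ
    c = suc (h ℕ.+ h)

    c⊥Q : Coprime c Q
    c⊥Q = subst (Coprime c) (sym Q≡) (coprime-shift k c⊥R)

    Modulus : Set
    Modulus = ∃[ m ] ∃[ s ] ∃[ t ] 0 ℕ.< m × Coprime m Q × (+ Q ∣ + m * (s * s) - + c) × (+ m ∣ t * t + + D * + N)

    modulus : Modulus
    modulus = find-modulus N D v l c M≡ c⊥Q (trans (symbol-congruent l l′ h q (⊥Q⇒⊥n c⊥Q) c⊥M′ M≡′) symbol′)

    Q≡4v²DN : Q ≡ 4 ℕ.* (v ℕ.* v) ℕ.* D ℕ.* N
    Q≡4v²DN = trans (lem₁ (even l)) (trans (cong (4 ℕ.*_) M≡) (lem₂ v D N))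
      where
      lem₁ : ∀ M → (M ℕ.+ M) ℕ.+ (M ℕ.+ M) ≡ 4 ℕ.* M
      lem₁ = ℕ.solve-∀
      lem₂ : ∀ v D N → 4 ℕ.* (v ℕ.* v ℕ.* (D ℕ.* N)) ≡ 4 ℕ.* (v ℕ.* v) ℕ.* D ℕ.* N
      lem₂ = ℕ.solve-∀

    N∣Q : + N ∣ + Q
    N∣Q = pos-∣ (subst (N ℕ.∣_) (sym Q≡4v²DN) (ℕ.n∣m*n (4 ℕ.* (v ℕ.* v) ℕ.* D)))

    D∣Q : + D ∣ + Q
    D∣Q = pos-∣ (subst (D ℕ.∣_) (sym Q≡4v²DN) (ℕ.∣m⇒∣m*n N (ℕ.n∣m*n (4 ℕ.* (v ℕ.* v)))))

    N∣1+ems² : ∀ e w → e ℕ.* c ℕ.+ 1 ≡ w ℕ.* N → ∀ {m} {s : ℤ} → + Q ∣ + m * (s * s) - + c → + N ∣ 1ℤ + + e * + m * (s * s)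
    N∣1+ems² e w eq {m} {s} Q∣ = ∣-resp (lem (+ e) (+ m) s (+ c)) (∣m∣n⇒∣m+n (∣n⇒∣m*n (+ e) (∣-trans N∣Q Q∣)) N∣ec+1)
      where
      lem : ∀ e m s c → e * (m * (s * s) - c) + (e * c + 1ℤ) ≡ 1ℤ + e * m * (s * s)
      lem = solve-∀
      N∣ec+1 : + N ∣ + e * + c + 1ℤ
      N∣ec+1 = divides (+ w) (trans (cong (_+ 1ℤ) (sym (ℤ.pos-* e c))) (trans (cong +_ eq) (ℤ.pos-* w N)))

  -- Here (-4 / c) is taken at c ≡ 1 modulo 4, and the period 16 leaves four values to compute.
  symbol₄ : ∀ j → Symbol.symbol 4 (suc ((j ℕ.+ j) ℕ.+ (j ℕ.+ j))) ≡ 1ℤ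
  symbol₄ 0 = refl
  symbol₄ 1 = refl
  symbol₄ 2 = refl
  symbol₄ 3 = refl
  symbol₄ (suc (suc (suc (suc j)))) = trans (cong (Symbol.symbol 4) (lem j)) (trans (Symbol.symbol-periodic 4 (suc ((j ℕ.+ j) ℕ.+ (j ℕ.+ j)))) (symbol₄ j))
    where lem : ∀ j → suc (((4 ℕ.+ j) ℕ.+ (4 ℕ.+ j)) ℕ.+ ((4 ℕ.+ j) ℕ.+ (4 ℕ.+ j))) ≡ suc ((j ℕ.+ j) ℕ.+ (j ℕ.+ j)) ℕ.+ 16
          lem = ℕ.solve-∀

  symbol-constant : ∀ l′ u i c → c ≡ i ℕ.* Extended.Q l′ ℕ.+ u → Symbol.symbol (even l′) u ≡ 1ℤ → Symbol.symbol (even l′) c ≡ 1ℤ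
  symbol-constant l′ u i c eq one = trans (cong (Symbol.symbol (even l′)) eq) (trans (Extended.symbol-shift l′ i u) one)

  SumOfThreeSquares : ℕ → Set
  SumOfThreeSquares N = ∃[ x ] ∃[ y ] ∃[ z ] x * x + y * y + z * z ≡ + N

  three-squares : ∀ {N m s t} → 0 ℕ.< N → 0 ℕ.< m → + m ∣ t * t + + 1 * + N → + N ∣ 1ℤ + + 1 * + m * (s * s) → SumOfThreeSquares N
  three-squares {N} {m} {s} {t} 0<N 0<m m∣ N∣ = subst SumOfThreeSquares (ℕ.*-identityˡ N) (classify₁ positive eN∈F)
    where open Construction N 1 1 m 0<N (s≤s z≤n) (s≤s z≤n) 0<m s t m∣ N∣

  -- With c = N - 1 one has M = 4N = 4 + 4c, and (-4 / c) = 1 because c ≡ 1 modulo 4.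
  three-squares-2mod4 : ∀ j → SumOfThreeSquares (2 ℕ.+ 4 ℕ.* j)
  three-squares-2mod4 j = conclude modulus
    where
    N = 2 ℕ.+ 4 ℕ.* j
    h = j ℕ.+ j
    l = 3 ℕ.+ 8 ℕ.* j
    M≡ : ∀ j → suc (suc ((3 ℕ.+ 8 ℕ.* j) ℕ.+ (3 ℕ.+ 8 ℕ.* j))) ≡ 2 ℕ.* 2 ℕ.* (1 ℕ.* (2 ℕ.+ 4 ℕ.* j))
    M≡ = ℕ.solve-∀
    M≡′ : ∀ j → suc (suc ((3 ℕ.+ 8 ℕ.* j) ℕ.+ (3 ℕ.+ 8 ℕ.* j))) ≡ 4 ℕ.+ 4 ℕ.* suc ((j ℕ.+ j) ℕ.+ (j ℕ.+ j))
    M≡′ = ℕ.solve-∀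
    Q≡ : ∀ j → let M = suc (suc ((3 ℕ.+ 8 ℕ.* j) ℕ.+ (3 ℕ.+ 8 ℕ.* j))) in (M ℕ.+ M) ℕ.+ (M ℕ.+ M) ≡ 16 ℕ.* suc ((j ℕ.+ j) ℕ.+ (j ℕ.+ j)) ℕ.+ 16
    Q≡ = ℕ.solve-∀
    c+1 : ∀ j → 1 ℕ.* suc ((j ℕ.+ j) ℕ.+ (j ℕ.+ j)) ℕ.+ 1 ≡ 1 ℕ.* (2 ℕ.+ 4 ℕ.* j)
    c+1 = ℕ.solve-∀
    open Family N 1 2 l 1 h 4 16 16 (M≡ j) (M≡′ j) (Q≡ j) (odd⊥16 h) (odd⊥8 h) (symbol₄ j)
    conclude : Modulus → SumOfThreeSquares N
    conclude (m , s , t , 0<m , _ , Q∣ , m∣) = three-squares {N} {m} {s} {t} (s≤s z≤n) 0<m m∣ (N∣1+ems² 1 1 (c+1 j) {m} {s} Q∣)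

  -- As N - 1 is even, c = 2N - 1 takes its place: M = 4N = 2 + 2c, and (-2 / c) = 1 because c ≡ 1
  -- modulo 8.
  three-squares-1mod4 : ∀ j → SumOfThreeSquares (1 ℕ.+ 4 ℕ.* j)
  three-squares-1mod4 j = conclude modulus
    where
    N = 1 ℕ.+ 4 ℕ.* j
    h = 4 ℕ.* j
    l = 1 ℕ.+ 8 ℕ.* j
    M≡ : ∀ j → suc (suc ((1 ℕ.+ 8 ℕ.* j) ℕ.+ (1 ℕ.+ 8 ℕ.* j))) ≡ 2 ℕ.* 2 ℕ.* (1 ℕ.* (1 ℕ.+ 4 ℕ.* j))
    M≡ = ℕ.solve-∀
    M≡′ : ∀ j → suc (suc ((1 ℕ.+ 8 ℕ.* j) ℕ.+ (1 ℕ.+ 8 ℕ.* j))) ≡ 2 ℕ.+ 2 ℕ.* suc (4 ℕ.* j ℕ.+ 4 ℕ.* j)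
    M≡′ = ℕ.solve-∀
    Q≡ : ∀ j → let M = suc (suc ((1 ℕ.+ 8 ℕ.* j) ℕ.+ (1 ℕ.+ 8 ℕ.* j))) in (M ℕ.+ M) ℕ.+ (M ℕ.+ M) ≡ 8 ℕ.* suc (4 ℕ.* j ℕ.+ 4 ℕ.* j) ℕ.+ 8
    Q≡ = ℕ.solve-∀
    c+1 : ∀ j → 1 ℕ.* suc (4 ℕ.* j ℕ.+ 4 ℕ.* j) ℕ.+ 1 ≡ 2 ℕ.* (1 ℕ.+ 4 ℕ.* j)
    c+1 = ℕ.solve-∀
    c≡ : ∀ j → suc (4 ℕ.* j ℕ.+ 4 ℕ.* j) ≡ j ℕ.* 8 ℕ.+ 1
    c≡ = ℕ.solve-∀
    open Family N 1 2 l 0 h 2 8 8 (M≡ j) (M≡′ j) (Q≡ j) (odd⊥8 h) (odd⊥4 h) (symbol-constant 0 1 j _ (c≡ j) refl)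
    conclude : Modulus → SumOfThreeSquares N
    conclude (m , s , t , 0<m , _ , Q∣ , m∣) = three-squares {N} {m} {s} {t} (s≤s z≤n) 0<m m∣ (N∣1+ems² 1 2 (c+1 j) {m} {s} Q∣)

  odd-minus-1 : ∀ {m} → (∃[ h ] m ≡ suc (h ℕ.+ h)) → + 2 ∣ + m - 1ℤ
  odd-minus-1 (h , refl) = divides (+ h) (lem (+ h))
    where lem : ∀ h → 1ℤ + (h + h) - 1ℤ ≡ h * + 2
          lem = solve-∀

  -- With c = (N - 1) / 2 one has 2c ≡ -1 modulo N and M = 4N = 4 + 8c. The factor 2 is put into the
  -- modulus 2m and not into the leading coefficient, which keeps the determinant at 1; `odd-root`
  -- supplies the root of -N modulo 2m.
  three-squares-3mod8 : ∀ j → SumOfThreeSquares (3 ℕ.+ 8 ℕ.* j)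
  three-squares-3mod8 j = conclude modulus
    where
    N = 3 ℕ.+ 8 ℕ.* j
    h = j ℕ.+ j
    l = 5 ℕ.+ 16 ℕ.* j
    M≡ : ∀ j → suc (suc ((5 ℕ.+ 16 ℕ.* j) ℕ.+ (5 ℕ.+ 16 ℕ.* j))) ≡ 2 ℕ.* 2 ℕ.* (1 ℕ.* (3 ℕ.+ 8 ℕ.* j))
    M≡ = ℕ.solve-∀
    M≡′ : ∀ j → suc (suc ((5 ℕ.+ 16 ℕ.* j) ℕ.+ (5 ℕ.+ 16 ℕ.* j))) ≡ 4 ℕ.+ 8 ℕ.* suc ((j ℕ.+ j) ℕ.+ (j ℕ.+ j))
    M≡′ = ℕ.solve-∀
    Q≡ : ∀ j → let M = suc (suc ((5 ℕ.+ 16 ℕ.* j) ℕ.+ (5 ℕ.+ 16 ℕ.* j))) in (M ℕ.+ M) ℕ.+ (M ℕ.+ M) ≡ 32 ℕ.* suc ((j ℕ.+ j) ℕ.+ (j ℕ.+ j)) ℕ.+ 16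
    Q≡ = ℕ.solve-∀
    2c+1 : ∀ j → 2 ℕ.* suc ((j ℕ.+ j) ℕ.+ (j ℕ.+ j)) ℕ.+ 1 ≡ 1 ℕ.* (3 ℕ.+ 8 ℕ.* j)
    2c+1 = ℕ.solve-∀
    N-odd : ∀ j → 3 ℕ.+ 8 ℕ.* j ≡ suc ((1 ℕ.+ 4 ℕ.* j) ℕ.+ (1 ℕ.+ 4 ℕ.* j))
    N-odd = ℕ.solve-∀
    open Family N 1 2 l 1 h 8 32 16 (M≡ j) (M≡′ j) (Q≡ j) (odd⊥16 h) (odd⊥8 h) (symbol₄ j)
    conclude : Modulus → SumOfThreeSquares N
    conclude (m , s , t , 0<m , m⊥Q , Q∣ , m∣) = three-squares {N} {2 ℕ.* m} {s} {proj₁ root} (s≤s z≤n) (ℕ.*-mono-< {0} {2} (s≤s z≤n) 0<m)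
        (subst (λ y → + (2 ℕ.* m) ∣ proj₁ root * proj₁ root + y) (sym (ℤ.*-identityˡ (+ N))) (proj₂ root))
        (∣-resp (trans (lem (+ m) (s * s)) (cong (λ y → 1ℤ + 1ℤ * y * (s * s)) (sym (ℤ.pos-* 2 m)))) (N∣1+ems² 2 1 (2c+1 j) {m} {s} Q∣))
      where
      lem : ∀ m x → 1ℤ + + 2 * m * x ≡ 1ℤ + 1ℤ * (+ 2 * m) * x
      lem = solve-∀
      m-odd : ∃[ h ] m ≡ suc (h ℕ.+ h)
      m-odd = coprime-even⇒odd {m} {Extended.n l} m⊥Q
      m⊥2 : Coprime m 2
      m⊥2 = subst (λ y → Coprime y 2) (sym (proj₂ m-odd)) (odd⊥2 (proj₁ m-odd))
      root : ∃[ u ] + (2 ℕ.* m) ∣ u * u + + N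
      root = odd-root m⊥2 t (subst (λ y → + m ∣ t * t + y) (ℤ.*-identityˡ (+ N)) m∣) (odd-minus-1 (1 ℕ.+ 4 ℕ.* j , N-odd j)) (odd-minus-1 m-odd)

  residue-mod3 : ∀ m s c → + 3 ∣ m * (s * s) - c → + 3 ∣ c - + 1 → + 3 ∣ m - + 1
  residue-mod3 m s c = by-residues 3 (3 ∣′ x₀ ⊗ (x₁ ⊗ x₁) ⊖ x₂ ⇒′ 3 ∣′ x₂ ⊖ con (+ 1) ⇒′ 3 ∣′ x₀ ⊖ con (+ 1)) tt (m ∷ s ∷ c ∷ [])

  -- Modulo 3 the equation reads L² + T² ≡ 0, so 3 divides L and T. Modulo 9 there remains 6 m N ≡ 3
  -- N x², that is x² ≡ 2 modulo 3.
  six-not-value : ∀ m N L T x → + 3 ∣ m - + 1 → + 3 ∣ N - + 1 →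
                  m * N * + 6 ≢ + 1 * m * (L * L) + T * T + + 3 * N * (x * x)
  six-not-value m N L T x m≡1 N≡1 eq = from-no (9 ℕ.∣? 1) (∣⇒∣ᵤ (by-residues 9
      (3 ∣′ x₀ ⊖ con (+ 1) ⇒′ 3 ∣′ x₁ ⊖ con (+ 1) ⇒′
        9 ∣′ x₀ ⊗ x₁ ⊗ con (+ 6) ⊖ (con (+ 1) ⊗ x₀ ⊗ (x₂ ⊗ x₂) ⊕ x₃ ⊗ x₃ ⊕ con (+ 3) ⊗ x₁ ⊗ (x₄ ⊗ x₄)) ⇒′
        9 ∣′ con (+ 1)) tt (m ∷ N ∷ L ∷ T ∷ x ∷ []) m≡1 N≡1 (divides 0ℤ (ℤ.i≡j⇒i-j≡0 eq))))
    where
    x₃ x₄ : Expr 5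
    x₃ = var (suc (suc (suc zero)))
    x₄ = var (suc (suc (suc (suc zero))))

  -- With c = 8N - 1 one has M = 48N = 6 + 6c, and (-6 / c) = 1 because c ≡ 7 modulo 24. Also c ≡ 1
  -- modulo 3, hence m ≡ 1 modulo 3, as the exclusion of 6 requires.
  two-squares-plus-three : ∀ j → ∃[ x ] ∃[ y ] ∃[ z ] x * x + y * y + + 3 * (z * z) ≡ + (7 ℕ.+ 24 ℕ.* j)
  two-squares-plus-three j = conclude modulus
    where
    N = 7 ℕ.+ 24 ℕ.* j
    h = 27 ℕ.+ 96 ℕ.* j
    l = 167 ℕ.+ 576 ℕ.* j
    M≡ : ∀ j → suc (suc ((167 ℕ.+ 576 ℕ.* j) ℕ.+ (167 ℕ.+ 576 ℕ.* j))) ≡ 4 ℕ.* 4 ℕ.* (3 ℕ.* (7 ℕ.+ 24 ℕ.* j))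
    M≡ = ℕ.solve-∀
    M≡′ : ∀ j → suc (suc ((167 ℕ.+ 576 ℕ.* j) ℕ.+ (167 ℕ.+ 576 ℕ.* j))) ≡ 6 ℕ.+ 6 ℕ.* suc ((27 ℕ.+ 96 ℕ.* j) ℕ.+ (27 ℕ.+ 96 ℕ.* j))
    M≡′ = ℕ.solve-∀
    Q≡ : ∀ j → let M = suc (suc ((167 ℕ.+ 576 ℕ.* j) ℕ.+ (167 ℕ.+ 576 ℕ.* j))) in (M ℕ.+ M) ℕ.+ (M ℕ.+ M) ≡ 24 ℕ.* suc ((27 ℕ.+ 96 ℕ.* j) ℕ.+ (27 ℕ.+ 96 ℕ.* j)) ℕ.+ 24
    Q≡ = ℕ.solve-∀
    c+1 : ∀ j → 1 ℕ.* suc ((27 ℕ.+ 96 ℕ.* j) ℕ.+ (27 ℕ.+ 96 ℕ.* j)) ℕ.+ 1 ≡ 8 ℕ.* (7 ℕ.+ 24 ℕ.* j)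
    c+1 = ℕ.solve-∀
    c≡ : ∀ j → suc ((27 ℕ.+ 96 ℕ.* j) ℕ.+ (27 ℕ.+ 96 ℕ.* j)) ≡ (2 ℕ.+ 8 ℕ.* j) ℕ.* 24 ℕ.+ 7
    c≡ = ℕ.solve-∀
    2h≡3i : ∀ j → 3 ℕ.* (18 ℕ.+ 64 ℕ.* j) ≡ (27 ℕ.+ 96 ℕ.* j) ℕ.+ (27 ℕ.+ 96 ℕ.* j)
    2h≡3i = ℕ.solve-∀
    c⊥3 : Coprime (suc (h ℕ.+ h)) 3
    c⊥3 = subst (λ y → Coprime (suc y) 3) (2h≡3i j) (coprime-1+ (18 ℕ.+ 64 ℕ.* j) 3)
    open Family N 3 4 l 2 h 6 24 24 (M≡ j) (M≡′ j) (Q≡ j) (coprime-*ʳ {m = 8} {3} (odd⊥8 h) c⊥3) (coprime-*ʳ {m = 4} {3} (odd⊥4 h) c⊥3)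
      (symbol-constant 2 7 (2 ℕ.+ 8 ℕ.* j) _ (c≡ j) refl)
    Goal : Set
    Goal = ∃[ x ] ∃[ y ] ∃[ z ] x * x + y * y + + 3 * (z * z) ≡ + N
    conclude : Modulus → Goal
    conclude (m , s , t , 0<m , _ , Q∣ , m∣) =
        subst (λ y → ∃[ x ] ∃[ y′ ] ∃[ z ] x * x + y′ * y′ + + 3 * (z * z) ≡ + y) (ℕ.*-identityˡ N) (classify₃ positive 6∉F eN∈F)
      where
      open Construction N 3 1 m (s≤s z≤n) (s≤s z≤n) (s≤s z≤n) 0<m s t m∣ (N∣1+ems² 1 8 (c+1 j) {m} {s} Q∣)
      three∣ : ∀ {y} i → y ≡ suc (3 ℕ.* i) → + 3 ∣ + y - + 1
      three∣ i refl = divides (+ i) (trans (lem (+ (3 ℕ.* i))) (trans (ℤ.pos-* 3 i) (ℤ.*-comm (+ 3) (+ i))))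
        where lem : ∀ x → 1ℤ + x - 1ℤ ≡ x
              lem = solve-∀
      N≡1+3i : ∀ j → 7 ℕ.+ 24 ℕ.* j ≡ 1 ℕ.+ 3 ℕ.* (2 ℕ.+ 8 ℕ.* j)
      N≡1+3i = ℕ.solve-∀
      m≡1 : + 3 ∣ + m - + 1
      m≡1 = residue-mod3 (+ m) s (+ c) (∣-trans D∣Q Q∣) (three∣ (18 ℕ.+ 64 ℕ.* j) (cong suc (sym (2h≡3i j))))
      6∉F : ¬ + 6 ∈ᵛ F
      6∉F 6∈F = let (L , T , x , eq) = diagonal 6∈F in
        six-not-value (+ m) (+ N) L T x m≡1 (three∣ (2 ℕ.+ 8 ℕ.* j) (N≡1+3i j)) eq

  anisotropic-mod5 : ∀ N T x → + 5 ∣ N - + 2 → + 5 ∣ T * T + N * (x * x) → (+ 5 ∣ T) × (+ 5 ∣ x)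
  anisotropic-mod5 N T x = by-residues 5 (5 ∣′ x₀ ⊖ con (+ 2) ⇒′ 5 ∣′ x₁ ⊗ x₁ ⊕ x₀ ⊗ (x₂ ⊗ x₂) ⇒′ (5 ∣′ x₁ ∧′ 5 ∣′ x₂)) tt (N ∷ T ∷ x ∷ [])

  nonresidue-mod5 : ∀ N m L → + 5 ∣ N - + 2 → + 5 ∣ m * N - m * (L * L) → + 5 ∣ m
  nonresidue-mod5 N m L = by-residues 5 (5 ∣′ x₀ ⊖ con (+ 2) ⇒′ 5 ∣′ x₁ ⊗ x₀ ⊖ x₁ ⊗ (x₂ ⊗ x₂) ⇒′ 5 ∣′ x₁) tt (N ∷ m ∷ L ∷ [])

  no-root-mod5 : ∀ N t → + 5 ∣ N - + 2 → ¬ + 5 ∣ t * t + + 1 * N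
  no-root-mod5 N t N≡2 d = from-no (5 ℕ.∣? 1) (∣⇒∣ᵤ (by-residues 5
    (5 ∣′ x₀ ⊖ con (+ 2) ⇒′ 5 ∣′ x₁ ⊗ x₁ ⊕ con (+ 1) ⊗ x₀ ⇒′ 5 ∣′ con (+ 1)) tt (N ∷ t ∷ []) N≡2 d))

  -- As -N ≡ 3 is a nonresidue modulo 5, 5 divides T and x, so 25 divides T² + N x² and 5 divides m
  -- (N - L²). As N ≡ 2 is a nonresidue as well, 5 divides m.
  five-not-value : ∀ m N L T x → + 5 ∣ N - + 2 → ¬ + 5 ∣ m →
                   m * N * + 5 ≢ + 5 * m * (L * L) + T * T + + 1 * N * (x * x)
  five-not-value m N L T x N≡2 5∤m eq = 5∤m (nonresidue-mod5 N m L N≡2 5∣)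
    where
    norm≡ : T * T + N * (x * x) ≡ (m * N - m * (L * L)) * + 5
    norm≡ = trans (lem m N L T x) (trans (cong (λ y → (m * N - m * (L * L)) * + 5 + y) (ℤ.i≡j⇒i-j≡0 (sym eq))) (ℤ.+-identityʳ _))
      where
      lem : ∀ m N L T x → T * T + N * (x * x) ≡ (m * N - m * (L * L)) * + 5 + (+ 5 * m * (L * L) + T * T + + 1 * N * (x * x) - m * N * + 5)
      lem = solve-∀
    both : (+ 5 ∣ T) × (+ 5 ∣ x)
    both = anisotropic-mod5 N T x N≡2 (divides (m * N - m * (L * L)) norm≡)
    square∣ : ∀ {y} → + 5 ∣ y → + 5 * + 5 ∣ y * y
    square∣ (divides q refl) = divides (q * q) (lem q)
      where lem : ∀ q → q * + 5 * (q * + 5) ≡ q * q * (+ 5 * + 5)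
            lem = solve-∀
    5∣ : + 5 ∣ m * N - m * (L * L)
    5∣ = *-cancelʳ-∣ (+ 5) (∣-resp norm≡ (∣m∣n⇒∣m+n (square∣ (proj₁ both)) (∣n⇒∣m*n N (square∣ (proj₂ both)))))

  -- Here 5c + 1 = 8N and M = 16N = 2 + 10c, with (-2 / c) = 1 because c ≡ 3 modulo 8. The factor e
  -- = 5 makes both the determinant 5 and the represented value 5N. A factor 5 of m would make -N ≡
  -- 3 a square modulo 5.
  skew-form : ∀ j → ∃[ x ] ∃[ y ] ∃[ z ] x * x + + 2 * (y * y) + + 2 * (y * z) + + 3 * (z * z) ≡ + (5 ℕ.* (17 ℕ.+ 40 ℕ.* j))
  skew-form j = conclude modulus
    where
    N = 17 ℕ.+ 40 ℕ.* j
    h = 13 ℕ.+ 32 ℕ.* j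
    l = 135 ℕ.+ 320 ℕ.* j
    M≡ : ∀ j → suc (suc ((135 ℕ.+ 320 ℕ.* j) ℕ.+ (135 ℕ.+ 320 ℕ.* j))) ≡ 4 ℕ.* 4 ℕ.* (1 ℕ.* (17 ℕ.+ 40 ℕ.* j))
    M≡ = ℕ.solve-∀
    M≡′ : ∀ j → suc (suc ((135 ℕ.+ 320 ℕ.* j) ℕ.+ (135 ℕ.+ 320 ℕ.* j))) ≡ 2 ℕ.+ 10 ℕ.* suc ((13 ℕ.+ 32 ℕ.* j) ℕ.+ (13 ℕ.+ 32 ℕ.* j))
    M≡′ = ℕ.solve-∀
    Q≡ : ∀ j → let M = suc (suc ((135 ℕ.+ 320 ℕ.* j) ℕ.+ (135 ℕ.+ 320 ℕ.* j))) in (M ℕ.+ M) ℕ.+ (M ℕ.+ M) ≡ 40 ℕ.* suc ((13 ℕ.+ 32 ℕ.* j) ℕ.+ (13 ℕ.+ 32 ℕ.* j)) ℕ.+ 8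
    Q≡ = ℕ.solve-∀
    5c+1 : ∀ j → 5 ℕ.* suc ((13 ℕ.+ 32 ℕ.* j) ℕ.+ (13 ℕ.+ 32 ℕ.* j)) ℕ.+ 1 ≡ 8 ℕ.* (17 ℕ.+ 40 ℕ.* j)
    5c+1 = ℕ.solve-∀
    c≡ : ∀ j → suc ((13 ℕ.+ 32 ℕ.* j) ℕ.+ (13 ℕ.+ 32 ℕ.* j)) ≡ (3 ℕ.+ 8 ℕ.* j) ℕ.* 8 ℕ.+ 3
    c≡ = ℕ.solve-∀
    open Family N 1 4 l 0 h 10 40 8 (M≡ j) (M≡′ j) (Q≡ j) (odd⊥8 h) (odd⊥4 h) (symbol-constant 0 3 (3 ℕ.+ 8 ℕ.* j) _ (c≡ j) refl)
    N≡2 : + 5 ∣ + N - + 2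
    N≡2 = divides (+ (3 ℕ.+ 8 ℕ.* j)) (trans (cong (λ y → + y - + 2) (lem j)) (trans (lem₂ (+ (5 ℕ.* (3 ℕ.+ 8 ℕ.* j)))) (trans (ℤ.pos-* 5 (3 ℕ.+ 8 ℕ.* j)) (ℤ.*-comm (+ 5) (+ (3 ℕ.+ 8 ℕ.* j))))))
      where
      lem : ∀ j → 17 ℕ.+ 40 ℕ.* j ≡ 2 ℕ.+ 5 ℕ.* (3 ℕ.+ 8 ℕ.* j)
      lem = ℕ.solve-∀
      lem₂ : ∀ x → + 2 + x - + 2 ≡ x
      lem₂ = solve-∀
    conclude : Modulus →
               ∃[ x ] ∃[ y ] ∃[ z ] x * x + + 2 * (y * y) + + 2 * (y * z) + + 3 * (z * z) ≡ + (5 ℕ.* N)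
    conclude (m , s , t , 0<m , _ , Q∣ , m∣) = classify₅ positive 5∉F eN∈F
      where
      open Construction N 1 5 m (s≤s z≤n) (s≤s z≤n) (s≤s z≤n) 0<m s t m∣ (N∣1+ems² 5 8 (5c+1 j) {m} {s} Q∣)
      5∉F : ¬ + 5 ∈ᵛ F
      5∉F 5∈F = let (L , T , x , eq) = diagonal 5∈F in
        five-not-value (+ m) (+ N) L T x N≡2 (λ 5∣m → no-root-mod5 (+ N) t N≡2 (∣-trans 5∣m m∣)) eq

-- Completing squares, and the triples settled by signs and order.

module Triples where

  open import Defs using (f)
  open Folding using (∣-resp)
  open Congruence
  open Families
  open import Algebra.Properties.AbelianGroup ℤ.+-0-abelianGroup using (∙-cancelʳ)
  open import Data.Integer.Divisibility.Signed
  open import Data.Unit.Base using (tt)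
  open import Data.Vec.Base using ([]; _∷_)
  open import Function.Base using (case_of_)

  Solvable : ℤ → ℤ → ℤ → ℕ → Set
  Solvable a b c n = ∃[ x ] ∃[ y ] ∃[ z ] f a b c x y z ≡ + n

  Div± : ℤ → ℤ → ℤ → Set
  Div± k L d = (k ∣ L - d) ⊎ (k ∣ L + d)

  div± : ∀ {n} → ℕ → Expr n → ℤ → Formula n
  div± k L d = k ∣′ L ⊖ con d ∨′ k ∣′ L ⊕ con d

  square-of : ∀ k d L → Div± (k * d) L d → ∃[ x ] L * L ≡ d * d * ((k * x + 1ℤ) * (k * x + 1ℤ))
  square-of k d L (inj₁ (divides q eq)) = q , trans (cong (λ t → t * t) L≡) (lem₂ k d q)
    where
    lem₁ : ∀ L d → L ≡ L - d + d
    lem₁ = solve-∀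
    L≡ : L ≡ q * (k * d) + d
    L≡ = trans (lem₁ L d) (cong (_+ d) eq)
    lem₂ : ∀ k d q → (q * (k * d) + d) * (q * (k * d) + d) ≡ d * d * ((k * q + 1ℤ) * (k * q + 1ℤ))
    lem₂ = solve-∀
  square-of k d L (inj₂ (divides q eq)) = - q , trans (cong (λ t → t * t) L≡) (lem₂ k d q)
    where
    lem₁ : ∀ L d → L ≡ L + d - d
    lem₁ = solve-∀
    L≡ : L ≡ q * (k * d) - d
    L≡ = trans (lem₁ L d) (cong (_- d) eq)
    lem₂ : ∀ k d q → (q * (k * d) - d) * (q * (k * d) - d) ≡ d * d * ((k * - q + 1ℤ) * (k * - q + 1ℤ))
    lem₂ = solve-∀

  affine : ∀ a b n → + (a ℕ.+ b ℕ.* n) ≡ + a + + b * + n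
  affine a b n = cong (λ t → + a + t) (ℤ.pos-* b n)

  ∣S-a : ∀ {S} a b n → S ≡ + (a ℕ.+ b ℕ.* n) → + b ∣ S - + a
  ∣S-a {S} a b n eq = divides (+ n) (trans (cong (_- + a) (trans eq (affine a b n))) (lem (+ a) (+ b) (+ n)))
    where lem : ∀ a b n → a + b * n - a ≡ n * b
          lem = solve-∀

  -∣ : ∀ {k x} → k ∣ x → k ∣ 0ℤ - x
  -∣ {k} {x} d = ∣-resp (lem x) (∣m⇒∣-m d)
    where lem : ∀ x → - x ≡ 0ℤ - x
          lem = solve-∀

  neg : ∀ {n} → Expr n → Expr n
  neg e = con 0ℤ ⊖ e

  sumSq : ∀ {n} → Expr n → Expr n → Expr n → Expr n
  sumSq p q r = p ⊗ p ⊕ q ⊗ q ⊕ r ⊗ r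

  Σ² : ℤ → ℤ → ℤ → ℤ
  Σ² p q r = p * p + q * q + r * r

  swap-q : ∀ p q r {N} → Σ² p q r ≡ N → Σ² p (0ℤ - q) r ≡ N
  swap-q p q r eq = trans (lem p q r) eq
    where lem : ∀ p q r → p * p + (0ℤ - q) * (0ℤ - q) + r * r ≡ p * p + q * q + r * r
          lem = solve-∀

  swap-r : ∀ p q r {N} → Σ² p q r ≡ N → Σ² p q (0ℤ - r) ≡ N
  swap-r p q r eq = trans (lem p q r) eq
    where lem : ∀ p q r → p * p + q * q + (0ℤ - r) * (0ℤ - r) ≡ p * p + q * q + r * r
          lem = solve-∀

  rotate : ∀ p q r {N} → Σ² p q r ≡ N → Σ² q r p ≡ N
  rotate p q r eq = trans (lem p q r) eq
    where lem : ∀ p q r → q * q + r * r + p * p ≡ p * p + q * q + r * r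
          lem = solve-∀

  exchange : ∀ p q r {N} → Σ² p q r ≡ N → Σ² p r q ≡ N
  exchange p q r eq = trans (lem p q r) eq
    where lem : ∀ p q r → p * p + r * r + q * q ≡ p * p + q * q + r * r
          lem = solve-∀

  term-square : ∀ a d W C L x → W * (d * d) * (+ 4 * a) ≡ C → L * L ≡ d * d * ((+ 2 * a * x + 1ℤ) * (+ 2 * a * x + 1ℤ)) →
                W * (L * L) ≡ C * (x * (a * x + 1ℤ)) + W * (d * d)
  term-square a d W C L x eq L² = trans (cong (W *_) L²) (trans (lem a d W x) (cong (λ t → t * (x * (a * x + 1ℤ)) + W * (d * d)) eq))
    where lem : ∀ a d W x → W * (d * d * ((+ 2 * a * x + 1ℤ) * (+ 2 * a * x + 1ℤ))) ≡ W * (d * d) * (+ 4 * a) * (x * (a * x + 1ℤ)) + W * (d * d)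
          lem = solve-∀

  -- 4a x (a x + 1) + 1 = (2a x + 1)², and L is ± d (2a x + 1) when 2ad divides L ∓ d.
  complete-squares : ∀ a b c d₁ d₂ d₃ W₁ W₂ W₃ C .{{_ : ℤ.NonZero C}} →
    W₁ * (d₁ * d₁) * (+ 4 * a) ≡ C → W₂ * (d₂ * d₂) * (+ 4 * b) ≡ C → W₃ * (d₃ * d₃) * (+ 4 * c) ≡ C →
    ∀ L₁ L₂ L₃ n → Div± (+ 2 * a * d₁) L₁ d₁ → Div± (+ 2 * b * d₂) L₂ d₂ → Div± (+ 2 * c * d₃) L₃ d₃ →
    W₁ * (L₁ * L₁) + W₂ * (L₂ * L₂) + W₃ * (L₃ * L₃) ≡ C * + n + (W₁ * (d₁ * d₁) + W₂ * (d₂ * d₂) + W₃ * (d₃ * d₃)) →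
    Solvable a b c n
  complete-squares a b c d₁ d₂ d₃ W₁ W₂ W₃ C e₁ e₂ e₃ L₁ L₂ L₃ n D₁ D₂ D₃ eq =
    finish (square-of (+ 2 * a) d₁ L₁ D₁) (square-of (+ 2 * b) d₂ L₂ D₂) (square-of (+ 2 * c) d₃ L₃ D₃)
    where
    Square : ℤ → ℤ → ℤ → Set
    Square a d L = ∃[ x ] L * L ≡ d * d * ((+ 2 * a * x + 1ℤ) * (+ 2 * a * x + 1ℤ))
    finish : Square a d₁ L₁ → Square b d₂ L₂ → Square c d₃ L₃ → Solvable a b c n
    finish (x , p) (y , q) (z , r) = x , y , z , ℤ.*-cancelˡ-≡ C _ _ (∙-cancelʳ K _ _ (begin
      C * f a b c x y z + K                                                                 ≡⟨ lem C (x * (a * x + 1ℤ)) (y * (b * y + 1ℤ)) (z * (c * z + 1ℤ)) (W₁ * (d₁ * d₁)) (W₂ * (d₂ * d₂)) (W₃ * (d₃ * d₃)) ⟩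
      (C * (x * (a * x + 1ℤ)) + W₁ * (d₁ * d₁)) + (C * (y * (b * y + 1ℤ)) + W₂ * (d₂ * d₂)) +
        (C * (z * (c * z + 1ℤ)) + W₃ * (d₃ * d₃))                                           ≡⟨ sym (cong₂ _+_ (cong₂ _+_ (term-square a d₁ W₁ C L₁ x e₁ p) (term-square b d₂ W₂ C L₂ y e₂ q)) (term-square c d₃ W₃ C L₃ z e₃ r)) ⟩
      W₁ * (L₁ * L₁) + W₂ * (L₂ * L₂) + W₃ * (L₃ * L₃)                                      ≡⟨ eq ⟩
      C * + n + K                                                                           ∎))
      where
      open ≡-Reasoning
      K = W₁ * (d₁ * d₁) + W₂ * (d₂ * d₂) + W₃ * (d₃ * d₃)
      lem : ∀ C x y z u v w → C * (x + y + z) + (u + v + w) ≡ (C * x + u) + (C * y + v) + (C * z + w)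
      lem = solve-∀

  -- Doubling a² + b² + 3c² = 24n + 7 gives (a + b)² + (a - b)² + 6c² = 48n + 14, to be matched with
  -- 4(6y + 1)² + 4(6z + 1)² + 6(4x + 1)².
  solvable-233 : ∀ n → Solvable (+ 2) (+ 3) (+ 3) n
  solvable-233 n = conclude (two-squares-plus-three n)
    where
    conclude : (∃[ a ] ∃[ b ] ∃[ c ] a * a + b * b + + 3 * (c * c) ≡ + (7 ℕ.+ 24 ℕ.* n)) → Solvable (+ 2) (+ 3) (+ 3) n
    conclude (a , b , c , eq) = complete-squares (+ 2) (+ 3) (+ 3) (+ 1) (+ 2) (+ 2) (+ 6) (+ 1) (+ 1) (+ 48) refl refl refl
        c (a + b) (a - b) n (proj₂ (proj₂ conditions)) (proj₁ conditions) (proj₁ (proj₂ conditions))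
        (trans (lem a b c) (trans (cong (+ 2 *_) (trans eq (affine 7 24 n))) (lem₂ (+ n))))
      where
      conditions : Div± (+ 12) (a + b) (+ 2) × Div± (+ 12) (a - b) (+ 2) × Div± (+ 4) c (+ 1)
      conditions = by-residues 24 (24 ∣′ x₀ ⊗ x₀ ⊕ x₁ ⊗ x₁ ⊕ con (+ 3) ⊗ (x₂ ⊗ x₂) ⊖ con (+ 7) ⇒′
        div± 12 (x₀ ⊕ x₁) (+ 2) ∧′ div± 12 (x₀ ⊖ x₁) (+ 2) ∧′ div± 4 x₂ (+ 1)) tt (a ∷ b ∷ c ∷ []) (∣S-a 7 24 n eq)
      lem : ∀ a b c → + 6 * (c * c) + + 1 * ((a + b) * (a + b)) + + 1 * ((a - b) * (a - b)) ≡ + 2 * (a * a + b * b + + 3 * (c * c))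
      lem = solve-∀
      lem₂ : ∀ n → + 2 * (+ 7 + + 24 * n) ≡ + 48 * n + + 14
      lem₂ = solve-∀

  Condition₂₂₄ : ℤ → ℤ → ℤ → Set
  Condition₂₂₄ p q r = Div± (+ 8) (p + q) (+ 2) × Div± (+ 8) (p - q) (+ 2) × Div± (+ 8) r (+ 1)

  finish-224 : ∀ n p q r → Condition₂₂₄ p q r → Σ² p q r ≡ + (5 ℕ.+ 16 ℕ.* n) → Solvable (+ 2) (+ 2) (+ 4) n
  finish-224 n p q r (d₁ , d₂ , d₃) eq = complete-squares (+ 2) (+ 2) (+ 4) (+ 2) (+ 2) (+ 1) (+ 1) (+ 1) (+ 2) (+ 32) refl refl refl
      (p + q) (p - q) r n d₁ d₂ d₃ (trans (lem p q r) (trans (cong (+ 2 *_) (trans eq (affine 5 16 n))) (lem₂ (+ n))))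
    where
    lem : ∀ p q r → + 1 * ((p + q) * (p + q)) + + 1 * ((p - q) * (p - q)) + + 2 * (r * r) ≡ + 2 * (p * p + q * q + r * r)
    lem = solve-∀
    lem₂ : ∀ n → + 2 * (+ 5 + + 16 * n) ≡ + 32 * n + + 10
    lem₂ = solve-∀

  solvable-224 : ∀ n → Solvable (+ 2) (+ 2) (+ 4) n
  solvable-224 n = conclude (subst SumOfThreeSquares (lem n) (three-squares-1mod4 (1 ℕ.+ 4 ℕ.* n)))
    where
    lem : ∀ n → 1 ℕ.+ 4 ℕ.* (1 ℕ.+ 4 ℕ.* n) ≡ 5 ℕ.+ 16 ℕ.* n
    lem = ℕ.solve-∀
    condition : ∀ {k} → Expr k → Expr k → Expr k → Formula k
    condition p q r = div± 8 (p ⊕ q) (+ 2) ∧′ div± 8 (p ⊖ q) (+ 2) ∧′ div± 8 r (+ 1)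
    arrange : ∀ p q r → + 16 ∣ Σ² p q r - + 5 → Condition₂₂₄ p q r ⊎ Condition₂₂₄ q r p ⊎ Condition₂₂₄ p r q
    arrange p q r = by-residues 16 (16 ∣′ sumSq x₀ x₁ x₂ ⊖ con (+ 5) ⇒′ condition x₀ x₁ x₂ ∨′ condition x₁ x₂ x₀ ∨′ condition x₀ x₂ x₁)
      tt (p ∷ q ∷ r ∷ [])
    conclude : SumOfThreeSquares (5 ℕ.+ 16 ℕ.* n) → Solvable (+ 2) (+ 2) (+ 4) n
    conclude (p , q , r , eq) = case arrange p q r (∣S-a 5 16 n eq) of λ where
      (inj₁ c)        → finish-224 n p q r c eq
      (inj₂ (inj₁ c)) → finish-224 n q r p c (rotate p q r eq)
      (inj₂ (inj₂ c)) → finish-224 n p r q c (exchange p q r eq)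

  Condition₁₂₄ : ℤ → ℤ → ℤ → Set
  Condition₁₂₄ p q r = Div± (+ 8) (p - q) (+ 4) × Div± (+ 8) r (+ 2) × Div± (+ 16) (p + q) (+ 2)

  finish-124 : ∀ n p q r → Condition₁₂₄ p q r → Σ² p q r ≡ + (14 ℕ.+ 32 ℕ.* n) → Solvable (+ 1) (+ 2) (+ 4) n
  finish-124 n p q r (d₁ , d₂ , d₃) eq = complete-squares (+ 1) (+ 2) (+ 4) (+ 4) (+ 2) (+ 2) (+ 1) (+ 2) (+ 1) (+ 64) refl refl refl
      (p - q) r (p + q) n d₁ d₂ d₃ (trans (lem p q r) (trans (cong (+ 2 *_) (trans eq (affine 14 32 n))) (lem₂ (+ n))))
    where
    lem : ∀ p q r → + 1 * ((p - q) * (p - q)) + + 2 * (r * r) + + 1 * ((p + q) * (p + q)) ≡ + 2 * (p * p + q * q + r * r)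
    lem = solve-∀
    lem₂ : ∀ n → + 2 * (+ 14 + + 32 * n) ≡ + 64 * n + + 28
    lem₂ = solve-∀

  -- As 32n + 14 ≡ 2 modulo 4, exactly one entry is even; it becomes r, and a sign makes 4 divide p
  -- - q. The value modulo 32 then forces r ≡ ±2 and p - q ≡ 4 modulo 8, and p + q ≡ ±2 modulo 16.
  solvable-124 : ∀ n → Solvable (+ 1) (+ 2) (+ 4) n
  solvable-124 n = conclude (subst SumOfThreeSquares (lem n) (three-squares-2mod4 (3 ℕ.+ 8 ℕ.* n)))
    where
    lem : ∀ n → 2 ℕ.+ 4 ℕ.* (3 ℕ.+ 8 ℕ.* n) ≡ 14 ℕ.+ 32 ℕ.* n
    lem = ℕ.solve-∀
    condition : ∀ {k} → Expr k → Expr k → Expr k → Formula k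
    condition p q r = div± 8 (p ⊖ q) (+ 4) ∧′ div± 8 r (+ 2) ∧′ div± 16 (p ⊕ q) (+ 2)
    Signed : ℤ → ℤ → ℤ → Set
    Signed p q r = Condition₁₂₄ p q r ⊎ Condition₁₂₄ p (0ℤ - q) r
    signed : ∀ {k} → Expr k → Expr k → Expr k → Formula k
    signed p q r = condition p q r ∨′ condition p (neg q) r
    arrange : ∀ p q r → + 32 ∣ Σ² p q r - + 14 → Signed p q r ⊎ Signed q r p ⊎ Signed p r q
    arrange p q r = by-residues 32 (32 ∣′ sumSq x₀ x₁ x₂ ⊖ con (+ 14) ⇒′ signed x₀ x₁ x₂ ∨′ signed x₁ x₂ x₀ ∨′ signed x₀ x₂ x₁)
      tt (p ∷ q ∷ r ∷ [])
    finish : ∀ p q r → Signed p q r → Σ² p q r ≡ + (14 ℕ.+ 32 ℕ.* n) → Solvable (+ 1) (+ 2) (+ 4) n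
    finish p q r (inj₁ c) eq = finish-124 n p q r c eq
    finish p q r (inj₂ c) eq = finish-124 n p (0ℤ - q) r c (swap-q p q r eq)
    conclude : SumOfThreeSquares (14 ℕ.+ 32 ℕ.* n) → Solvable (+ 1) (+ 2) (+ 4) n
    conclude (p , q , r , eq) = case arrange p q r (∣S-a 14 32 n eq) of λ where
      (inj₁ c)        → finish p q r c eq
      (inj₂ (inj₁ c)) → finish q r p c (rotate p q r eq)
      (inj₂ (inj₂ c)) → finish p r q c (exchange p q r eq)

  -- The linear forms come from the orthogonal vectors (1, 1, -2), (1, 1, 1), (1, -1, 0) of squared
  -- lengths 6, 3, 2; with weights 1, 2, 3 their squares add up to 6 (p² + q² + r²).
  Condition₁₂₃ : ℤ → ℤ → ℤ → Set
  Condition₁₂₃ p q r = Div± (+ 12) (p + q - + 2 * r) (+ 6) × Div± (+ 12) (p + q + r) (+ 3) × Div± (+ 12) (p - q) (+ 2)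

  finish-123 : ∀ n p q r → Condition₁₂₃ p q r → Σ² p q r ≡ + (11 ℕ.+ 24 ℕ.* n) → Solvable (+ 1) (+ 2) (+ 3) n
  finish-123 n p q r (d₁ , d₂ , d₃) eq = complete-squares (+ 1) (+ 2) (+ 3) (+ 6) (+ 3) (+ 2) (+ 1) (+ 2) (+ 3) (+ 144) refl refl refl
      (p + q - + 2 * r) (p + q + r) (p - q) n d₁ d₂ d₃ (trans (lem p q r) (trans (cong (+ 6 *_) (trans eq (affine 11 24 n))) (lem₂ (+ n))))
    where
    lem : ∀ p q r → + 1 * ((p + q - + 2 * r) * (p + q - + 2 * r)) + + 2 * ((p + q + r) * (p + q + r)) + + 3 * ((p - q) * (p - q)) ≡
                    + 6 * (p * p + q * q + r * r)
    lem = solve-∀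
    lem₂ : ∀ n → + 6 * (+ 11 + + 24 * n) ≡ + 144 * n + + 66
    lem₂ = solve-∀

  -- All entries are odd and exactly one is divisible by 3, as 24n + 11 is 3 modulo 8 and 2 modulo
  -- 3. The conditions then come down to 4 ∣ p + q, 3 ∣ p + q + r and 3 ∤ p - q, which signs and
  -- order achieve.
  solvable-123 : ∀ n → Solvable (+ 1) (+ 2) (+ 3) n
  solvable-123 n = conclude (subst SumOfThreeSquares (lem n) (three-squares-3mod8 (1 ℕ.+ 3 ℕ.* n)))
    where
    lem : ∀ n → 3 ℕ.+ 8 ℕ.* (1 ℕ.+ 3 ℕ.* n) ≡ 11 ℕ.+ 24 ℕ.* n
    lem = ℕ.solve-∀
    condition : ∀ {k} → Expr k → Expr k → Expr k → Formula k
    condition p q r = div± 12 (p ⊕ q ⊖ con (+ 2) ⊗ r) (+ 6) ∧′ div± 12 (p ⊕ q ⊕ r) (+ 3) ∧′ div± 12 (p ⊖ q) (+ 2)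
    Signed : ℤ → ℤ → ℤ → Set
    Signed p q r = Condition₁₂₃ p q r ⊎ Condition₁₂₃ p (0ℤ - q) r ⊎ Condition₁₂₃ p q (0ℤ - r) ⊎ Condition₁₂₃ p (0ℤ - q) (0ℤ - r)
    signed : ∀ {k} → Expr k → Expr k → Expr k → Formula k
    signed p q r = condition p q r ∨′ condition p (neg q) r ∨′ condition p q (neg r) ∨′ condition p (neg q) (neg r)
    arrange : ∀ p q r → + 24 ∣ Σ² p q r - + 11 → Signed p q r ⊎ Signed q r p ⊎ Signed p r q
    arrange p q r = by-residues 24 (24 ∣′ sumSq x₀ x₁ x₂ ⊖ con (+ 11) ⇒′ signed x₀ x₁ x₂ ∨′ signed x₁ x₂ x₀ ∨′ signed x₀ x₂ x₁)
      tt (p ∷ q ∷ r ∷ [])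
    finish : ∀ p q r → Signed p q r → Σ² p q r ≡ + (11 ℕ.+ 24 ℕ.* n) → Solvable (+ 1) (+ 2) (+ 3) n
    finish p q r (inj₁ c) eq = finish-123 n p q r c eq
    finish p q r (inj₂ (inj₁ c)) eq = finish-123 n p (0ℤ - q) r c (swap-q p q r eq)
    finish p q r (inj₂ (inj₂ (inj₁ c))) eq = finish-123 n p q (0ℤ - r) c (swap-r p q r eq)
    finish p q r (inj₂ (inj₂ (inj₂ c))) eq = finish-123 n p (0ℤ - q) (0ℤ - r) c (swap-r p (0ℤ - q) r (swap-q p q r eq))
    conclude : SumOfThreeSquares (11 ℕ.+ 24 ℕ.* n) → Solvable (+ 1) (+ 2) (+ 3) n
    conclude (p , q , r , eq) = case arrange p q r (∣S-a 11 24 n eq) of λ where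
      (inj₁ c)        → finish p q r c eq
      (inj₂ (inj₁ c)) → finish q r p c (rotate p q r eq)
      (inj₂ (inj₂ c)) → finish p r q c (exchange p q r eq)

-- The triples (2,2,5), (1,2,5) and (2,3,4).

module Descent where

  open Folding using (∣-resp; pos-∣)
  open Congruence
  open Families using (SumOfThreeSquares; three-squares-2mod4; skew-form)
  open Triples
  open import Data.Nat.Induction using (<-rec)
  open import Data.Integer.Divisibility.Signed
  open import Data.Unit.Base using (tt)
  open import Data.Vec.Base using ([]; _∷_)
  open import Function.Base using (case_of_)
  open import Relation.Nullary.Decidable using (from-no; from-yes; _×-dec_)

  -- If (x , y) represents n by x² + d y² then multiplication by the two elements A ± B √-d of norm ℓ²
  -- gives representations of ℓ² n, at least one of which is primitive at ℓ when (x , y) is.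
  module Primitive (ℓ : ℕ) (1<ℓ : 1 ℕ.< ℓ) (d A B : ℤ) (norm : A * A + d * (B * B) ≡ + ℓ * + ℓ)
    (independent : ∀ x y → + ℓ ∣ A * x - d * (B * y) → + ℓ ∣ B * x + A * y →
                           + ℓ ∣ A * x + d * (B * y) → + ℓ ∣ A * y - B * x → (+ ℓ ∣ x) × (+ ℓ ∣ y)) where

    Norm : ℤ → ℤ → ℤ
    Norm x y = x * x + d * (y * y)

    Result : ℤ → Set
    Result n = ∃[ x ] ∃[ y ] Norm x y ≡ n × ¬ ((+ ℓ ∣ x) × (+ ℓ ∣ y))

    ascend : ∀ {n} → Result n → Result (n * (+ ℓ * + ℓ))
    ascend {n} (x , y , eq , not-both) = by-cases ((+ ℓ ∣? A * x - d * (B * y)) ×-dec (+ ℓ ∣? B * x + A * y))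
      where
      lem₁ : ∀ d A B x y → (A * x - d * (B * y)) * (A * x - d * (B * y)) + d * ((B * x + A * y) * (B * x + A * y)) ≡
                           (x * x + d * (y * y)) * (A * A + d * (B * B))
      lem₁ = solve-∀
      lem₂ : ∀ d A B x y → (A * x + d * (B * y)) * (A * x + d * (B * y)) + d * ((A * y - B * x) * (A * y - B * x)) ≡
                           (x * x + d * (y * y)) * (A * A + d * (B * B))
      lem₂ = solve-∀
      by-cases : Dec ((+ ℓ ∣ A * x - d * (B * y)) × (+ ℓ ∣ B * x + A * y)) → Result (n * (+ ℓ * + ℓ))
      by-cases (no ¬both) = A * x - d * (B * y) , B * x + A * y , trans (lem₁ d A B x y) (cong₂ _*_ eq norm) , ¬both
      by-cases (yes (p , q)) = A * x + d * (B * y) , A * y - B * x , trans (lem₂ d A B x y) (cong₂ _*_ eq norm) ,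
        λ (r , s) → not-both (independent x y p q r s)

    Nonzero : ℤ → ℤ → Set
    Nonzero x y = ¬ (x ≡ 0ℤ × y ≡ 0ℤ)

    size : ℤ → ℤ → ℕ
    size x y = ℤ.∣ x ∣ ℕ.+ ℤ.∣ y ∣

    size-scaled : ∀ x y → size (x * + ℓ) (y * + ℓ) ≡ size x y ℕ.* ℓ
    size-scaled x y = trans (cong₂ ℕ._+_ (ℤ.abs-* x (+ ℓ)) (ℤ.abs-* y (+ ℓ))) (sym (ℕ.*-distribʳ-+ ℓ ℤ.∣ x ∣ ℤ.∣ y ∣))

    size-decreases : ∀ x y → Nonzero x y → size x y ℕ.< size (x * + ℓ) (y * + ℓ)
    size-decreases x y nz = subst (size x y ℕ.<_) (sym (size-scaled x y)) (ℕ.m<m*n (size x y) ℓ {{ℕ.≢-nonZero size≢0}} 1<ℓ)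
      where
      size≢0 : size x y ≢ 0
      size≢0 eq = nz (ℤ.∣i∣≡0⇒i≡0 (ℕ.m+n≡0⇒m≡0 ℤ.∣ x ∣ eq) , ℤ.∣i∣≡0⇒i≡0 (ℕ.m+n≡0⇒n≡0 ℤ.∣ x ∣ eq))

    -- Common factors ℓ are divided out by descent on the size, and each lost factor ℓ² of the norm
    -- is restored by `ascend`, which preserves primitivity.
    primitive-representation : ∀ x y → Nonzero x y → Result (Norm x y)
    primitive-representation x y = <-rec _ step (size x y) x y refl
      where
      P : ℕ → Set
      P k = ∀ x y → size x y ≡ k → Nonzero x y → Result (Norm x y)
      step : ∀ k → (∀ {k′} → k′ ℕ.< k → P k′) → P k
      step k rec x y size≡ nz = by-cases ((+ ℓ ∣? x) ×-dec (+ ℓ ∣? y))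
        where
        lem : ∀ d l u v → (u * u + d * (v * v)) * (l * l) ≡ u * l * (u * l) + d * (v * l * (v * l))
        lem = solve-∀
        by-cases : Dec ((+ ℓ ∣ x) × (+ ℓ ∣ y)) → Result (Norm x y)
        by-cases (no ¬both) = x , y , refl , ¬both
        by-cases (yes (divides u x≡ , divides v y≡)) = subst Result
            (trans (lem d (+ ℓ) u v) (cong₂ (λ s t → s * s + d * (t * t)) (sym x≡) (sym y≡)))
            (ascend (rec (subst (size u v ℕ.<_) (trans (sym (cong₂ size x≡ y≡)) size≡) (size-decreases u v nz′)) u v refl nz′))
          where
          nz′ : Nonzero u v
          nz′ (u≡0 , v≡0) = nz (trans x≡ (cong (_* + ℓ) u≡0) , trans y≡ (cong (_* + ℓ) v≡0))

  zero-square : ∀ {p q} r → p ≡ 0ℤ → q ≡ 0ℤ → Σ² p q r ≡ r * r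
  zero-square r refl refl = lem r
    where lem : ∀ r → 0ℤ * 0ℤ + 0ℤ * 0ℤ + r * r ≡ r * r
          lem = solve-∀

  -- Multiplication of p + q i by 3 + i, of norm 10, yields the first two linear forms.
  Condition₂₂₅ : ℤ → ℤ → ℤ → Set
  Condition₂₂₅ p q r = Div± (+ 20) (+ 3 * p - q) (+ 5) × Div± (+ 20) (p + + 3 * q) (+ 5) × Div± (+ 10) r (+ 1)

  finish-225 : ∀ n p q r → Condition₂₂₅ p q r → Σ² p q r ≡ + (6 ℕ.+ 20 ℕ.* n) → Solvable (+ 2) (+ 2) (+ 5) n
  finish-225 n p q r (d₁ , d₂ , d₃) eq = complete-squares (+ 2) (+ 2) (+ 5) (+ 5) (+ 5) (+ 1) (+ 1) (+ 1) (+ 10) (+ 200) refl refl refl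
      (+ 3 * p - q) (p + + 3 * q) r n d₁ d₂ d₃ (trans (lem p q r) (trans (cong (+ 10 *_) (trans eq (affine 6 20 n))) (lem₂ (+ n))))
    where
    lem : ∀ p q r → + 1 * ((+ 3 * p - q) * (+ 3 * p - q)) + + 1 * ((p + + 3 * q) * (p + + 3 * q)) + + 10 * (r * r) ≡
                    + 10 * (p * p + q * q + r * r)
    lem = solve-∀
    lem₂ : ∀ n → + 10 * (+ 6 + + 20 * n) ≡ + 200 * n + + 60
    lem₂ = solve-∀

  -- The multiplier is 3 + 4i = (2 + i)², of norm 25.
  module Fives = Primitive 5 (s≤s (s≤s z≤n)) (+ 1) (+ 3) (+ 4) refl
    (λ x y → by-residues 5 (5 ∣′ con (+ 3) ⊗ x₀ ⊖ con (+ 1) ⊗ (con (+ 4) ⊗ x₁) ⇒′ 5 ∣′ con (+ 4) ⊗ x₀ ⊕ con (+ 3) ⊗ x₁ ⇒′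
      5 ∣′ con (+ 3) ⊗ x₀ ⊕ con (+ 1) ⊗ (con (+ 4) ⊗ x₁) ⇒′ 5 ∣′ con (+ 3) ⊗ x₁ ⊖ con (+ 4) ⊗ x₀ ⇒′ 5 ∣′ x₀ ∧′ 5 ∣′ x₁) tt (x ∷ y ∷ []))

  -- The condition can fail only if two entries are divisible by 5. Their sum of squares is then
  -- rewritten with a pair that is not; it stays 0 modulo 5, which makes the condition hold. The
  -- pair is not (0, 0), as r² = 20n + 6 is impossible modulo 4.
  solvable-225 : ∀ n → Solvable (+ 2) (+ 2) (+ 5) n
  solvable-225 n = conclude (subst SumOfThreeSquares (lem n) (three-squares-2mod4 (1 ℕ.+ 5 ℕ.* n)))
    where
    lem : ∀ n → 2 ℕ.+ 4 ℕ.* (1 ℕ.+ 5 ℕ.* n) ≡ 6 ℕ.+ 20 ℕ.* n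
    lem = ℕ.solve-∀
    N : ℤ
    N = + (6 ℕ.+ 20 ℕ.* n)
    condition signed : ∀ {k} → Expr k → Expr k → Expr k → Formula k
    condition p q r = div± 20 (con (+ 3) ⊗ p ⊖ q) (+ 5) ∧′ div± 20 (p ⊕ con (+ 3) ⊗ q) (+ 5) ∧′ div± 10 r (+ 1)
    signed p q r = condition p q r ∨′ condition p (neg q) r
    Signed : ℤ → ℤ → ℤ → Set
    Signed p q r = Condition₂₂₅ p q r ⊎ Condition₂₂₅ p (0ℤ - q) r
    Arranged : ℤ → ℤ → ℤ → Set
    Arranged p q r = Signed p q r ⊎ Signed q r p ⊎ Signed p r q
    arranged : Formula 3
    arranged = signed x₀ x₁ x₂ ∨′ signed x₁ x₂ x₀ ∨′ signed x₀ x₂ x₁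
    arrange : ∀ p q r → + 20 ∣ Σ² p q r - + 6 →
              ((+ 5 ∣ p) × (+ 5 ∣ q)) ⊎ ((+ 5 ∣ q) × (+ 5 ∣ r)) ⊎ ((+ 5 ∣ p) × (+ 5 ∣ r)) ⊎ Arranged p q r
    arrange p q r = by-residues 20 (20 ∣′ sumSq x₀ x₁ x₂ ⊖ con (+ 6) ⇒′
      (5 ∣′ x₀ ∧′ 5 ∣′ x₁) ∨′ (5 ∣′ x₁ ∧′ 5 ∣′ x₂) ∨′ (5 ∣′ x₀ ∧′ 5 ∣′ x₂) ∨′ arranged) tt (p ∷ q ∷ r ∷ [])
    arrange-primitive : ∀ p q r → + 20 ∣ Σ² p q r - + 6 → + 5 ∣ p * p + + 1 * (q * q) → ((+ 5 ∣ p) × (+ 5 ∣ q) → + 5 ∣ + 1) → Arranged p q r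
    arrange-primitive p q r = by-residues 20 (20 ∣′ sumSq x₀ x₁ x₂ ⊖ con (+ 6) ⇒′ 5 ∣′ x₀ ⊗ x₀ ⊕ con (+ 1) ⊗ (x₁ ⊗ x₁) ⇒′
      (5 ∣′ x₀ ∧′ 5 ∣′ x₁ ⇒′ 5 ∣′ con (+ 1)) ⇒′ arranged) tt (p ∷ q ∷ r ∷ [])
    finish-signed : ∀ p q r → Signed p q r → Σ² p q r ≡ N → Solvable (+ 2) (+ 2) (+ 5) n
    finish-signed p q r (inj₁ c) eq = finish-225 n p q r c eq
    finish-signed p q r (inj₂ c) eq = finish-225 n p (0ℤ - q) r c (swap-q p q r eq)
    finish : ∀ p q r → Arranged p q r → Σ² p q r ≡ N → Solvable (+ 2) (+ 2) (+ 5) n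
    finish p q r (inj₁ c) eq = finish-signed p q r c eq
    finish p q r (inj₂ (inj₁ c)) eq = finish-signed q r p c (rotate p q r eq)
    finish p q r (inj₂ (inj₂ c)) eq = finish-signed p r q c (exchange p q r eq)
    nonsquare : ∀ r → ¬ + 4 ∣ r * r - + 6
    nonsquare r d = from-no (4 ℕ.∣? 1) (∣⇒∣ᵤ (by-residues 4 (4 ∣′ x₀ ⊗ x₀ ⊖ con (+ 6) ⇒′ 4 ∣′ con (+ 1)) tt (r ∷ []) d))
    rotated : ∀ p q r → Σ² p q r ≡ N → + 5 ∣ p → + 5 ∣ q → Solvable (+ 2) (+ 2) (+ 5) n
    rotated p q r eq 5∣p 5∣q = continue (Fives.primitive-representation p q nonzero)
      where
      nonzero : Fives.Nonzero p q
      nonzero (p≡0 , q≡0) = nonsquare r (∣-resp (cong (_- + 6) (zero-square r p≡0 q≡0)) (∣-trans (pos-∣ (from-yes (4 ℕ.∣? 20))) (∣S-a 6 20 n eq)))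
      lem₁ : ∀ p q → p * p + q * q ≡ p * p + + 1 * (q * q)
      lem₁ = solve-∀
      continue : Fives.Result (Fives.Norm p q) → Solvable (+ 2) (+ 2) (+ 5) n
      continue (u , v , norm , not-both) = finish u v r
          (arrange-primitive u v r (∣S-a 6 20 n eq′)
            (∣-resp (sym norm) (∣m∣n⇒∣m+n (∣m⇒∣m*n p 5∣p) (∣n⇒∣m*n (+ 1) (∣m⇒∣m*n q 5∣q))))
            (λ both → contradiction both not-both)) eq′
        where
        eq′ : Σ² u v r ≡ N
        eq′ = trans (cong (_+ r * r) (trans (lem₁ u v) (trans norm (sym (lem₁ p q))))) eq
    conclude : SumOfThreeSquares (6 ℕ.+ 20 ℕ.* n) → Solvable (+ 2) (+ 2) (+ 5) n
    conclude (p , q , r , eq) = case arrange p q r (∣S-a 6 20 n eq) of λ where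
      (inj₁ (5∣p , 5∣q))               → rotated p q r eq 5∣p 5∣q
      (inj₂ (inj₁ (5∣q , 5∣r)))        → rotated q r p (rotate p q r eq) 5∣q 5∣r
      (inj₂ (inj₂ (inj₁ (5∣p , 5∣r)))) → rotated p r q (exchange p q r eq) 5∣p 5∣r
      (inj₂ (inj₂ (inj₂ c)))           → finish p q r c eq

  -- Twice the form is 2x² + (2y + z)² + 5z², and -2 is a nonresidue modulo 5, so x = 5u and 2y + z
  -- = 5w. Division by 5 gives 10u² + 5w² + z² = 80n + 34, where w ≡ z modulo 2.
  solvable-125 : ∀ n → Solvable (+ 1) (+ 2) (+ 5) n
  solvable-125 n = conclude (skew-form n)
    where
    multiples : ∀ x y z → + 5 ∣ x * x + + 2 * (y * y) + + 2 * (y * z) + + 3 * (z * z) → (+ 5 ∣ x) × (+ 5 ∣ + 2 * y + z)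
    multiples x y z = by-residues 5 (5 ∣′ x₀ ⊗ x₀ ⊕ con (+ 2) ⊗ (x₁ ⊗ x₁) ⊕ con (+ 2) ⊗ (x₁ ⊗ x₂) ⊕ con (+ 3) ⊗ (x₂ ⊗ x₂) ⇒′
      5 ∣′ x₀ ∧′ 5 ∣′ con (+ 2) ⊗ x₁ ⊕ x₂) tt (x ∷ y ∷ z ∷ [])
    form : Expr 3
    form = con (+ 10) ⊗ (x₀ ⊗ x₀) ⊕ con (+ 5) ⊗ (x₁ ⊗ x₁) ⊕ x₂ ⊗ x₂
    parities : ∀ x w z → + 16 ∣ + 10 * (x * x) + + 5 * (w * w) + z * z - + 34 → + 2 ∣ w - z →
               Div± (+ 4) w (+ 2) × Div± (+ 4) x (+ 1) × (+ 4 ∣ z - + 2)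
    parities x w z = by-residues 16 (16 ∣′ form ⊖ con (+ 34) ⇒′ 2 ∣′ x₁ ⊖ x₂ ⇒′
      div± 4 x₁ (+ 2) ∧′ div± 4 x₀ (+ 1) ∧′ 4 ∣′ x₂ ⊖ con (+ 2)) tt (x ∷ w ∷ z ∷ [])
    fives : ∀ x w z → + 5 ∣ + 10 * (x * x) + + 5 * (w * w) + z * z - + 34 → Div± (+ 5) z (+ 2)
    fives x w z = by-residues 5 (5 ∣′ form ⊖ con (+ 34) ⇒′ div± 5 x₂ (+ 2)) tt (x ∷ w ∷ z ∷ [])
    twenty : ∀ z → + 4 ∣ z - + 2 → Div± (+ 5) z (+ 2) → Div± (+ 20) z (+ 2)
    twenty z = by-residues 20 (4 ∣′ x₀ ⊖ con (+ 2) ⇒′ div± 5 x₀ (+ 2) ⇒′ div± 20 x₀ (+ 2)) tt (z ∷ [])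
    Goal : Set
    Goal = Solvable (+ 1) (+ 2) (+ 5) n
    finish : ∀ x w z → + 10 * (x * x) + + 5 * (w * w) + z * z ≡ + (34 ℕ.+ 80 ℕ.* n) → + 2 ∣ w - z → Goal
    finish x w z eq 2∣ = complete-squares (+ 1) (+ 2) (+ 5) (+ 2) (+ 1) (+ 2) (+ 5) (+ 10) (+ 1) (+ 80) refl refl refl
        w x z n (proj₁ halves) (proj₁ (proj₂ halves)) (twenty z (proj₂ (proj₂ halves)) (fives x w z (∣-trans (pos-∣ (from-yes (5 ℕ.∣? 80))) 80∣)))
        (trans (lem x w z) (trans (trans eq (affine 34 80 n)) (lem₂ (+ n))))
      where
      80∣ : + 80 ∣ + 10 * (x * x) + + 5 * (w * w) + z * z - + 34
      80∣ = ∣S-a 34 80 n eq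
      halves = parities x w z (∣-trans (pos-∣ (from-yes (16 ℕ.∣? 80))) 80∣) 2∣
      lem : ∀ x w z → + 5 * (w * w) + + 10 * (x * x) + + 1 * (z * z) ≡ + 10 * (x * x) + + 5 * (w * w) + z * z
      lem = solve-∀
      lem₂ : ∀ n → + 34 + + 80 * n ≡ + 80 * n + + 34
      lem₂ = solve-∀
    conclude : (∃[ x ] ∃[ y ] ∃[ z ] x * x + + 2 * (y * y) + + 2 * (y * z) + + 3 * (z * z) ≡ + (5 ℕ.* (17 ℕ.+ 40 ℕ.* n))) → Goal
    conclude (x , y , z , eq) = divide (multiples x y z (divides (+ (17 ℕ.+ 40 ℕ.* n)) (trans eq (trans (ℤ.pos-* 5 (17 ℕ.+ 40 ℕ.* n)) (ℤ.*-comm (+ 5) (+ (17 ℕ.+ 40 ℕ.* n)))))))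
      where
      divide : (+ 5 ∣ x) × (+ 5 ∣ + 2 * y + z) → Goal
      divide (divides u x≡ , divides w s≡) = finish u w z (ℤ.*-cancelˡ-≡ (+ 5) _ _ five-times) (divides (y - + 2 * w) (trans (lem₃ w y z) (trans (cong (λ t → (y - + 2 * w) * + 2 + (w * + 5 - t)) s≡) (lem₄ w y))))
        where
        lem₁ : ∀ u w z → + 5 * (+ 10 * (u * u) + + 5 * (w * w) + z * z) ≡ + 2 * (u * + 5 * (u * + 5)) + w * + 5 * (w * + 5) + + 5 * (z * z)
        lem₁ = solve-∀
        lem₂ : ∀ x y z → + 2 * (x * x) + (+ 2 * y + z) * (+ 2 * y + z) + + 5 * (z * z) ≡ + 2 * (x * x + + 2 * (y * y) + + 2 * (y * z) + + 3 * (z * z))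
        lem₂ = solve-∀
        lem₃ : ∀ w y z → w - z ≡ (y - + 2 * w) * + 2 + (w * + 5 - (+ 2 * y + z))
        lem₃ = solve-∀
        lem₄ : ∀ w y → (y - + 2 * w) * + 2 + (w * + 5 - w * + 5) ≡ (y - + 2 * w) * + 2
        lem₄ = solve-∀
        lem₅ : ∀ n → 2 ℕ.* (5 ℕ.* (17 ℕ.+ 40 ℕ.* n)) ≡ 5 ℕ.* (34 ℕ.+ 80 ℕ.* n)
        lem₅ = ℕ.solve-∀
        five-times : + 5 * (+ 10 * (u * u) + + 5 * (w * w) + z * z) ≡ + 5 * + (34 ℕ.+ 80 ℕ.* n)
        five-times = trans (lem₁ u w z) (trans (cong₂ (λ s t → + 2 * (s * s) + t * t + + 5 * (z * z)) (sym x≡) (sym s≡))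
          (trans (lem₂ x y z) (trans (cong (+ 2 *_) eq) (trans (sym (ℤ.pos-* 2 (5 ℕ.* (17 ℕ.+ 40 ℕ.* n)))) (trans (cong +_ (lem₅ n)) (ℤ.pos-* 5 (34 ℕ.+ 80 ℕ.* n)))))))

  -- The orthogonal frame of `Condition₁₂₃` again, the squared lengths 3, 2, 6 now belonging to the
  -- coefficients 2, 3, 4.
  Condition₂₃₄ : ℤ → ℤ → ℤ → Set
  Condition₂₃₄ p q r = Div± (+ 24) (p + q + r) (+ 6) × Div± (+ 24) (p - q) (+ 4) × Div± (+ 48) (p + q - + 2 * r) (+ 6)

  finish-234 : ∀ n p q r → Condition₂₃₄ p q r → Σ² p q r ≡ + (26 ℕ.+ 96 ℕ.* n) → Solvable (+ 2) (+ 3) (+ 4) n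
  finish-234 n p q r (d₁ , d₂ , d₃) eq = complete-squares (+ 2) (+ 3) (+ 4) (+ 6) (+ 4) (+ 6) (+ 2) (+ 3) (+ 1) (+ 576) refl refl refl
      (p + q + r) (p - q) (p + q - + 2 * r) n d₁ d₂ d₃ (trans (lem p q r) (trans (cong (+ 6 *_) (trans eq (affine 26 96 n))) (lem₂ (+ n))))
    where
    lem : ∀ p q r → + 2 * ((p + q + r) * (p + q + r)) + + 3 * ((p - q) * (p - q)) + + 1 * ((p + q - + 2 * r) * (p + q - + 2 * r)) ≡
                    + 6 * (p * p + q * q + r * r)
    lem = solve-∀
    lem₂ : ∀ n → + 6 * (+ 26 + + 96 * n) ≡ + 576 * n + + 156
    lem₂ = solve-∀

  -- The multiplier is 1 + 2√-2 = -(1 - √-2)², of norm 9.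
  module Threes = Primitive 3 (s≤s (s≤s z≤n)) (+ 2) (+ 1) (+ 2) refl
    (λ x y → by-residues 3 (3 ∣′ con (+ 1) ⊗ x₀ ⊖ con (+ 2) ⊗ (con (+ 2) ⊗ x₁) ⇒′ 3 ∣′ con (+ 2) ⊗ x₀ ⊕ con (+ 1) ⊗ x₁ ⇒′
      3 ∣′ con (+ 1) ⊗ x₀ ⊕ con (+ 2) ⊗ (con (+ 2) ⊗ x₁) ⇒′ 3 ∣′ con (+ 1) ⊗ x₁ ⊖ con (+ 2) ⊗ x₀ ⇒′ 3 ∣′ x₀ ∧′ 3 ∣′ x₁) tt (x ∷ y ∷ []))

  module Solve₂₃₄ (n : ℕ) where

    Goal : Set
    Goal = Solvable (+ 2) (+ 3) (+ 4) n

    Sum26 : ℤ → ℤ → ℤ → Set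
    Sum26 p q r = Σ² p q r ≡ + (26 ℕ.+ 96 ℕ.* n)

    weaken : ∀ {k p q r} → k ℕ.∣ 96 → Sum26 p q r → + k ∣ Σ² p q r - + 26
    weaken {p = p} {q} {r} k∣96 eq = ∣-trans (pos-∣ k∣96) (∣S-a {Σ² p q r} 26 96 n eq)

    two-adic : ∀ p q r → + 32 ∣ Σ² p q r - + 26 → + 2 ∣ r → + 4 ∣ p - q →
               Div± (+ 8) (p + q + r) (+ 6) × (+ 8 ∣ p - q - + 4) × Div± (+ 16) (p + q - + 2 * r) (+ 6)
    two-adic p q r = by-residues 32 (32 ∣′ sumSq x₀ x₁ x₂ ⊖ con (+ 26) ⇒′ 2 ∣′ x₂ ⇒′ 4 ∣′ x₀ ⊖ x₁ ⇒′
      div± 8 (x₀ ⊕ x₁ ⊕ x₂) (+ 6) ∧′ 8 ∣′ x₀ ⊖ x₁ ⊖ con (+ 4) ∧′ div± 16 (x₀ ⊕ x₁ ⊖ con (+ 2) ⊗ x₂) (+ 6)) tt (p ∷ q ∷ r ∷ [])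

    lift₂₄ : ∀ x → Div± (+ 8) x (+ 6) → + 3 ∣ x → Div± (+ 24) x (+ 6)
    lift₂₄ x = by-residues 24 (div± 8 x₀ (+ 6) ⇒′ 3 ∣′ x₀ ⇒′ div± 24 x₀ (+ 6)) tt (x ∷ [])

    lift₄₈ : ∀ x → Div± (+ 16) x (+ 6) → + 3 ∣ x → Div± (+ 48) x (+ 6)
    lift₄₈ x = by-residues 48 (div± 16 x₀ (+ 6) ⇒′ 3 ∣′ x₀ ⇒′ div± 48 x₀ (+ 6)) tt (x ∷ [])

    lift-unit : ∀ x → + 8 ∣ x - + 4 → (+ 3 ∣ x → + 3 ∣ + 1) → Div± (+ 24) x (+ 4)
    lift-unit x = by-residues 24 (8 ∣′ x₀ ⊖ con (+ 4) ⇒′ (3 ∣′ x₀ ⇒′ 3 ∣′ con (+ 1)) ⇒′ div± 24 x₀ (+ 4)) tt (x ∷ [])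

    suitable : ∀ p q r → Sum26 p q r → + 2 ∣ r → + 4 ∣ p - q → + 3 ∣ p + q + r → (+ 3 ∣ p - q → + 3 ∣ + 1) → Goal
    suitable p q r eq 2∣r 4∣ 3∣ 3∤ = finish-234 n p q r
        (lift₂₄ (p + q + r) (proj₁ adic) 3∣ , lift-unit (p - q) (proj₁ (proj₂ adic)) 3∤ ,
         lift₄₈ (p + q - + 2 * r) (proj₂ (proj₂ adic)) (∣-resp (lem p q r) (∣m∣n⇒∣m-n 3∣ (∣n⇒∣m*n r ∣-refl)))) eq
      where
      adic = two-adic p q r (weaken {p = p} {q} {r} (from-yes (32 ℕ.∣? 96)) eq) 2∣r 4∣
      lem : ∀ p q r → p + q + r - r * + 3 ≡ p + q - + 2 * r
      lem = solve-∀

    odd-pair : ∀ p q r → + 4 ∣ Σ² p q r - + 26 → + 2 ∣ r → (+ 4 ∣ p - q) ⊎ (+ 4 ∣ p - (0ℤ - q))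
    odd-pair p q r = by-residues 4 (4 ∣′ sumSq x₀ x₁ x₂ ⊖ con (+ 26) ⇒′ 2 ∣′ x₂ ⇒′ 4 ∣′ x₀ ⊖ x₁ ∨′ 4 ∣′ x₀ ⊖ neg x₁) tt (p ∷ q ∷ r ∷ [])

    Suitable₃ : ℤ → ℤ → ℤ → Set
    Suitable₃ p q r = (+ 3 ∣ p + q + r) × (+ 3 ∣ p - q → + 3 ∣ + 1)

    suitable₃ : ∀ {k} → Expr k → Expr k → Expr k → Formula k
    suitable₃ p q r = 3 ∣′ p ⊕ q ⊕ r ∧′ (3 ∣′ p ⊖ q ⇒′ 3 ∣′ con (+ 1))

    -- As 26 ≡ 2 modulo 3, exactly one entry is divisible by 3, and it is not r. So 3 ∤ p - q and p
    -- + q ≡ ±r, which the sign of r turns into p + q + r ≡ 0.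
    three-adic : ∀ p q r → + 3 ∣ Σ² p q r - + 26 → (+ 3 ∣ r → + 3 ∣ + 1) → Suitable₃ p q r ⊎ Suitable₃ p q (0ℤ - r)
    three-adic p q r = by-residues 3 (3 ∣′ sumSq x₀ x₁ x₂ ⊖ con (+ 26) ⇒′ (3 ∣′ x₂ ⇒′ 3 ∣′ con (+ 1)) ⇒′
      suitable₃ x₀ x₁ x₂ ∨′ suitable₃ x₀ x₁ (neg x₂)) tt (p ∷ q ∷ r ∷ [])

    prime-to-3 : ∀ p q r → Sum26 p q r → + 2 ∣ r → ¬ + 3 ∣ r → Goal
    prime-to-3 p q r eq 2∣r 3∤r = case odd-pair p q r (weaken {p = p} {q} {r} (from-yes (4 ℕ.∣? 96)) eq) 2∣r of λ where
        (inj₁ 4∣) → signed p q eq 4∣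
        (inj₂ 4∣) → signed p (0ℤ - q) (swap-q p q r eq) 4∣
      where
      signed : ∀ p q → Sum26 p q r → + 4 ∣ p - q → Goal
      signed p q eq 4∣ = case three-adic p q r (weaken {p = p} {q} {r} (from-yes (3 ℕ.∣? 96)) eq) (λ 3∣r → contradiction 3∣r 3∤r) of λ where
        (inj₁ (3∣ , 3∤)) → suitable p q r eq 2∣r 4∣ 3∣ 3∤
        (inj₂ (3∣ , 3∤)) → suitable p q (0ℤ - r) (swap-r p q r eq) (-∣ 2∣r) 4∣ 3∣ 3∤

    -- Reflecting (6k + ζ , 6k - ζ , 12w) in (1 , 1 , 1) subtracts 8 (k + w) from each entry.
    reflect : ∀ ζ k w → Sum26 (+ 6 * k + ζ) (+ 6 * k - ζ) (+ 12 * w) → ¬ + 3 ∣ k + w → Goal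
    reflect ζ k w eq 3∤ = prime-to-3 (+ 6 * k + ζ - + 8 * (k + w)) (+ 6 * k - ζ - + 8 * (k + w)) (+ 12 * w - + 8 * (k + w))
        (trans (lem ζ k w) eq) (divides (+ 6 * w - + 4 * (k + w)) (lem₂ w (k + w)))
        -- Modulo 3 the new third entry 12w - 8(k + w) is k + w.
        (λ 3∣ → 3∤ (∣-resp (lem₃ w (k + w)) (∣m∣n⇒∣m+n 3∣ (∣n⇒∣m*n (+ 3 * (k + w) - + 4 * w) ∣-refl))))
      where
      lem : ∀ ζ k w → (+ 6 * k + ζ - + 8 * (k + w)) * (+ 6 * k + ζ - + 8 * (k + w)) + (+ 6 * k - ζ - + 8 * (k + w)) * (+ 6 * k - ζ - + 8 * (k + w)) +
                      (+ 12 * w - + 8 * (k + w)) * (+ 12 * w - + 8 * (k + w)) ≡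
                      (+ 6 * k + ζ) * (+ 6 * k + ζ) + (+ 6 * k - ζ) * (+ 6 * k - ζ) + + 12 * w * (+ 12 * w)
      lem = solve-∀
      lem₂ : ∀ w j → + 12 * w - + 8 * j ≡ (+ 6 * w - + 4 * j) * + 2
      lem₂ = solve-∀
      lem₃ : ∀ w j → + 12 * w - + 8 * j + (+ 3 * j - + 4 * w) * + 3 ≡ j
      lem₃ = solve-∀

    -- With ζ fixed, only the norm k² + 2w² matters, so (k , w) may be exchanged for another pair of
    -- the same norm.
    norm-form : ∀ ζ k w → Σ² (+ 6 * k + ζ) (+ 6 * k - ζ) (+ 12 * w) ≡ + 2 * (ζ * ζ) + + 72 * Threes.Norm k w
    norm-form = lem
      where lem : ∀ ζ k w → (+ 6 * k + ζ) * (+ 6 * k + ζ) + (+ 6 * k - ζ) * (+ 6 * k - ζ) + + 12 * w * (+ 12 * w) ≡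
                            + 2 * (ζ * ζ) + + 72 * (k * k + + 2 * (w * w))
            lem = solve-∀

    nonsquare : ∀ ζ → ¬ + 32 ∣ + 2 * (ζ * ζ) - + 26
    nonsquare ζ d = from-no (32 ℕ.∣? 1) (∣⇒∣ᵤ (by-residues 32 (32 ∣′ con (+ 2) ⊗ (x₀ ⊗ x₀) ⊖ con (+ 26) ⇒′ 32 ∣′ con (+ 1)) tt (ζ ∷ []) d))

    -- For a primitive pair (u , v), 3 does not divide both u + v and u - v, so a reflection, with v
    -- or -v, makes the third entry prime to 3. The case k = w = 0 would give 2ζ² ≡ 26 modulo 32,
    -- but 13 is not a square modulo 16.
    degenerate : ∀ ζ k w → Sum26 (+ 6 * k + ζ) (+ 6 * k - ζ) (+ 12 * w) → Goal
    degenerate ζ k w eq = continue (Threes.primitive-representation k w nonzero)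
      where
      nonzero : Threes.Nonzero k w
      nonzero (refl , refl) = nonsquare ζ (∣-resp (cong (_- + 26) (trans (norm-form ζ 0ℤ 0ℤ) (ℤ.+-identityʳ (+ 2 * (ζ * ζ)))))
        (weaken {p = 0ℤ + ζ} {0ℤ - ζ} {0ℤ} (from-yes (32 ℕ.∣? 96)) eq))
      continue : Threes.Result (Threes.Norm k w) → Goal
      continue (u , v , norm , not-both) = case (+ 3 ∣? u + v) of λ where
          (no 3∤) → reflect ζ u v eq′ 3∤
          (yes 3∣) → reflect ζ u (- v) (trans (lem ζ u v) eq′)
            (λ 3∣′ → not-both (both u v 3∣ 3∣′))
        where
        eq′ : Sum26 (+ 6 * u + ζ) (+ 6 * u - ζ) (+ 12 * v)
        eq′ = trans (norm-form ζ u v) (trans (cong (λ t → + 2 * (ζ * ζ) + + 72 * t) norm) (trans (sym (norm-form ζ k w)) eq))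
        lem : ∀ ζ u v → (+ 6 * u + ζ) * (+ 6 * u + ζ) + (+ 6 * u - ζ) * (+ 6 * u - ζ) + + 12 * - v * (+ 12 * - v) ≡
                        (+ 6 * u + ζ) * (+ 6 * u + ζ) + (+ 6 * u - ζ) * (+ 6 * u - ζ) + + 12 * v * (+ 12 * v)
        lem = solve-∀
        both : ∀ u v → + 3 ∣ u + v → + 3 ∣ u + - v → (+ 3 ∣ u) × (+ 3 ∣ v)
        both u v = by-residues 3 (3 ∣′ x₀ ⊕ x₁ ⇒′ 3 ∣′ x₀ ⊖ x₁ ⇒′ 3 ∣′ x₀ ∧′ 3 ∣′ x₁) tt (u ∷ v ∷ [])

    twelve : ∀ p q r → Sum26 p q r → + 12 ∣ p + q → + 12 ∣ r → Goal
    twelve p q r eq (divides k s≡) (divides w r≡) = degenerate (p - + 6 * k) k w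
      (trans (cong₂ (λ s t → s * s + t * t + + 12 * w * (+ 12 * w)) (lem₁ p k) q≡) (trans (cong (λ t → p * p + q * q + t * t) (trans (ℤ.*-comm (+ 12) w) (sym r≡))) eq))
      where
      lem₁ : ∀ p k → + 6 * k + (p - + 6 * k) ≡ p
      lem₁ = solve-∀
      lem₂ : ∀ p k → + 6 * k - (p - + 6 * k) ≡ k * + 12 - p
      lem₂ = solve-∀
      lem₃ : ∀ p q → p + q - p ≡ q
      lem₃ = solve-∀
      q≡ : + 6 * k - (p - + 6 * k) ≡ q
      q≡ = trans (lem₂ p k) (trans (cong (_- p) (sym s≡)) (lem₃ p q))

    four∣r : ∀ p q r → + 16 ∣ Σ² p q r - + 26 → + 2 ∣ r → + 4 ∣ r
    four∣r p q r = by-residues 16 (16 ∣′ sumSq x₀ x₁ x₂ ⊖ con (+ 26) ⇒′ 2 ∣′ x₂ ⇒′ 4 ∣′ x₂) tt (p ∷ q ∷ r ∷ [])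

    twelve∣ : ∀ x → + 4 ∣ x → + 3 ∣ x → + 12 ∣ x
    twelve∣ x = by-residues 12 (4 ∣′ x₀ ⇒′ 3 ∣′ x₀ ⇒′ 12 ∣′ x₀) tt (x ∷ [])

    three∣r : ∀ p q r → + 3 ∣ Σ² p q r - + 26 → + 3 ∣ r → (+ 3 ∣ p - q) ⊎ Suitable₃ p q r
    three∣r p q r = by-residues 3 (3 ∣′ sumSq x₀ x₁ x₂ ⊖ con (+ 26) ⇒′ 3 ∣′ x₂ ⇒′ 3 ∣′ x₀ ⊖ x₁ ∨′ suitable₃ x₀ x₁ x₂) tt (p ∷ q ∷ r ∷ [])

    -- With the sign of q chosen so that 4 ∣ p - q, the one exceptional case is 3 ∣ r and p ≡ q
    -- modulo 3; there both p - q and r are divisible by 12.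
    even-r : ∀ p q r → Sum26 p q r → + 2 ∣ r → Goal
    even-r p q r eq 2∣r = case (+ 3 ∣? r) of λ where
        (no 3∤r)  → prime-to-3 p q r eq 2∣r 3∤r
        (yes 3∣r) → case odd-pair p q r (weaken {p = p} {q} {r} (from-yes (4 ℕ.∣? 96)) eq) 2∣r of λ where
          (inj₁ 4∣) → signed p q eq 4∣ 3∣r
          (inj₂ 4∣) → signed p (0ℤ - q) (swap-q p q r eq) 4∣ 3∣r
      where
      lem : ∀ p q → p - q ≡ p + (0ℤ - q)
      lem = solve-∀
      signed : ∀ p q → Sum26 p q r → + 4 ∣ p - q → + 3 ∣ r → Goal
      signed p q eq 4∣ 3∣r = case three∣r p q r (weaken {p = p} {q} {r} (from-yes (3 ℕ.∣? 96)) eq) 3∣r of λ where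
        (inj₁ 3∣) → twelve p (0ℤ - q) r (swap-q p q r eq) (∣-resp (lem p q) (twelve∣ (p - q) 4∣ 3∣))
          (twelve∣ r (four∣r p q r (weaken {p = p} {q} {r} (from-yes (16 ℕ.∣? 96)) eq) 2∣r) 3∣r)
        (inj₂ (3∣ , 3∤)) → suitable p q r eq 2∣r 4∣ 3∣ 3∤

    some-even : ∀ p q r → + 4 ∣ Σ² p q r - + 26 → (+ 2 ∣ r) ⊎ (+ 2 ∣ p) ⊎ (+ 2 ∣ q)
    some-even p q r = by-residues 4 (4 ∣′ sumSq x₀ x₁ x₂ ⊖ con (+ 26) ⇒′ 2 ∣′ x₂ ∨′ 2 ∣′ x₀ ∨′ 2 ∣′ x₁) tt (p ∷ q ∷ r ∷ [])

    solve : SumOfThreeSquares (26 ℕ.+ 96 ℕ.* n) → Goal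
    solve (p , q , r , eq) = case some-even p q r (weaken {p = p} {q} {r} (from-yes (4 ℕ.∣? 96)) eq) of λ where
      (inj₁ 2∣r)        → even-r p q r eq 2∣r
      (inj₂ (inj₁ 2∣p)) → even-r q r p (rotate p q r eq) 2∣p
      (inj₂ (inj₂ 2∣q)) → even-r p r q (exchange p q r eq) 2∣q

  solvable-234 : ∀ n → Solvable (+ 2) (+ 3) (+ 4) n
  solvable-234 n = Solve₂₃₄.solve n (subst SumOfThreeSquares (lem n) (three-squares-2mod4 (6 ℕ.+ 24 ℕ.* n)))
    where
    lem : ∀ n → 2 ℕ.+ 4 ℕ.* (6 ℕ.+ 24 ℕ.* n) ≡ 26 ℕ.+ 96 ℕ.* n
    lem = ℕ.solve-∀

-- Nonnegativity of the values.

module Nonnegative where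

  open import Defs using (f)
  open import Data.Integer.Base using (-[1+_]; _≤_; +≤+)

  -- For x < 0 both factors are at most 0, because the coefficient is at least 1.
  term-≥0 : ∀ a x → 0ℤ ≤ x * (+ suc a * x + 1ℤ)
  term-≥0 a (+ n)      = subst (0ℤ ≤_) (trans (ℤ.pos-* n _) (cong (λ t → + n * (t + 1ℤ)) (ℤ.pos-* (suc a) n))) (+≤+ z≤n)
  term-≥0 a -[1+ n ] = subst (λ t → 0ℤ ≤ -[1+ n ] * t) (sym (value (n ℕ.+ a ℕ.* suc n))) (nonneg (n ℕ.+ a ℕ.* suc n))
    where
    value : ∀ k → -[1+ k ] + 1ℤ ≡ 0ℤ - + k
    value 0       = refl
    value (suc k) = refl
    nonneg : ∀ k → 0ℤ ≤ -[1+ n ] * (0ℤ - + k)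
    nonneg 0       = ℤ.≤-reflexive (sym (ℤ.*-zeroʳ -[1+ n ]))
    nonneg (suc k) = +≤+ z≤n

  f-≥0 : ∀ a b c x y z → 0ℤ ≤ f (+ suc a) (+ suc b) (+ suc c) x y z
  f-≥0 a b c x y z = ℤ.+-mono-≤ (ℤ.+-mono-≤ (term-≥0 a x) (term-≥0 b y)) (term-≥0 c z)

open import Defs
open import Data.Nat using (ℕ)
open import Data.Integer using (ℤ; +_; _≤_)
open import Data.List.Membership.Propositional using (_∈_)
open import Data.Product using (_×_; _,_; ∃; ∃-syntax)
open import Relation.Binary.PropositionalEquality using (_≡_)
open import Data.List.Relation.Unary.Any using (here; there)
open import Relation.Binary.PropositionalEquality using (refl)

theorem1p2 : (a b c : ℕ) → (a , b , c) ∈ triples →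
    ((x y z : ℤ) → + 0 ≤ f (+ a) (+ b) (+ c) x y z)
    × ((n : ℕ) → ∃[ x ] ∃[ y ] ∃[ z ] f (+ a) (+ b) (+ c) x y z ≡ + n)
theorem1p2 _ _ _ (here refl) = Nonnegative.f-≥0 0 1 2 , Triples.solvable-123
theorem1p2 _ _ _ (there (here refl)) = Nonnegative.f-≥0 0 1 3 , Triples.solvable-124
theorem1p2 _ _ _ (there (there (here refl))) = Nonnegative.f-≥0 0 1 4 , Descent.solvable-125
theorem1p2 _ _ _ (there (there (there (here refl)))) = Nonnegative.f-≥0 1 1 3 , Triples.solvable-224
theorem1p2 _ _ _ (there (there (there (there (here refl))))) = Nonnegative.f-≥0 1 1 4 , Descent.solvable-225
theorem1p2 _ _ _ (there (there (there (there (there (here refl)))))) = Nonnegative.f-≥0 1 2 2 , Triples.solvable-233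
theorem1p2 _ _ _ (there (there (there (there (there (there (here refl))))))) = Nonnegative.f-≥0 1 2 3 , Descent.solvable-234
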